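{- For any set of rule schemes $\mathcal{R}\subseteq\{N,H,P,F,wF\}$, the logic $i\mathbf{STL}(\mathcal{R})$ is complete with respect to the class of all $\mathbf{K}(\mathcal{R})$-Kripke models: if a sequent $\Gamma\Rightarrow A$ of $\mathcal{L}_\nabla$ is valid in every $\mathbf{K}(\mathcal{R})$-Kripke model, then $i\mathbf{STL}(\mathcal{R})\vdash\Gamma\Rightarrow A$.
   Context: Language $\mathcal{L}_\nabla$: formulas from atoms and constants $\top,\bot,1$ by $\wedge,\vee,\otimes,\to$ and unary $\nabla$; sequents $\Gamma\Rightarrow A$ with $\Gamma$ a finite sequence, $\nabla\Gamma$ applying $\nabla$ to each member. $\mathbf{STL}$: axioms $A\Rightarrow A$; $\Rightarrow1$; $\nabla1\Rightarrow1$; $\Gamma\Rightarrow\top$; $\Gamma,\bot,\Sigma\Rightarrow A$; cut (from $\Gamma\Rightarrow A$, $\Pi,A,\Sigma\Rightarrow B$ infer $\Pi,\Gamma,\Sigma\Rightarrow B$); $L\wedge$ (from $\Gamma,A,\Sigma\Rightarrow C$ infer $\Gamma,A\wedge B,\Sigma\Rightarrow C$ and $\Gamma,B\wedge A,\Sigma\Rightarrow C$); $R\wedge$ (from $\Gamma\Rightarrow A,\Gamma\Rightarrow B$ infer $\Gamma\Rightarrow A\wedge B$); $L\vee$ (from $\Gamma,A,\Sigma\Rightarrow C$ and $\Gamma,B,\Sigma\Rightarrow C$ infer $\Gamma,A\vee B,\Sigma\Rightarrow C$); $R\vee$ (from $\Gamma\Rightarrow A$ infer $\Gamma\Rightarrow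 A\vee B$ and $\Gamma\Rightarrow B\vee A$); $L1$ (from $\Gamma,\Sigma\Rightarrow A$ infer $\Gamma,1,\Sigma\Rightarrow A$); $L\otimes$ (from $\Gamma,A,B,\Sigma\Rightarrow C$ infer $\Gamma,A\otimes B,\Sigma\Rightarrow C$); $R\otimes$ (from $\Gamma\Rightarrow A$, $\Sigma\Rightarrow B$ infer $\Gamma,\Sigma\Rightarrow A\otimes B$); $\nabla$ (from $A\Rightarrow B$ infer $\nabla A\Rightarrow\nabla B$); Oplax (from $\nabla A,\nabla B\Rightarrow C$ infer $\nabla(A\otimes B)\Rightarrow C$); $L\to$ (from $\Gamma\Rightarrow A$ and $\Pi,B,\Sigma\Rightarrow C$ infer $\Pi,\Gamma,\nabla(A\to B),\Sigma\Rightarrow C$); $R\to$ (from $A,\nabla\Gamma\Rightarrow B$ infer $\Gamma\Rightarrow A\to B$). Schemes: $(N)$ from $\Gamma\Rightarrow A$ infer $\nabla\Gamma\Rightarrow\nabla A$; $(P)$ from $\Gamma\Rightarrow\nabla A$ infer $\Gamma\Rightarrow A$; $(F)$ from $\Gamma\Rightarrow A$ infer $\Gamma\Rightarrow\nabla A$; $(wF)$ from $\nabla A\Rightarrow\bot$ infer $A\Rightarrow\bot$; $(H)$ from $\Gamma,A_1\to B_1,\dots,A_n\to B_n\Rightarrow C$ infer $\nabla\Gamma,\nabla A_1\to\nabla B_1,\dots,\nabla A_n\to\nabla B_n\Rightarrow\nabla C$. $i\mathbf{STL}(\mathcal{R})$ is $\mathbf{STL}$ plus the schemes in $\mathcal{R}$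 plus left weakening, contraction and exchange. A Kripke model is $(W,\leq,R,V)$ with $(W,\leq)$ a poset, $R\subseteq W\times W$ compatible with $\leq$ ($(u,v)\in R$, $u'\leq u$, $v\leq v'$ imply $(u',v')\in R$), $V$ assigning upsets to atoms. Forcing: $w\Vdash p$ iff $w\in V(p)$; $\top,1$ always forced, $\bot$ never; $\wedge$ and $\otimes$ as conjunction, $\vee$ as disjunction; $w\Vdash A\to B$ iff for all $v$ with $(w,v)\in R$, $v\Vdash A$ implies $v\Vdash B$; $w\Vdash\nabla A$ iff some $v$ with $(v,w)\in R$ has $v\Vdash A$. $\Gamma\Rightarrow A$ is valid if every $w$ forcing all of $\Gamma$ forces $A$. Conditions: $(N)$ normal (there is order preserving $\pi$ with $(u,v)\in R$ iff $u\leq\pi(v)$); $(H)$ normal with $\pi$ a poset isomorphism; $(P)$ $R\subseteq\leq$; $(F)$ $R$ reflexive; $(wF)$ $R$ serial. A $\mathbf{K}(\mathcal{R})$-Kripke model satisfies the conditions for all schemes in $\mathcal{R}$. -}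

module Defs where

open import Level using (Level; _⊔_) renaming (suc to lsuc)
open import Data.Nat using (ℕ)
open import Data.Bool using (Bool; T)
open import Data.List using (List; []; _∷_; _++_; map)
open import Data.List.Relation.Unary.All using (All)
open import Data.Product using (Σ; ∃; _×_; _,_)
open import Relation.Binary.PropositionalEquality using (_≡_)

infixr 6 _∧_ _∨_ _⊗_
infixr 5 _⊸_
infix  3 _⊢_⇒_

data Formula : Set where
  atom : ℕ → Formula
  ⊤′ ⊥′ 𝟏 : Formula
  _∧_ _∨_ _⊗_ _⊸_ : Formula → Formula → Formula
  ∇ : Formula → Formula

∇* : List Formula → List Formula
∇* = map ∇

data Scheme : Set where
  N H P F wF : Scheme

SchemeSet : Set
SchemeSet = Scheme → Bool

_∈R_ : Scheme → SchemeSet → Set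
S ∈R 𝓡 = T (𝓡 S)

imps : List (Formula × Formula) → List Formula
imps = map (λ { (a , b) → a ⊸ b })

∇imps : List (Formula × Formula) → List Formula
∇imps = map (λ { (a , b) → ∇ a ⊸ ∇ b })

data _⊢_⇒_ (𝓡 : SchemeSet) : List Formula → Formula → Set where
  ax     : ∀ {A} → 𝓡 ⊢ A ∷ [] ⇒ A
  R1     : 𝓡 ⊢ [] ⇒ 𝟏
  ∇1     : 𝓡 ⊢ ∇ 𝟏 ∷ [] ⇒ 𝟏
  R⊤     : ∀ {Γ} → 𝓡 ⊢ Γ ⇒ ⊤′
  L⊥     : ∀ {Γ Σ′ A} → 𝓡 ⊢ Γ ++ ⊥′ ∷ Σ′ ⇒ A
  cut    : ∀ {Γ Π Σ′ A B} → 𝓡 ⊢ Γ ⇒ A → 𝓡 ⊢ Π ++ A ∷ Σ′ ⇒ B → 𝓡 ⊢ Π ++ Γ ++ Σ′ ⇒ B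
  L∧₁    : ∀ {Γ Σ′ A B C} → 𝓡 ⊢ Γ ++ A ∷ Σ′ ⇒ C → 𝓡 ⊢ Γ ++ (A ∧ B) ∷ Σ′ ⇒ C
  L∧₂    : ∀ {Γ Σ′ A B C} → 𝓡 ⊢ Γ ++ A ∷ Σ′ ⇒ C → 𝓡 ⊢ Γ ++ (B ∧ A) ∷ Σ′ ⇒ C
  R∧     : ∀ {Γ A B} → 𝓡 ⊢ Γ ⇒ A → 𝓡 ⊢ Γ ⇒ B → 𝓡 ⊢ Γ ⇒ A ∧ B
  L∨     : ∀ {Γ Σ′ A B C} → 𝓡 ⊢ Γ ++ A ∷ Σ′ ⇒ C → 𝓡 ⊢ Γ ++ B ∷ Σ′ ⇒ C
           → 𝓡 ⊢ Γ ++ (A ∨ B) ∷ Σ′ ⇒ C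
  R∨₁    : ∀ {Γ A B} → 𝓡 ⊢ Γ ⇒ A → 𝓡 ⊢ Γ ⇒ A ∨ B
  R∨₂    : ∀ {Γ A B} → 𝓡 ⊢ Γ ⇒ A → 𝓡 ⊢ Γ ⇒ B ∨ A
  L1     : ∀ {Γ Σ′ A} → 𝓡 ⊢ Γ ++ Σ′ ⇒ A → 𝓡 ⊢ Γ ++ 𝟏 ∷ Σ′ ⇒ A
  L⊗     : ∀ {Γ Σ′ A B C} → 𝓡 ⊢ Γ ++ A ∷ B ∷ Σ′ ⇒ C → 𝓡 ⊢ Γ ++ (A ⊗ B) ∷ Σ′ ⇒ C
  R⊗     : ∀ {Γ Σ′ A B} → 𝓡 ⊢ Γ ⇒ A → 𝓡 ⊢ Σ′ ⇒ B → 𝓡 ⊢ Γ ++ Σ′ ⇒ A ⊗ B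
  ∇rule  : ∀ {A B} → 𝓡 ⊢ A ∷ [] ⇒ B → 𝓡 ⊢ ∇ A ∷ [] ⇒ ∇ B
  oplax  : ∀ {A B C} → 𝓡 ⊢ ∇ A ∷ ∇ B ∷ [] ⇒ C → 𝓡 ⊢ ∇ (A ⊗ B) ∷ [] ⇒ C
  L→     : ∀ {Γ Π Σ′ A B C} → 𝓡 ⊢ Γ ⇒ A → 𝓡 ⊢ Π ++ B ∷ Σ′ ⇒ C
           → 𝓡 ⊢ Π ++ Γ ++ ∇ (A ⊸ B) ∷ Σ′ ⇒ C
  R→     : ∀ {Γ A B} → 𝓡 ⊢ A ∷ ∇* Γ ⇒ B → 𝓡 ⊢ Γ ⇒ A ⊸ B
  schN   : ∀ {Γ A} → N ∈R 𝓡 → 𝓡 ⊢ Γ ⇒ A → 𝓡 ⊢ ∇* Γ ⇒ ∇ A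
  schP   : ∀ {Γ A} → P ∈R 𝓡 → 𝓡 ⊢ Γ ⇒ ∇ A → 𝓡 ⊢ Γ ⇒ A
  schF   : ∀ {Γ A} → F ∈R 𝓡 → 𝓡 ⊢ Γ ⇒ A → 𝓡 ⊢ Γ ⇒ ∇ A
  schwF  : ∀ {A} → wF ∈R 𝓡 → 𝓡 ⊢ ∇ A ∷ [] ⇒ ⊥′ → 𝓡 ⊢ A ∷ [] ⇒ ⊥′
  schH   : ∀ {Γ ps C} → H ∈R 𝓡 → 𝓡 ⊢ Γ ++ imps ps ⇒ C
           → 𝓡 ⊢ ∇* Γ ++ ∇imps ps ⇒ ∇ C
  weak   : ∀ {Γ Σ′ A B} → 𝓡 ⊢ Γ ++ Σ′ ⇒ B → 𝓡 ⊢ Γ ++ A ∷ Σ′ ⇒ B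
  contr  : ∀ {Γ Σ′ A B} → 𝓡 ⊢ Γ ++ A ∷ A ∷ Σ′ ⇒ B → 𝓡 ⊢ Γ ++ A ∷ Σ′ ⇒ B
  exch   : ∀ {Γ Σ′ A B C} → 𝓡 ⊢ Γ ++ A ∷ B ∷ Σ′ ⇒ C → 𝓡 ⊢ Γ ++ B ∷ A ∷ Σ′ ⇒ C

record KripkeModel (ℓ : Level) : Set (lsuc ℓ) where
  field
    W        : Set ℓ
    _≤_      : W → W → Set ℓ
    ≤-refl   : ∀ {w} → w ≤ w
    ≤-trans  : ∀ {u v w} → u ≤ v → v ≤ w → u ≤ w
    ≤-antisym : ∀ {u v} → u ≤ v → v ≤ u → u ≡ v
    R        : W → W → Set ℓ
    R-compat : ∀ {u v u′ v′} → R u v → u′ ≤ u → v ≤ v′ → R u′ v′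
    V        : ℕ → W → Set ℓ
    V-up     : ∀ {p u v} → u ≤ v → V p u → V p v

module _ {ℓ : Level} (M : KripkeModel ℓ) where
  open KripkeModel M
  open import Data.Unit.Polymorphic using (⊤)
  open import Data.Empty.Polymorphic using (⊥)
  open import Data.Sum using (_⊎_)

  infix 4 _⊩_
  _⊩_ : W → Formula → Set ℓ
  w ⊩ atom p = V p w
  w ⊩ ⊤′ = ⊤
  w ⊩ ⊥′ = ⊥
  w ⊩ 𝟏 = ⊤
  w ⊩ A ∧ B = (w ⊩ A) × (w ⊩ B)
  w ⊩ A ∨ B = (w ⊩ A) ⊎ (w ⊩ B)
  w ⊩ A ⊗ B = (w ⊩ A) × (w ⊩ B)
  w ⊩ A ⊸ B = ∀ v → R w v → v ⊩ A → v ⊩ B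
  w ⊩ ∇ A = Σ W (λ v → R v w × v ⊩ A)

  Valid : List Formula → Formula → Set ℓ
  Valid Γ A = ∀ w → All (w ⊩_) Γ → w ⊩ A

  Monotone : (W → W) → Set ℓ
  Monotone π = ∀ {u v} → u ≤ v → π u ≤ π v

  NormalVia : (W → W) → Set ℓ
  NormalVia π = Monotone π × (∀ u v → (R u v → u ≤ π v) × (u ≤ π v → R u v))

  Cond : Scheme → Set ℓ
  Cond N  = Σ (W → W) NormalVia
  Cond H  = Σ (W → W) λ π → NormalVia π ×
              Σ (W → W) λ π⁻¹ → Monotone π⁻¹ ×
                (∀ w → π (π⁻¹ w) ≡ w) × (∀ w → π⁻¹ (π w) ≡ w)
  Cond P  = ∀ u v → R u v → u ≤ v
  Cond F  = ∀ w → R w w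
  Cond wF = ∀ w → Σ W (λ v → R w v)

  IsK : SchemeSet → Set ℓ
  IsK 𝓡 = ∀ S → S ∈R 𝓡 → Cond S

{-# OPTIONS --safe #-}
module Submission where

-- Forcing of ∨ is a sum type, so the canonical model does not satisfy the truth lemma constructively.  With Ans the
-- derivability of the given sequent, reasoning under K X = (X → Ans) → Ans is classical and K commutes with finite
-- quantification.  Hence finitely many facts about canonical worlds (prime theories) may be collected, and it is
-- enough that these determine a countermodel with decidable labels, whose existence contradicts validity.
-- Let Φ be a finite set of formulas closed under subformulas and under A ⊸ B ↦ ∇ (A ⊸ B); the type of a world is its
-- trace on Φ.
--  * Without N and H, or with both F and P, the types of worlds form a countermodel.
--  * With N every world X has a predecessor πX = {A | ∇A ∈ X}, and points are orbits X, πX, π²X, … of types.  Without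
--    F and P only finitely many entries of an orbit matter, by the depth of the formulas involved; with H orbits
--    also extend backwards.
--  * With N and one of F and P, orbits are monotone, and by Dickson's lemma every world omitting a formula can be
--    enlarged to one, still omitting it, whose orbit stabilises after a uniformly bounded number of steps.
--  * With H and one of F and P, orbits are monotone sequences indexed by ℤ.  Long constant blocks of a consistent
--    sequence can be shortened, or extended to −∞, without losing consistency, so that finitely many sequences
--    together with their translates answer all demands.
-- Points carry an integer time stamp, which turns preorders into partial orders.

open import Defs
open import Level as Level using (Level; 0ℓ; Setω) renaming (_⊔_ to _⊔ˡ_)
open import Data.Bool using (Bool; true; false; T)
open import Data.Bool.Properties using (T?; T-irrelevant)
open import Data.Empty using (⊥; ⊥-elim)
open import Data.Unit using (⊤; tt)
open import Data.Nat as ℕ using (ℕ; zero; suc; z≤n; s≤s)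
import Data.Nat.Properties as ℕₚ
open import Data.Integer as ℤ using (ℤ; +_; -[1+_]; 0ℤ; 1ℤ; -1ℤ; _+_; -_; _-_; _≤_; _<_; _⊓_; _⊔_) renaming (suc to sucℤ; pred to predℤ)
import Data.Integer.Properties as ℤₚ
open import Data.Integer.Properties using (≤-refl; ≤-trans; ≤-reflexive; ≤-total; _≤?_; +-monoˡ-≤; +-monoʳ-≤; i≤suc[i]; suc-mono; suc-pred; +-assoc; +-comm; +-identityʳ; +-identityˡ; +-inverseʳ; i⊓j≤i; i⊓j≤j; i≤i⊔j; i≤j⊔i; ≰⇒>; <⇒≤; <⇒≱; i<j⇒suc[i]≤j; i≤pred[j]⇒i<j; i≤j⇒pred[i]≤j; neg-distrib-+; neg-involutive; ≤-antisym; i≤j⇒0≤j-i)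
open import Data.Integer.Solver using (module +-*-Solver)
open import Data.Fin using (Fin; zero; suc; toℕ; fromℕ<)
open import Data.Fin.Properties using (toℕ-fromℕ<; toℕ<n)
open import Data.Maybe as Maybe using (Maybe; just; nothing; zipWith; Is-just)
open import Data.Maybe.Relation.Unary.Any using (just)
open import Data.Vec using (Vec; []; _∷_)
open import Data.Vec.Properties using (∷-injective)
open import Data.List using (List; []; _∷_; _++_; map; cartesianProductWith; length)
open import Data.List.Properties using (++-identityʳ; ++-assoc)
open import Data.List.Membership.Propositional using (_∈_)
open import Data.List.Membership.Propositional.Properties using (∈-++⁺ˡ; ∈-++⁺ʳ; ∈-++⁻; ∈-map⁺; ∈-map⁻; ∈-∃++; ∈-cartesianProductWith⁺)
open import Data.List.Relation.Unary.Any using (here; there)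
open import Data.List.Relation.Unary.All using (All; []; _∷_)
import Data.List.Relation.Unary.All as All
import Data.List.Relation.Unary.All.Properties as Allₚ
open import Data.Product using (Σ; ∃; _×_; _,_; proj₁; proj₂)
open import Data.Sum using (_⊎_; inj₁; inj₂; [_,_]′)
open import Function using (_∘_; id)
open import Relation.Nullary using (¬_; Dec; yes; no)
open import Relation.Nullary.Decidable using (map′; ⌊_⌋; toWitness; fromWitness)
open import Relation.Binary.PropositionalEquality using (_≡_; refl; sym; trans; cong; cong₂; subst; subst₂)

-- Validity gives information only through a model that has been built, so every appeal to excluded
-- middle must be settled beforehand, and K passes only through finitely many questions. This forces
-- finite data everywhere. Types alone fail under N, because the trace of a predecessor is not a
-- function of the trace of the world; hence orbits, which are infinite. Without F and P, evaluating
-- a formula inspects a bounded window and the remaining levels are arbitrary. F and P couple all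
-- levels: a window may be cut off only where the orbit has become constant, and although a monotone
-- orbit in a finite order does so, the moment is not bounded in advance. Under H there is a second
-- end at -∞, and ∇ (A ⊸ B) becomes intuitionistic implication, so that answering one demand
-- enlarges an entire orbit. Consistency of a sequence is then treated as a greatest fixed point: a
-- modified sequence is consistent once its demands are answered by consistent or similarly modified
-- ones, and soundness of the calculus for such a class is the coinduction principle. The required
-- block lengths arise by induction on the number of formulas omitted by the repeated type.

infix 4 _⊑_
_⊑_ : List Formula → List Formula → Set
Γ ⊑ Δ = ∀ {A} → A ∈ Γ → A ∈ Δ

-- Derived rules: contexts as sets, the adjoint of ∇, and consequences of H.

module Calculus (𝓡 : SchemeSet) where

  move : ∀ Δ Γ {Θ A C} → 𝓡 ⊢ Δ ++ A ∷ Γ ++ Θ ⇒ C → 𝓡 ⊢ Δ ++ Γ ++ A ∷ Θ ⇒ C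
  move Δ [] d = d
  move Δ (B ∷ Γ) {Θ} {A} {C} d =
    subst (λ Ξ → 𝓡 ⊢ Ξ ⇒ C) (++-assoc Δ (B ∷ []) (Γ ++ A ∷ Θ))
      (move (Δ ++ B ∷ []) Γ
        (subst (λ Ξ → 𝓡 ⊢ Ξ ⇒ C) (sym (++-assoc Δ (B ∷ []) (A ∷ Γ ++ Θ))) (exch {Γ = Δ} d)))

  absorb : ∀ {Γ A C} → A ∈ Γ → 𝓡 ⊢ A ∷ Γ ⇒ C → 𝓡 ⊢ Γ ⇒ C
  absorb {A = A} {C} m d with ∈-∃++ m
  ... | Δ , Θ , refl = contr {Γ = Δ} (move [] Δ d)

  weakenʳ : ∀ {Γ C} Δ → 𝓡 ⊢ Γ ⇒ C → 𝓡 ⊢ Γ ++ Δ ⇒ C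
  weakenʳ {Γ} {C} [] d = subst (λ Ξ → 𝓡 ⊢ Ξ ⇒ C) (sym (++-identityʳ Γ)) d
  weakenʳ {Γ} (B ∷ Δ) d = weak {Γ = Γ} (weakenʳ Δ d)

  absorbAll : ∀ Γ {Δ C} → Γ ⊑ Δ → 𝓡 ⊢ Γ ++ Δ ⇒ C → 𝓡 ⊢ Δ ⇒ C
  absorbAll [] s d = d
  absorbAll (B ∷ Γ) s d = absorbAll Γ (λ m → s (there m)) (absorb (∈-++⁺ʳ Γ (s (here refl))) d)

  -- With all structural rules a context acts as a set: `Δ` is appended by weakening, then each
  -- formula of `Γ` is moved next to its copy in `Δ` and contracted.
  weaken : ∀ {Γ Δ C} → Γ ⊑ Δ → 𝓡 ⊢ Γ ⇒ C → 𝓡 ⊢ Δ ⇒ C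
  weaken {Γ} {Δ} s d = absorbAll Γ s (weakenʳ Δ d)

  hyp : ∀ {Γ A} → A ∈ Γ → 𝓡 ⊢ Γ ⇒ A
  hyp m = weaken (λ { (here refl) → m }) ax

  cutSet : ∀ {Γ Δ A C} → 𝓡 ⊢ Γ ⇒ A → 𝓡 ⊢ A ∷ Δ ⇒ C → Γ ⊑ Δ → 𝓡 ⊢ Δ ⇒ C
  cutSet {Γ} d e s = absorbAll Γ s (cut {Π = []} d e)

  infixr 4 _⨟_
  _⨟_ : ∀ {Γ A C} → 𝓡 ⊢ Γ ⇒ A → 𝓡 ⊢ A ∷ [] ⇒ C → 𝓡 ⊢ Γ ⇒ C
  _⨟_ {Γ} {A} {C} d e = subst (λ Ξ → 𝓡 ⊢ Ξ ⇒ C) (++-identityʳ Γ) (cut {Π = []} {Σ′ = []} d e)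

  cutAll : ∀ {Γ Δ C} → (∀ {A} → A ∈ Γ → 𝓡 ⊢ Δ ⇒ A) → 𝓡 ⊢ Γ ++ Δ ⇒ C → 𝓡 ⊢ Δ ⇒ C
  cutAll {[]} h d = d
  cutAll {B ∷ Γ} h d = cutAll (λ m → h (there m)) (cutSet (h (here refl)) d (∈-++⁺ʳ Γ))

  cuts : ∀ {Γ Δ C} → (∀ {A} → A ∈ Γ → 𝓡 ⊢ Δ ⇒ A) → 𝓡 ⊢ Γ ⇒ C → 𝓡 ⊢ Δ ⇒ C
  cuts {Δ = Δ} h d = cutAll h (weakenʳ Δ d)

  ⋀ : List Formula → Formula
  ⋀ [] = ⊤′
  ⋀ (A ∷ Γ) = A ∧ ⋀ Γ

  ⋀-elim : ∀ {Γ A} → A ∈ Γ → 𝓡 ⊢ ⋀ Γ ∷ [] ⇒ A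
  ⋀-elim (here refl) = L∧₁ {Γ = []} ax
  ⋀-elim (there m) = L∧₂ {Γ = []} (⋀-elim m)

  ⋀-intro : ∀ Γ → 𝓡 ⊢ Γ ⇒ ⋀ Γ
  ⋀-intro [] = R⊤
  ⋀-intro (A ∷ Γ) = R∧ (hyp (here refl)) (weaken there (⋀-intro Γ))

  -- Semantically, truth at all accessible worlds. This is the right adjoint of `∇`: `∇□-elim` is
  -- the counit, `□∇-intro` the unit, and `transpose` one direction of the adjunction.
  □ : Formula → Formula
  □ A = ⊤′ ⊸ A

  ∇□-elim : ∀ {A} → 𝓡 ⊢ ∇ (□ A) ∷ [] ⇒ A
  ∇□-elim = L→ {Γ = []} {Π = []} R⊤ ax

  mp : ∀ {A B} → 𝓡 ⊢ A ∷ ∇ (A ⊸ B) ∷ [] ⇒ B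
  mp = L→ {Π = []} ax ax

  □∇-intro : ∀ {A} → 𝓡 ⊢ A ∷ [] ⇒ □ (∇ A)
  □∇-intro = R→ (hyp (there (here refl)))

  transpose : ∀ {A B} → 𝓡 ⊢ A ∷ [] ⇒ □ B → 𝓡 ⊢ ∇ A ∷ [] ⇒ B
  transpose d = ∇rule d ⨟ ∇□-elim

  -- A left adjoint preserves joins; `∇-⊥` is the empty case.
  ∇-∨ : ∀ {A B} → 𝓡 ⊢ ∇ (A ∨ B) ∷ [] ⇒ ∇ A ∨ ∇ B
  ∇-∨ = transpose (L∨ {Γ = []} (R→ (R∨₁ (hyp (there (here refl))))) (R→ (R∨₂ (hyp (there (here refl))))))

  ∇-⊥ : 𝓡 ⊢ ∇ ⊥′ ∷ [] ⇒ ⊥′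
  ∇-⊥ = transpose (L⊥ {Γ = []})

  -- H with an empty list of implications is N.
  normalRule : (N ∈R 𝓡 ⊎ H ∈R 𝓡) → ∀ {Γ A} → 𝓡 ⊢ Γ ⇒ A → 𝓡 ⊢ ∇* Γ ⇒ ∇ A
  normalRule (inj₁ n) d = schN n d
  normalRule (inj₂ h) {Γ} {A} d =
    subst (λ Ξ → 𝓡 ⊢ Ξ ⇒ ∇ A) (++-identityʳ (∇* Γ))
      (schH {ps = []} h (subst (λ Ξ → 𝓡 ⊢ Ξ ⇒ A) (sym (++-identityʳ Γ)) d))

  module Automorphism (h : H ∈R 𝓡) where

    nec : ∀ {Γ A} → 𝓡 ⊢ Γ ⇒ A → 𝓡 ⊢ ∇* Γ ⇒ ∇ A
    nec = normalRule (inj₂ h)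

    ∇⊸ : ∀ {A B} → 𝓡 ⊢ (∇ A ⊸ ∇ B) ∷ [] ⇒ ∇ (A ⊸ B)
    ∇⊸ {A} {B} = schH {Γ = []} {ps = (A , B) ∷ []} h ax

    ⊸∇ : ∀ {A B} → 𝓡 ⊢ ∇ (A ⊸ B) ∷ [] ⇒ ∇ A ⊸ ∇ B
    ⊸∇ = R→ (nec mp)

    -- The hypothesis gives `∇ ⊤′ ⊸ ∇ A`, which H turns into `∇ (⊤′ ⊸ A)`. Together with the
    -- adjunction this makes `□` and `∇` mutually inverse up to interderivability.
    □∇-∇□ : ∀ {A} → 𝓡 ⊢ □ (∇ A) ∷ [] ⇒ ∇ (□ A)
    □∇-∇□ = R→ (∇□-elim′) ⨟ ∇⊸
      where
      ∇□-elim′ : ∀ {A} → 𝓡 ⊢ ∇ ⊤′ ∷ ∇ (□ (∇ A)) ∷ [] ⇒ ∇ A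
      ∇□-elim′ = weaken there ∇□-elim

    ∇□-intro : ∀ {A} → 𝓡 ⊢ A ∷ [] ⇒ ∇ (□ A)
    ∇□-intro = □∇-intro ⨟ □∇-∇□

    □∇-elim : ∀ {A} → 𝓡 ⊢ □ (∇ A) ∷ [] ⇒ A
    □∇-elim = □∇-∇□ ⨟ ∇□-elim

    □-nec : ∀ {Γ A} → 𝓡 ⊢ Γ ⇒ A → 𝓡 ⊢ map □ Γ ⇒ □ A
    □-nec {Γ} d = R→ (weaken there (cuts (λ m → h′ m) d))
      where
      h′ : ∀ {B} → B ∈ Γ → 𝓡 ⊢ ∇* (map □ Γ) ⇒ B
      h′ m = weaken (λ { (here refl) → ∈-map⁺ ∇ (∈-map⁺ □ m) }) ∇□-elim

    □-mono : ∀ {A B} → 𝓡 ⊢ A ∷ [] ⇒ B → 𝓡 ⊢ □ A ∷ [] ⇒ □ B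
    □-mono = □-nec

    □-∨ : ∀ {A B} → 𝓡 ⊢ □ (A ∨ B) ∷ [] ⇒ □ A ∨ □ B
    □-∨ = □-mono (L∨ {Γ = []} (∇□-intro ⨟ ∇rule (R∨₁ ax)) (∇□-intro ⨟ ∇rule (R∨₂ ax))) ⨟ □∇-elim

    □-⊥ : 𝓡 ⊢ □ ⊥′ ∷ [] ⇒ ⊥′
    □-⊥ = □-mono (L⊥ {Γ = []}) ⨟ □∇-elim

    -- Every hypothesis is replaced by its equivalent `∇ (□ C)`, so that `R→` and necessitation
    -- apply. With `mp` as elimination, `∇ (A ⊸ B)` is the intuitionistic implication from `A` to
    -- `B`.
    ⇒-intro : ∀ {Γ A B} → 𝓡 ⊢ A ∷ Γ ⇒ B → 𝓡 ⊢ Γ ⇒ ∇ (A ⊸ B)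
    ⇒-intro {Γ} {A} {B} d = cuts back (nec (R→ {Γ = map □ Γ} (cuts fwd d)))
      where
      fwd : ∀ {C} → C ∈ A ∷ Γ → 𝓡 ⊢ A ∷ ∇* (map □ Γ) ⇒ C
      fwd (here refl) = hyp (here refl)
      fwd (there m) = weaken (λ { (here refl) → there (∈-map⁺ ∇ (∈-map⁺ □ m)) }) ∇□-elim
      back : ∀ {C} → C ∈ ∇* (map □ Γ) → 𝓡 ⊢ Γ ⇒ C
      back m with ∈-map⁻ ∇ m
      ... | _ , m′ , refl with ∈-map⁻ □ m′
      ... | _ , m″ , refl = weaken (λ { (here refl) → m″ }) ∇□-intro

    ∇□⊸ : ∀ {A B} → 𝓡 ⊢ ∇ (□ A ⊸ □ B) ∷ [] ⇒ A ⊸ B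
    ∇□⊸ {A} {B} = ⊸∇ ⨟ R→ (cuts (λ { (here refl) → weaken (λ { (here refl) → here refl }) ∇□-intro
                                    ; (there (here refl)) → hyp (there (here refl)) })
                          (mp ⨟ ∇□-elim))

    □⊸ : ∀ {A B} → 𝓡 ⊢ ∇ (□ A ⊸ □ B) ∷ [] ⇒ □ (∇ (A ⊸ B))
    □⊸ = ∇□⊸ ⨟ □∇-intro

-- Exhausting the formulas by finite lists.

enum : ℕ → List Formula
enum zero = []
enum (suc n) = atom n ∷ ⊤′ ∷ ⊥′ ∷ 𝟏 ∷ enum n
  ++ cartesianProductWith _∧_ (enum n) (enum n)
  ++ cartesianProductWith _∨_ (enum n) (enum n)
  ++ cartesianProductWith _⊗_ (enum n) (enum n)
  ++ cartesianProductWith _⊸_ (enum n) (enum n)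
  ++ map ∇ (enum n)

enum-suc : ∀ {n A} → A ∈ enum n → A ∈ enum (suc n)
enum-suc m = there (there (there (there (∈-++⁺ˡ m))))

enum-mono : ∀ {m n A} → m ℕ.≤ n → A ∈ enum m → A ∈ enum n
enum-mono l = go (ℕₚ.≤⇒≤′ l)
  where
  go : ∀ {m n A} → m ℕ.≤′ n → A ∈ enum m → A ∈ enum n
  go ℕ.≤′-refl p = p
  go (ℕ.≤′-step l) p = enum-suc (go l p)

enumerated : ∀ A → ∃ λ n → A ∈ enum n
enumerated (atom n) = suc n , here refl
enumerated ⊤′ = 1 , there (here refl)
enumerated ⊥′ = 1 , there (there (here refl))
enumerated 𝟏 = 1 , there (there (there (here refl)))
enumerated (A ∧ B) with enumerated A | enumerated B
... | m , p | n , q = suc (m ℕ.⊔ n) , there (there (there (there (∈-++⁺ʳ (enum (m ℕ.⊔ n)) (∈-++⁺ˡ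
      (∈-cartesianProductWith⁺ _∧_ (enum-mono (ℕₚ.m≤m⊔n m n) p) (enum-mono (ℕₚ.m≤n⊔m m n) q)))))))
enumerated (A ∨ B) with enumerated A | enumerated B
... | m , p | n , q = suc (m ℕ.⊔ n) , there (there (there (there (∈-++⁺ʳ (enum (m ℕ.⊔ n))
      (∈-++⁺ʳ (cartesianProductWith _∧_ (enum (m ℕ.⊔ n)) _) (∈-++⁺ˡ
      (∈-cartesianProductWith⁺ _∨_ (enum-mono (ℕₚ.m≤m⊔n m n) p) (enum-mono (ℕₚ.m≤n⊔m m n) q))))))))
enumerated (A ⊗ B) with enumerated A | enumerated B
... | m , p | n , q = suc (m ℕ.⊔ n) , there (there (there (there (∈-++⁺ʳ (enum (m ℕ.⊔ n))
      (∈-++⁺ʳ (cartesianProductWith _∧_ (enum (m ℕ.⊔ n)) _) (∈-++⁺ʳ (cartesianProductWith _∨_ (enum (m ℕ.⊔ n)) _) (∈-++⁺ˡ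
      (∈-cartesianProductWith⁺ _⊗_ (enum-mono (ℕₚ.m≤m⊔n m n) p) (enum-mono (ℕₚ.m≤n⊔m m n) q)))))))))
enumerated (A ⊸ B) with enumerated A | enumerated B
... | m , p | n , q = suc (m ℕ.⊔ n) , there (there (there (there (∈-++⁺ʳ (enum (m ℕ.⊔ n))
      (∈-++⁺ʳ (cartesianProductWith _∧_ (enum (m ℕ.⊔ n)) _) (∈-++⁺ʳ (cartesianProductWith _∨_ (enum (m ℕ.⊔ n)) _)
      (∈-++⁺ʳ (cartesianProductWith _⊗_ (enum (m ℕ.⊔ n)) _) (∈-++⁺ˡ
      (∈-cartesianProductWith⁺ _⊸_ (enum-mono (ℕₚ.m≤m⊔n m n) p) (enum-mono (ℕₚ.m≤n⊔m m n) q))))))))))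
enumerated (∇ A) with enumerated A
... | n , p = suc n , there (there (there (there (∈-++⁺ʳ (enum n)
      (∈-++⁺ʳ (cartesianProductWith _∧_ (enum n) _) (∈-++⁺ʳ (cartesianProductWith _∨_ (enum n) _)
      (∈-++⁺ʳ (cartesianProductWith _⊗_ (enum n) _) (∈-++⁺ʳ (cartesianProductWith _⊸_ (enum n) _)
      (∈-map⁺ ∇ p)))))))))

-- Prime theories relative to an answer type.

module Continuation (Ans : Set) where

  K : ∀ {ℓ} → Set ℓ → Set ℓ
  K X = (X → Ans) → Ans

module Canonical (𝓡 : SchemeSet) (Ans : Set) where

  open Calculus 𝓡
  open Continuation Ans

  Theory : Set₁
  Theory = Formula → Set

  -- A Lindenbaum extension does not decide which disjunct it contains, hence primality under `K`,
  -- and `Ans` replaces absurdity. Stability removes a `K` whenever the goal is a membership.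
  record World : Set₁ where
    field
      mem    : Theory
      closed : ∀ {Γ A} → All mem Γ → 𝓡 ⊢ Γ ⇒ A → mem A
      prime  : ∀ {A B} → mem (A ∨ B) → K (mem A ⊎ mem B)
      proper : mem ⊥′ → Ans
      stable : ∀ {A} → K (mem A) → mem A

  open World public

  -- Adding formulas one at a time as long as the ideal I stays underivable from the theory T₀.
  module Lindenbaum (T₀ I : Theory)
    (join : ∀ {A B} → I A → I B → I (A ∨ B)) (bot : I ⊥′)
    (avoids : ∀ {Γ B} → All T₀ Γ → I B → 𝓡 ⊢ Γ ⇒ B → Ans) where

    Con : Theory → Formula → Set
    Con S A = ∀ Γ B → All S Γ → I B → 𝓡 ⊢ A ∷ Γ ⇒ B → Ans

    -- Compatibility is demanded inside each proof that `A` belongs to the extension, so nothing has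
    -- to be decided when `A` is added.
    add : Theory → Formula → Theory
    add S A B = S B ⊎ (B ≡ A × Con S A)

    split : ∀ {S A Γ} → All (add S A) Γ → All S Γ ⊎ (Con S A × ∃ λ Δ → All S Δ × Γ ⊑ A ∷ Δ)
    split [] = inj₁ []
    split (inj₁ s ∷ ps) with split ps
    ... | inj₁ ss = inj₁ (s ∷ ss)
    ... | inj₂ (c , Δ , ss , sub) = inj₂ (c , _ ∷ Δ , s ∷ ss , λ { (here refl) → there (here refl)
        ; (there m) → keep (sub m) })
      where
      keep : ∀ {A B C Δ} → C ∈ A ∷ Δ → C ∈ A ∷ B ∷ Δ
      keep (here e) = here e
      keep (there m) = there (there m)
    split (inj₂ (refl , c) ∷ ps) with split ps
    ... | inj₁ ss = inj₂ (c , _ , ss , id)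
    ... | inj₂ (c′ , Δ , ss , sub) = inj₂ (c , Δ , ss , λ { (here refl) → here refl ; (there m) → sub m })

    Safe : Theory → Set
    Safe S = ∀ {Γ B} → All S Γ → I B → 𝓡 ⊢ Γ ⇒ B → Ans

    add-safe : ∀ {S A} → Safe S → Safe (add S A)
    add-safe safe ps i d with split ps
    ... | inj₁ ss = safe ss i d
    ... | inj₂ (c , Δ , ss , sub) = c _ _ ss i (weaken sub d)

    extend : Theory → List Formula → Theory
    extend S [] = S
    extend S (A ∷ l) = extend (add S A) l

    extend-⊇ : ∀ {S} l {A} → S A → extend S l A
    extend-⊇ [] s = s
    extend-⊇ (_ ∷ l) s = extend-⊇ l (inj₁ s)

    extend-safe : ∀ {S} l → Safe S → Safe (extend S l)
    extend-safe [] s = s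
    extend-safe (_ ∷ l) s = extend-safe l (add-safe s)

    stage : ℕ → Theory
    stage zero = T₀
    stage (suc n) = extend (stage n) (enum n)

    stage-safe : ∀ n → Safe (stage n)
    stage-safe zero = avoids
    stage-safe (suc n) = extend-safe (enum n) (stage-safe n)

    stage-mono : ∀ {m n A} → m ℕ.≤ n → stage m A → stage n A
    stage-mono l = go (ℕₚ.≤⇒≤′ l)
      where
      go : ∀ {m n A} → m ℕ.≤′ n → stage m A → stage n A
      go ℕ.≤′-refl s = s
      go (ℕ.≤′-step {n} l) s = extend-⊇ (enum n) (go l s)

    limit : Theory
    limit A = ∃ λ n → stage n A

    collect : ∀ {Γ} → All limit Γ → ∃ λ n → All (stage n) Γ
    collect [] = 0 , []
    collect ((m , s) ∷ ps) with collect ps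
    ... | n , ss = m ℕ.⊔ n , stage-mono (ℕₚ.m≤m⊔n m n) s ∷ All.map (stage-mono (ℕₚ.m≤n⊔m m n)) ss

    limit-safe : Safe limit
    limit-safe ps with collect ps
    ... | n , ss = stage-safe n ss

    -- Compatibility with `limit` ends in `Ans` and is therefore stable under `K`, which membership
    -- in `limit` is not evidently. The two coincide, since a formula compatible with the limit was
    -- compatible at the stage that considered it.
    member : Theory
    member = Con limit

    member-extend : ∀ {S} l {A} → (∀ {B} → extend S l B → limit B) → A ∈ l → member A → extend S l A
    member-extend (A ∷ l) inc (here refl) c =
      extend-⊇ l (inj₂ (refl , λ _ _ ss → c _ _ (All.map (λ s → inc (extend-⊇ l (inj₁ s))) ss)))
    member-extend (_ ∷ l) inc (there m) c = member-extend l inc m c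

    member-limit : ∀ {A} → member A → limit A
    member-limit {A} c with enumerated A
    ... | n , m = suc n , member-extend (enum n) (suc n ,_) m c

    limit-member : ∀ {A} → limit A → member A
    limit-member s _ _ ss = limit-safe (s ∷ ss)

    world : World
    world .mem = member
    world .closed ps d _ _ ss i e =
      limit-safe (Allₚ.++⁺ (All.map member-limit ps) ss) i
        (cutSet d (weaken (λ { (here refl) → here refl ; (there m) → there (∈-++⁺ʳ _ m) }) e) ∈-++⁺ˡ)
    -- The answer `A` is tried first; a derivation refuting it is retained while `B` is tried. The
    -- two refutations combine by `L∨` to a derivation of the join of two ideal elements.
    world .prime {A} {B} c k = k (inj₁ λ Γ _ ss i d → k (inj₂ λ _ _ ss′ i′ d′ →
      c _ _ (Allₚ.++⁺ ss ss′) (join i i′)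
        (L∨ {Γ = []} (R∨₁ (weaken (λ { (here refl) → here refl ; (there m) → there (∈-++⁺ˡ m) }) d))
                     (R∨₂ (weaken (λ { (here refl) → here refl ; (there m) → there (∈-++⁺ʳ Γ m) }) d′)))))
    world .proper c = c _ _ [] bot ax
    world .stable k _ _ ss i d = k (λ c → c _ _ ss i d)

    world-⊇ : ∀ {A} → T₀ A → mem world A
    world-⊇ s = limit-member (0 , s)

    world-avoids : ∀ {A} → I A → mem world A → Ans
    world-avoids i c = c _ _ [] i ax

  module Avoid (T₀ : Theory) (B : Formula) (avoids : ∀ {Γ} → All T₀ Γ → 𝓡 ⊢ Γ ⇒ B → Ans) where
    open Lindenbaum T₀ (λ C → 𝓡 ⊢ C ∷ [] ⇒ B) (L∨ {Γ = []}) (L⊥ {Γ = []}) (λ ss i d → avoids ss (d ⨟ i))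
      public using (world; world-⊇)
      renaming (world-avoids to world-avoids′)

    world-avoids : mem world B → Ans
    world-avoids = world-avoids′ ax

  entails : ∀ (X : World) {A B} → mem X A → 𝓡 ⊢ A ∷ [] ⇒ B → mem X B
  entails X a d = closed X (a ∷ []) d

  infix 4 _↦_
  _↦_ : World → World → Set
  X ↦ Y = ∀ {A} → mem X A → mem Y (∇ A)

  -- Extend `A` together with all `∇ D`, `D` in `X`, avoiding `B`; a derivation of `B` from these
  -- would put `A ⊸ B` into `X` by `R→`.
  refute-⊸ : (X : World) → ∀ {A B} → (mem X (A ⊸ B) → Ans) → Σ World λ Y → (X ↦ Y) × mem Y A × (mem Y B → Ans)
  refute-⊸ X {A} {B} k = world , (λ x → world-⊇ (inj₂ (_ , refl , x))) , world-⊇ (inj₁ refl) , world-avoids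
    where
    T₀ : Theory
    T₀ C = C ≡ A ⊎ ∃ λ D → C ≡ ∇ D × mem X D
    gather : ∀ {Γ} → All T₀ Γ → ∃ λ Δ → All (mem X) Δ × Γ ⊑ A ∷ ∇* Δ
    gather [] = [] , [] , λ ()
    gather (inj₁ refl ∷ ps) with gather ps
    ... | Δ , xs , sub = Δ , xs , λ { (here refl) → here refl ; (there m) → sub m }
    gather (inj₂ (D , refl , x) ∷ ps) with gather ps
    ... | Δ , xs , sub = D ∷ Δ , x ∷ xs , λ { (here refl) → there (here refl) ; (there m) → keep (sub m) }
      where
      keep : ∀ {C E Ξ} → C ∈ A ∷ Ξ → C ∈ A ∷ E ∷ Ξ
      keep (here e) = here e
      keep (there m) = there (there m)
    avoids : ∀ {Γ} → All T₀ Γ → 𝓡 ⊢ Γ ⇒ B → Ans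
    avoids ps d = let (Δ , xs , sub) = gather ps in k (closed X xs (R→ (weaken sub d)))
    open Avoid T₀ B avoids

  -- Start from `A` and avoid the formulas whose `∇` is missing from `Y`. These form an ideal
  -- because `∇` preserves disjunction and falsity, and avoiding them gives `X ↦ Y` by stability of
  -- `Y`.
  witness-∇ : (Y : World) → ∀ {A} → mem Y (∇ A) → Σ World λ X → (X ↦ Y) × mem X A
  witness-∇ Y {A} y = world , (λ x → stable Y (λ k → world-avoids k x)) , world-⊇ refl
    where
    sub : ∀ {Γ} → All (_≡ A) Γ → Γ ⊑ A ∷ []
    sub (refl ∷ _) (here e) = here e
    sub (_ ∷ ps) (there m) = sub ps m
    join : ∀ {B C} → (mem Y (∇ B) → Ans) → (mem Y (∇ C) → Ans) → mem Y (∇ (B ∨ C)) → Ans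
    join i j c = prime Y (entails Y c ∇-∨) [ i , j ]′
    open Lindenbaum (_≡ A) (λ C → mem Y (∇ C) → Ans) join
      (λ c → proper Y (entails Y c ∇-⊥))
      (λ ss i d → i (entails Y y (∇rule (weaken (sub ss) d))))

  -- If the formulas `∇ D` were inconsistent, finitely many `D` would suffice; wF treats one formula
  -- at a time, so they are merged into a conjunction.
  serial : wF ∈R 𝓡 → (X : World) → Σ World λ Y → X ↦ Y
  serial wf X = world , λ x → world-⊇ (_ , refl , x)
    where
    T₀ : Theory
    T₀ C = ∃ λ D → C ≡ ∇ D × mem X D
    gather : ∀ {Γ} → All T₀ Γ → ∃ λ Δ → All (mem X) Δ × Γ ⊑ ∇* Δ
    gather [] = [] , [] , λ ()
    gather ((D , refl , x) ∷ ps) with gather ps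
    ... | Δ , xs , sub = D ∷ Δ , x ∷ xs , λ { (here refl) → here refl ; (there m) → there (sub m) }
    avoids : ∀ {Γ} → All T₀ Γ → 𝓡 ⊢ Γ ⇒ ⊥′ → Ans
    avoids ps d = let (Δ , xs , sub) = gather ps in
      proper X (closed X xs (⋀-intro Δ ⨟ schwF wf (cuts
        (λ m → let (_ , m′ , e) = ∈-map⁻ ∇ (sub m) in subst (λ C → 𝓡 ⊢ ∇ (⋀ Δ) ∷ [] ⇒ C) (sym e) (∇rule (⋀-elim m′))) d)))
    open Avoid T₀ ⊥′ avoids

  predecessor : (N ∈R 𝓡 ⊎ H ∈R 𝓡) → World → World
  predecessor n X .mem A = mem X (∇ A)
  predecessor n X .closed ps d = closed X (Allₚ.map⁺ ps) (normalRule n d)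
  predecessor n X .prime c = prime X (entails X c ∇-∨)
  predecessor n X .proper c = proper X (entails X c ∇-⊥)
  predecessor n X .stable k = stable X k

-- Labelled structures and their truth lemma.

record Labelled : Set₁ where
  infix 4 _∋_
  field
    X    : Set
    R₀   : X → X → Set
    _∋_  : X → Formula → Set
    -- The formulas whose label at a point is reliable. In models cut down to windows this depends
    -- on the height of the point.
    rel  : X → Formula → Set
    rel∧ : ∀ {x A B} → rel x (A ∧ B) → rel x A × rel x B
    rel∨ : ∀ {x A B} → rel x (A ∨ B) → rel x A × rel x B
    rel⊗ : ∀ {x A B} → rel x (A ⊗ B) → rel x A × rel x B
    rel⊸ : ∀ {x y A B} → rel x (A ⊸ B) → R₀ x y → rel y A × rel y B
    rel∇ : ∀ {x y A} → rel x (∇ A) → R₀ y x → rel y A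
    ∋⊤   : ∀ {x} → rel x ⊤′ → x ∋ ⊤′
    ∋𝟏   : ∀ {x} → rel x 𝟏 → x ∋ 𝟏
    ∌⊥   : ∀ {x} → rel x ⊥′ → x ∋ ⊥′ → ⊥
    ∧⁺   : ∀ {x A B} → rel x (A ∧ B) → x ∋ A → x ∋ B → x ∋ A ∧ B
    ∧⁻   : ∀ {x A B} → rel x (A ∧ B) → x ∋ A ∧ B → x ∋ A × x ∋ B
    ⊗⁺   : ∀ {x A B} → rel x (A ⊗ B) → x ∋ A → x ∋ B → x ∋ A ⊗ B
    ⊗⁻   : ∀ {x A B} → rel x (A ⊗ B) → x ∋ A ⊗ B → x ∋ A × x ∋ B
    ∨⁺   : ∀ {x A B} → rel x (A ∨ B) → x ∋ A ⊎ x ∋ B → x ∋ A ∨ B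
    ∨⁻   : ∀ {x A B} → rel x (A ∨ B) → x ∋ A ∨ B → x ∋ A ⊎ x ∋ B
    ⊸⁻   : ∀ {x y A B} → rel x (A ⊸ B) → x ∋ A ⊸ B → R₀ x y → y ∋ A → y ∋ B
    ⊸?   : ∀ {x A B} → rel x (A ⊸ B) → x ∋ A ⊸ B ⊎ Σ X λ y → R₀ x y × y ∋ A × (y ∋ B → ⊥)
    ∇⁺   : ∀ {x y A} → rel x (∇ A) → R₀ y x → y ∋ A → x ∋ ∇ A
    ∇⁻   : ∀ {x A} → rel x (∇ A) → x ∋ ∇ A → Σ X λ y → R₀ y x × y ∋ A

-- The projection `pt` is a bounded morphism for accessibility in both directions: forward lifting
-- serves `⊸`, backward lifting serves `∇`. Copies of a point with different stamps thus share its
-- labels.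
module TruthLemma (L : Labelled) (M : KripkeModel 0ℓ) where
  open Labelled L
  open KripkeModel M

  module _
    (pt  : W → X)
    (val : ∀ {p u} → V p u → pt u ∋ atom p) (lav : ∀ {p u} → pt u ∋ atom p → V p u)
    (prj : ∀ {u v} → R u v → R₀ (pt u) (pt v))
    (fwd : ∀ {u y} → R₀ (pt u) y → Σ W λ v → R u v × pt v ≡ y)
    (bwd : ∀ {v x} → R₀ x (pt v) → Σ W λ u → R u v × pt u ≡ x) where

    sound    : ∀ A {u} → rel (pt u) A → pt u ∋ A → _⊩_ M u A
    complete : ∀ A {u} → rel (pt u) A → _⊩_ M u A → pt u ∋ A

    sound (atom p) r a = lav a
    sound ⊤′ r a = Level.lift tt
    sound ⊥′ r a = ⊥-elim (∌⊥ r a)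
    sound 𝟏 r a = Level.lift tt
    sound (A ∧ B) r a = let (p , q) = ∧⁻ r a ; (s , t) = rel∧ r in sound A s p , sound B t q
    sound (A ∨ B) r a with ∨⁻ r a
    ... | inj₁ p = inj₁ (sound A (proj₁ (rel∨ r)) p)
    ... | inj₂ q = inj₂ (sound B (proj₂ (rel∨ r)) q)
    sound (A ⊗ B) r a = let (p , q) = ⊗⁻ r a ; (s , t) = rel⊗ r in sound A s p , sound B t q
    sound (A ⊸ B) r a v uv f =
      let (s , t) = rel⊸ r (prj uv) in sound B t (⊸⁻ r a (prj uv) (complete A s f))
    sound (∇ A) r a with ∇⁻ r a
    ... | y , yx , b with bwd yx
    ... | v , vu , refl = v , vu , sound A (rel∇ r yx) b

    complete (atom p) r f = val f
    complete ⊤′ r f = ∋⊤ r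
    complete ⊥′ r (Level.lift ())
    complete 𝟏 r f = ∋𝟏 r
    complete (A ∧ B) r (f , g) = let (s , t) = rel∧ r in ∧⁺ r (complete A s f) (complete B t g)
    complete (A ∨ B) r (inj₁ f) = ∨⁺ r (inj₁ (complete A (proj₁ (rel∨ r)) f))
    complete (A ∨ B) r (inj₂ g) = ∨⁺ r (inj₂ (complete B (proj₂ (rel∨ r)) g))
    complete (A ⊗ B) r (f , g) = let (s , t) = rel⊗ r in ⊗⁺ r (complete A s f) (complete B t g)
    complete (A ⊸ B) r f with ⊸? r
    ... | inj₁ a = a
    ... | inj₂ (y , xy , a , nb) with fwd xy
    ... | v , uv , refl = let (s , t) = rel⊸ r xy in ⊥-elim (nb (complete B t (f v uv (sound A s a))))
    complete (∇ A) r (v , vu , f) = ∇⁺ r (prj vu) (complete A (rel∇ r (prj vu)) f)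

    refutes : ∀ {Γ A} u → All (λ B → rel (pt u) B × pt u ∋ B) Γ → rel (pt u) A → (pt u ∋ A → ⊥) → Valid M Γ A → ⊥
    refutes {Γ} {A} u as r n valid = n (complete A r (valid u (forces as)))
      where
      forces : ∀ {Δ} → All (λ B → rel (pt u) B × pt u ∋ B) Δ → All (_⊩_ M u) Δ
      forces [] = []
      forces ((s , a) ∷ as) = sound _ s a ∷ forces as

-- Time stamps and the frames built from them.

n<sucn : ∀ n → n < sucℤ n
n<sucn n = ℤₚ.≤-<-trans (ℤₚ.≤-reflexive (sym (ℤₚ.+-identityˡ n))) (ℤₚ.+-monoˡ-< n (ℤ.+<+ (ℕ.s≤s ℕ.z≤n)))

predn<n : ∀ n → predℤ n < n
predn<n n = subst (predℤ n <_) (ℤₚ.suc-pred n) (n<sucn (predℤ n))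

-- A preorder is turned into a partial order by a time stamp: comparable distinct points have increasing stamps.
module Stamped (X : Set) (_≼_ : X → X → Set)
  (≼-refl : ∀ {x} → x ≼ x) (≼-trans : ∀ {x y z} → x ≼ y → y ≼ z → x ≼ z) where

  W : Set
  W = X × ℤ

  infix 4 _≤ˢ_
  _≤ˢ_ : W → W → Set
  (x , m) ≤ˢ (y , n) = (x , m) ≡ (y , n) ⊎ (m < n × x ≼ y)

  ≤ˢ-trans : ∀ {u v w} → u ≤ˢ v → v ≤ˢ w → u ≤ˢ w
  ≤ˢ-trans (inj₁ refl) q = q
  ≤ˢ-trans (inj₂ p) (inj₁ refl) = inj₂ p
  ≤ˢ-trans (inj₂ (l , p)) (inj₂ (l′ , q)) = inj₂ (ℤₚ.<-trans l l′ , ≼-trans p q)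

  ≤ˢ-antisym : ∀ {u v} → u ≤ˢ v → v ≤ˢ u → u ≡ v
  ≤ˢ-antisym (inj₁ e) q = e
  ≤ˢ-antisym (inj₂ (l , _)) (inj₁ refl) = ⊥-elim (ℤₚ.<-irrefl refl l)
  ≤ˢ-antisym (inj₂ (l , _)) (inj₂ (l′ , _)) = ⊥-elim (ℤₚ.<-asym l l′)

  ≤ˢ-≼ : ∀ {u v} → u ≤ˢ v → proj₁ u ≼ proj₁ v
  ≤ˢ-≼ (inj₁ refl) = ≼-refl
  ≤ˢ-≼ (inj₂ (_ , p)) = p

  module Model (Rˢ : W → W → Set) (compat : ∀ {u v u′ v′} → Rˢ u v → u′ ≤ˢ u → v ≤ˢ v′ → Rˢ u′ v′)
    (Vˢ : ℕ → X → Set) (Vˢ-up : ∀ {p x y} → x ≼ y → Vˢ p x → Vˢ p y) where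

    model : KripkeModel 0ℓ
    model = record
      { W = W ; _≤_ = _≤ˢ_ ; ≤-refl = inj₁ refl ; ≤-trans = ≤ˢ-trans ; ≤-antisym = ≤ˢ-antisym
      ; R = Rˢ ; R-compat = compat ; V = λ p u → Vˢ p (proj₁ u) ; V-up = λ l → Vˢ-up (≤ˢ-≼ l) }

-- F requires u ≤ π u, so π must advance the stamp; P requires π u ≤ u, so π must set it back.
data Drift : Set where
  up down : Drift

drift : Drift → ℤ → ℤ
drift up = sucℤ
drift down = predℤ

drift-< : ∀ d {m n} → m < n → drift d m < drift d n
drift-< up l = ℤₚ.+-monoʳ-< 1ℤ l
drift-< down l = ℤₚ.+-monoʳ-< -1ℤ l

later : ∀ d m → ∃ λ n → m < drift d n
later up m = m , n<sucn m
later down m = sucℤ (sucℤ m) , subst (m <_) (sym (ℤₚ.pred-suc (sucℤ m))) (n<sucn m)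

earlier : ∀ d n → ∃ λ m → m < drift d n
earlier d n = predℤ (drift d n) , predn<n _

undrift : Drift → ℤ → ℤ
undrift up = predℤ
undrift down = sucℤ

undrift-< : ∀ d {m n} → m < n → undrift d m < undrift d n
undrift-< up l = ℤₚ.+-monoʳ-< -1ℤ l
undrift-< down l = ℤₚ.+-monoʳ-< 1ℤ l

drift-undrift : ∀ d n → drift d (undrift d n) ≡ n
drift-undrift up = ℤₚ.suc-pred
drift-undrift down = ℤₚ.pred-suc

undrift-drift : ∀ d n → undrift d (drift d n) ≡ n
undrift-drift up = ℤₚ.pred-suc
undrift-drift down = ℤₚ.suc-pred

-- Models whose accessibility is u ≤ π v, with π moving the time stamp up or down.
module Normal (L : Labelled) where
 open Labelled L

 module Frame (_≼_ : X → X → Set)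
  (≼-refl : ∀ {x} → x ≼ x) (≼-trans : ∀ {x y z} → x ≼ y → y ≼ z → x ≼ z)
  (π : X → X) (π-mono : ∀ {x y} → x ≼ y → π x ≼ π y)
  (R₀⁺ : ∀ {x y} → R₀ x y → x ≼ π y) (R₀⁻ : ∀ {x y} → x ≼ π y → R₀ x y)
  (∋-up : ∀ {p x y} → x ≼ y → x ∋ atom p → y ∋ atom p) (d : Drift) where

  open Stamped X _≼_ ≼-refl ≼-trans

  πˢ : W → W
  πˢ (x , n) = π x , drift d n

  πˢ-mono : ∀ {u v} → u ≤ˢ v → πˢ u ≤ˢ πˢ v
  πˢ-mono (inj₁ refl) = inj₁ refl
  πˢ-mono (inj₂ (l , p)) = inj₂ (drift-< d l , π-mono p)

  open Model (λ u v → u ≤ˢ πˢ v) (λ r l l′ → ≤ˢ-trans l (≤ˢ-trans r (πˢ-mono l′)))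
    (λ p x → x ∋ atom p) ∋-up public

  open TruthLemma L model

  refuting : ∀ {Γ A} x → All (λ B → rel x B × x ∋ B) Γ → rel x A → (x ∋ A → ⊥) → Valid model Γ A → ⊥
  refuting x = refutes proj₁ id id (λ l → R₀⁻ (≤ˢ-≼ l))
    (λ {u} r → let (n , l) = later d (proj₂ u) in (_ , n) , inj₂ (l , R₀⁺ r) , refl)
    (λ {v} r → let (m , l) = earlier d (proj₂ v) in (_ , m) , inj₂ (l , R₀⁺ r) , refl) (x , 0ℤ)

  condN : Cond model N
  condN = πˢ , πˢ-mono , λ u v → id , id

  condF : (∀ x → x ≼ π x) → d ≡ up → Cond model F
  condF f refl (x , n) = inj₂ (n<sucn n , f x)

  condP : (∀ x → π x ≼ x) → d ≡ down → Cond model P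
  condP f refl u (y , n) l = ≤ˢ-trans l (inj₂ (predn<n n , f y))

  condwF : (∀ x → ∃ λ y → x ≼ π y) → Cond model wF
  condwF f (x , m) = let (y , p) = f x ; (n , l) = later d m in (y , n) , inj₂ (l , p)

  condH : (ρ : X → X) → (∀ {x y} → x ≼ y → ρ x ≼ ρ y) → (∀ x → π (ρ x) ≡ x) → (∀ x → ρ (π x) ≡ x) → Cond model H
  condH ρ ρ-mono e e′ = πˢ , (πˢ-mono , λ u v → id , id) , ρˢ , ρˢ-mono ,
    (λ { (x , n) → cong₂ _,_ (e x) (drift-undrift d n) }) , (λ { (x , n) → cong₂ _,_ (e′ x) (undrift-drift d n) })
    where
    ρˢ : W → W
    ρˢ (x , n) = ρ x , undrift d n
    ρˢ-mono : ∀ {u v} → u ≤ˢ v → ρˢ u ≤ˢ ρˢ v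
    ρˢ-mono (inj₁ refl) = inj₁ refl
    ρˢ-mono (inj₂ (l , p)) = inj₂ (undrift-< d l , ρ-mono p)

-- Models without an operator on worlds; when F and P both hold, accessibility is the order itself.
module Relational (L : Labelled) where
 open Labelled L

 module Frame (_≼_ : X → X → Set)
  (≼-refl : ∀ {x} → x ≼ x) (≼-trans : ∀ {x y z} → x ≼ y → y ≼ z → x ≼ z)
  (compat : ∀ {x y x′ y′} → R₀ x y → x′ ≼ x → y ≼ y′ → R₀ x′ y′)
  (∋-up : ∀ {p x y} → x ≼ y → x ∋ atom p → y ∋ atom p) where

  open Stamped X _≼_ ≼-refl ≼-trans

  module Plain where
    open Model (λ u v → R₀ (proj₁ u) (proj₁ v)) (λ r l l′ → compat r (≤ˢ-≼ l) (≤ˢ-≼ l′))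
      (λ p x → x ∋ atom p) ∋-up public

    open TruthLemma L model

    refuting : ∀ {Γ A} x → All (λ B → rel x B × x ∋ B) Γ → rel x A → (x ∋ A → ⊥) → Valid model Γ A → ⊥
    refuting x = refutes proj₁ id id id (λ r → (_ , 0ℤ) , r , refl) (λ r → (_ , 0ℤ) , r , refl) (x , 0ℤ)

    condF : (∀ x → R₀ x x) → Cond model F
    condF f (x , _) = f x

    condwF : (∀ x → ∃ λ y → R₀ x y) → Cond model wF
    condwF f (x , _) = let (y , r) = f x in (y , 0ℤ) , r

  -- For P accessibility has to lie inside the stamped order, so accessible worlds receive strictly
  -- later stamps. Reflexivity is lost, which confines this frame to the case without F.
  module Inclusive (R₀⊆≼ : ∀ {x y} → R₀ x y → x ≼ y) where

    mix : ∀ {k l m n} → (k ≡ l ⊎ k < l) → l < m → (m ≡ n ⊎ m < n) → k < n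
    mix (inj₁ refl) l (inj₁ refl) = l
    mix (inj₁ refl) l (inj₂ l′) = ℤₚ.<-trans l l′
    mix (inj₂ l″) l (inj₁ refl) = ℤₚ.<-trans l″ l
    mix (inj₂ l″) l (inj₂ l′) = ℤₚ.<-trans (ℤₚ.<-trans l″ l) l′

    stamp : ∀ {u v} → u ≤ˢ v → proj₂ u ≡ proj₂ v ⊎ proj₂ u < proj₂ v
    stamp (inj₁ refl) = inj₁ refl
    stamp (inj₂ (l , _)) = inj₂ l

    Rˢ : W → W → Set
    Rˢ u v = R₀ (proj₁ u) (proj₁ v) × proj₂ u < proj₂ v

    Rˢ-compat : ∀ {u v u′ v′} → Rˢ u v → u′ ≤ˢ u → v ≤ˢ v′ → Rˢ u′ v′
    Rˢ-compat (r , q) l l′ = compat r (≤ˢ-≼ l) (≤ˢ-≼ l′) , mix (stamp l) q (stamp l′)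

    open Model Rˢ Rˢ-compat (λ p x → x ∋ atom p) ∋-up public

    open TruthLemma L model

    refuting : ∀ {Γ A} x → All (λ B → rel x B × x ∋ B) Γ → rel x A → (x ∋ A → ⊥) → Valid model Γ A → ⊥
    refuting x = refutes proj₁ id id proj₁
      (λ {u} r → (_ , sucℤ (proj₂ u)) , (r , n<sucn _) , refl)
      (λ {v} r → (_ , predℤ (proj₂ v)) , (r , predn<n _) , refl) (x , 0ℤ)

    condP : Cond model P
    condP u v (r , l) = inj₂ (l , R₀⊆≼ r)

    condwF : (∀ x → ∃ λ y → R₀ x y) → Cond model wF
    condwF f (x , n) = let (y , r) = f x in (y , sucℤ n) , r , n<sucn n

  module Trivial (R₀⊆≼ : ∀ {x y} → R₀ x y → x ≼ y) (≼⊆R₀ : ∀ {x y} → x ≼ y → R₀ x y) where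

    open Model _≤ˢ_ (λ r l l′ → ≤ˢ-trans l (≤ˢ-trans r l′)) (λ p x → x ∋ atom p) ∋-up public

    open TruthLemma L model

    refuting : ∀ {Γ A} x → All (λ B → rel x B × x ∋ B) Γ → rel x A → (x ∋ A → ⊥) → Valid model Γ A → ⊥
    refuting x = refutes proj₁ id id (λ l → ≼⊆R₀ (≤ˢ-≼ l))
      (λ {u} r → (_ , sucℤ (proj₂ u)) , inj₂ (n<sucn _ , R₀⊆≼ r) , refl)
      (λ {v} r → (_ , predℤ (proj₂ v)) , inj₂ (predn<n _ , R₀⊆≼ r) , refl) (x , 0ℤ)

    isK : ∀ S → Cond model S
    isK N = id , id , λ u v → id , id
    isK H = id , (id , λ u v → id , id) , id , id , (λ _ → refl) , λ _ → refl
    isK P u v l = l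
    isK F w = inj₁ refl
    isK wF w = w , inj₁ refl

-- Classical reasoning under K over finite types.

module Classical (Ans : Set) where
  open Continuation Ans public

  private variable
    a b ℓ : Level
    A B : Set a

  return : A → K A
  return x k = k x

  infixl 1 _>>=_
  _>>=_ : K A → (A → K B) → K B
  (m >>= f) k = m (λ x → f x k)

  em : (A : Set a) → K (A ⊎ (A → Ans))
  em A k = k (inj₂ (k ∘ inj₁))

  -- Decidability of the antecedent is what allows `K` to be moved out: a false antecedent makes the
  -- implication true outright.
  K-imp : Dec A → (A → K B) → K (A → B)
  K-imp (yes x) f k = f x (λ y → k (λ _ → y))
  K-imp (no ¬x) f k = k (λ x → ⊥-elim (¬x x))

  K-× : K A → K B → K (A × B)
  K-× p q = p >>= λ x → q >>= λ y → return (x , y)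

  -- Finiteness is expressed by its use, at all universe levels because the predicates also speak
  -- about canonical worlds, which are large.
  Finite : Set a → Setω
  Finite A = ∀ {ℓ} {P : A → Set ℓ} → (∀ x → K (P x)) → K (∀ x → P x)

  finite-Bool : Finite Bool
  finite-Bool f = f true >>= λ t → f false >>= λ u → return λ { true → t ; false → u }

  finite-Fin : ∀ {n} → Finite (Fin n)
  finite-Fin {zero} f = return λ ()
  finite-Fin {suc n} f = f zero >>= λ t → finite-Fin (f ∘ suc) >>= λ u → return λ { zero → t ; (suc i) → u i }

  finite-Σ : {B : A → Set b} → Finite A → (∀ x → Finite (B x)) → Finite (Σ A B)
  finite-Σ fa fb f = fa (λ x → fb x (λ y → f (x , y))) >>= λ g → return λ { (x , y) → g x y }

  finite-Vec : ∀ {n} → Finite A → Finite (Vec A n)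
  finite-Vec {n = zero} fa f = f [] >>= λ t → return λ { [] → t }
  finite-Vec {n = suc n} fa f = fa (λ x → finite-Vec fa (λ xs → f (x ∷ xs))) >>= λ g → return λ { (x ∷ xs) → g x xs }

  finite-All : ∀ {Φ : List Formula} → Finite A → Finite (All (λ _ → A) Φ)
  finite-All {Φ = []} fa f = f [] >>= λ t → return λ { [] → t }
  finite-All {Φ = _ ∷ _} fa f = fa (λ x → finite-All fa (λ xs → f (x ∷ xs))) >>= λ g → return λ { (x ∷ xs) → g x xs }

  K-∈ : ∀ {Φ : List Formula} {Q : ∀ {E} → E ∈ Φ → Set ℓ} → (∀ {E} (m : E ∈ Φ) → K (Q m)) → K (∀ {E} (m : E ∈ Φ) → Q m)
  K-∈ {Φ = []} f k = k λ ()
  K-∈ {Φ = _ ∷ Φ} f k = f (here refl) (λ t → K-∈ {Φ = Φ} (f ∘ there) (λ u → k λ { (here refl) → t ; (there m) → u m }))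

  finite-Dec : Dec A → (∀ (x y : A) → x ≡ y) → Finite A
  finite-Dec (yes x) irr {P = Q} f = f x >>= λ q → return λ y → subst Q (irr x y) q
  finite-Dec (no ¬x) irr f = return (λ x → ⊥-elim (¬x x))

  K-All : ∀ {Q : Formula → Set ℓ} {Γ} → (∀ {B} → B ∈ Γ → K (Q B)) → K (All Q Γ)
  K-All {Γ = []} f = return []
  K-All {Γ = _ ∷ _} f = f (here refl) >>= λ p → K-All (f ∘ there) >>= λ ps → return (p ∷ ps)

  module _ {A : Set a} (Q : A → Set ℓ) where

    -- A decidable stand-in for `Q`. Its elements form a small type even where `Q` mentions worlds,
    -- so they can serve as points of a model.
    Selection : Set (a ⊔ˡ ℓ)
    Selection = Σ (A → Bool) λ s → (∀ {x} → T (s x) → Q x) × (∀ {x} → Q x → K (T (s x)))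

    select : Finite A → K Selection
    select fa = fa (λ x → em (Q x)) >>= λ d → return ((λ x → is (d x)) , (λ {x} → get (d x)) , λ {x} → put (d x))
      where
      is : ∀ {x} → Q x ⊎ (Q x → Ans) → Bool
      is (inj₁ _) = true
      is (inj₂ _) = false
      get : ∀ {x} (d : Q x ⊎ (Q x → Ans)) → T (is d) → Q x
      get (inj₁ p) _ = p
      put : ∀ {x} (d : Q x ⊎ (Q x → Ans)) → Q x → K (T (is d))
      put (inj₁ _) _ = return tt
      put (inj₂ k) p _ = k p

  finite-T : {A : Set a} (s : A → Bool) → Finite A → Finite (Σ A (T ∘ s))
  finite-T s fa = finite-Σ fa (λ x → finite-Dec (T? (s x)) T-irrelevant)

-- Equality of formulas and the closure Φ.

eq? : (A B : Formula) → Maybe (A ≡ B)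
eq? (atom m) (atom n) with m ℕₚ.≟ n
... | yes e = just (cong atom e)
... | no _ = nothing
eq? ⊤′ ⊤′ = just refl
eq? ⊥′ ⊥′ = just refl
eq? 𝟏 𝟏 = just refl
eq? (A ∧ B) (C ∧ D) = zipWith (cong₂ _∧_) (eq? A C) (eq? B D)
eq? (A ∨ B) (C ∨ D) = zipWith (cong₂ _∨_) (eq? A C) (eq? B D)
eq? (A ⊗ B) (C ⊗ D) = zipWith (cong₂ _⊗_) (eq? A C) (eq? B D)
eq? (A ⊸ B) (C ⊸ D) = zipWith (cong₂ _⊸_) (eq? A C) (eq? B D)
eq? (∇ A) (∇ B) = Maybe.map (cong ∇) (eq? A B)
eq? _ _ = nothing

eq?-refl : ∀ A → Is-just (eq? A A)
eq?-refl (atom n) with n ℕₚ.≟ n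
... | yes _ = just tt
... | no ¬e = ⊥-elim (¬e refl)
eq?-refl ⊤′ = just tt
eq?-refl ⊥′ = just tt
eq?-refl 𝟏 = just tt
eq?-refl (A ∧ B) with eq? A A | eq?-refl A | eq? B B | eq?-refl B
... | just _ | _ | just _ | _ = just tt
eq?-refl (A ∨ B) with eq? A A | eq?-refl A | eq? B B | eq?-refl B
... | just _ | _ | just _ | _ = just tt
eq?-refl (A ⊗ B) with eq? A A | eq?-refl A | eq? B B | eq?-refl B
... | just _ | _ | just _ | _ = just tt
eq?-refl (A ⊸ B) with eq? A A | eq?-refl A | eq? B B | eq?-refl B
... | just _ | _ | just _ | _ = just tt
eq?-refl (∇ A) with eq? A A | eq?-refl A
... | just _ | _ = just tt

infix 4 _≟_
-- A failed test refutes equality because `eq? A A` always succeeds; no analysis of pairs of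
-- distinct connectives is required.
_≟_ : (A B : Formula) → Dec (A ≡ B)
A ≟ B with eq? A B | (λ (e : A ≡ B) → subst (λ C → Is-just (eq? A C)) e (eq?-refl A))
... | just e | _ = yes e
... | nothing | f = no (λ e → none (f e))
  where
  none : ∀ {X : Set} → Is-just {A = X} nothing → ⊥
  none ()

imm : Formula → List Formula
imm (A ∧ B) = A ∷ B ∷ []
imm (A ∨ B) = A ∷ B ∷ []
imm (A ⊗ B) = A ∷ B ∷ []
imm (A ⊸ B) = A ∷ B ∷ ∇ (A ⊸ B) ∷ []
imm (∇ A) = A ∷ []
imm _ = []

Closed : List Formula → Set
Closed Φ = ∀ {E D} → E ∈ Φ → D ∈ imm E → D ∈ Φ

-- The closure under `A ⊸ B ↦ ∇ (A ⊸ B)` stays finite, since the only immediate part of the added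
-- formula is `A ⊸ B` again.
sf : Formula → List Formula
sf (A ∧ B) = (A ∧ B) ∷ sf A ++ sf B
sf (A ∨ B) = (A ∨ B) ∷ sf A ++ sf B
sf (A ⊗ B) = (A ⊗ B) ∷ sf A ++ sf B
sf (A ⊸ B) = (A ⊸ B) ∷ ∇ (A ⊸ B) ∷ sf A ++ sf B
sf (∇ A) = ∇ A ∷ sf A
sf A = A ∷ []

sf-self : ∀ A → A ∈ sf A
sf-self (atom _) = here refl
sf-self ⊤′ = here refl
sf-self ⊥′ = here refl
sf-self 𝟏 = here refl
sf-self (A ∧ B) = here refl
sf-self (A ∨ B) = here refl
sf-self (A ⊗ B) = here refl
sf-self (A ⊸ B) = here refl
sf-self (∇ A) = here refl

++-closed : ∀ {Φ Ψ} → Closed Φ → Closed Ψ → Closed (Φ ++ Ψ)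
++-closed {Φ} c d m i with ∈-++⁻ Φ m
... | inj₁ m′ = ∈-++⁺ˡ (c m′ i)
... | inj₂ m′ = ∈-++⁺ʳ Φ (d m′ i)

∷-closed : ∀ {A Φ} → (∀ {D} → D ∈ imm A → D ∈ A ∷ Φ) → Closed Φ → Closed (A ∷ Φ)
∷-closed c d (here refl) i = c i
∷-closed c d (there m) i = there (d m i)

sf-closed : ∀ A → Closed (sf A)
sf-closed (atom _) = ∷-closed (λ ()) λ ()
sf-closed ⊤′ = ∷-closed (λ ()) λ ()
sf-closed ⊥′ = ∷-closed (λ ()) λ ()
sf-closed 𝟏 = ∷-closed (λ ()) λ ()
sf-closed (A ∧ B) = ∷-closed (λ { (here refl) → there (∈-++⁺ˡ (sf-self A)) ; (there (here refl)) → there (∈-++⁺ʳ (sf A) (sf-self B)) })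
                             (++-closed (sf-closed A) (sf-closed B))
sf-closed (A ∨ B) = ∷-closed (λ { (here refl) → there (∈-++⁺ˡ (sf-self A)) ; (there (here refl)) → there (∈-++⁺ʳ (sf A) (sf-self B)) })
                             (++-closed (sf-closed A) (sf-closed B))
sf-closed (A ⊗ B) = ∷-closed (λ { (here refl) → there (∈-++⁺ˡ (sf-self A)) ; (there (here refl)) → there (∈-++⁺ʳ (sf A) (sf-self B)) })
                             (++-closed (sf-closed A) (sf-closed B))
sf-closed (A ⊸ B) (here refl) (here refl) = there (there (∈-++⁺ˡ (sf-self A)))
sf-closed (A ⊸ B) (here refl) (there (here refl)) = there (there (∈-++⁺ʳ (sf A) (sf-self B)))
sf-closed (A ⊸ B) (here refl) (there (there (here refl))) = there (here refl)
sf-closed (A ⊸ B) (there (here refl)) (here refl) = here refl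
sf-closed (A ⊸ B) (there (there m)) i = there (there (++-closed (sf-closed A) (sf-closed B) m i))
sf-closed (∇ A) = ∷-closed (λ { (here refl) → there (sf-self A) }) (sf-closed A)

sfs : List Formula → List Formula
-- Falsity is included so that a successor demanded by wF can be described as a world omitting a
-- formula of the closure.
sfs [] = ⊥′ ∷ []
sfs (A ∷ Γ) = sf A ++ sfs Γ

sfs-closed : ∀ Γ → Closed (sfs Γ)
sfs-closed [] = ∷-closed (λ ()) λ ()
sfs-closed (A ∷ Γ) = ++-closed (sf-closed A) (sfs-closed Γ)

sfs-⊇ : ∀ Γ {A} → A ∈ Γ → A ∈ sfs Γ
sfs-⊇ (A ∷ Γ) (here refl) = ∈-++⁺ˡ (sf-self A)
sfs-⊇ (A ∷ Γ) (there m) = ∈-++⁺ʳ (sf A) (sfs-⊇ Γ m)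

sfs-⊥ : ∀ Γ → ⊥′ ∈ sfs Γ
sfs-⊥ [] = here refl
sfs-⊥ (A ∷ Γ) = ∈-++⁺ʳ (sf A) (sfs-⊥ Γ)

-- Types over Φ and their local laws.

module States (𝓡 : SchemeSet) (Ans : Set) (Φ : List Formula) (cl : Closed Φ) where
  open Calculus 𝓡
  open Classical Ans
  open Canonical 𝓡 Ans

  sub₁∧ : ∀ {A B} → (A ∧ B) ∈ Φ → A ∈ Φ
  sub₁∧ m = cl m (here refl)
  sub₂∧ : ∀ {A B} → (A ∧ B) ∈ Φ → B ∈ Φ
  sub₂∧ m = cl m (there (here refl))
  sub₁∨ : ∀ {A B} → (A ∨ B) ∈ Φ → A ∈ Φ
  sub₁∨ m = cl m (here refl)
  sub₂∨ : ∀ {A B} → (A ∨ B) ∈ Φ → B ∈ Φ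
  sub₂∨ m = cl m (there (here refl))
  sub₁⊗ : ∀ {A B} → (A ⊗ B) ∈ Φ → A ∈ Φ
  sub₁⊗ m = cl m (here refl)
  sub₂⊗ : ∀ {A B} → (A ⊗ B) ∈ Φ → B ∈ Φ
  sub₂⊗ m = cl m (there (here refl))
  sub₁⊸ : ∀ {A B} → (A ⊸ B) ∈ Φ → A ∈ Φ
  sub₁⊸ m = cl m (here refl)
  sub₂⊸ : ∀ {A B} → (A ⊸ B) ∈ Φ → B ∈ Φ
  sub₂⊸ m = cl m (there (here refl))
  sub∇⊸ : ∀ {A B} → (A ⊸ B) ∈ Φ → ∇ (A ⊸ B) ∈ Φ
  sub∇⊸ m = cl m (there (there (here refl)))
  sub∇ : ∀ {A} → ∇ A ∈ Φ → A ∈ Φ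
  sub∇ m = cl m (here refl)

  State : Set
  State = All (λ _ → Bool) Φ

  finite-State : Finite State
  finite-State = finite-All finite-Bool

  record On (q : State) {E : Formula} (m : E ∈ Φ) : Set where
    constructor bit
    field isOn : T (All.lookup q m)

  On? : ∀ q {E} (m : E ∈ Φ) → Dec (On q m)
  On? q m = map′ bit On.isOn (T? (All.lookup q m))

  infix 4 _≤ᵗ_
  _≤ᵗ_ : State → State → Set
  q ≤ᵗ r = ∀ {E} (m : E ∈ Φ) → On q m → On r m

  record Real (X : Theory) (q : State) : Set where
    field
      holds : ∀ {E} (m : E ∈ Φ) → On q m → X E
      off   : ∀ {E} (m : E ∈ Φ) → ¬ On q m → X E → Ans

  open Real public

  realize : (X : Theory) → K (Σ State (Real X))
  realize X = go Φ >>= λ { (q , f) → return (q , record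
    { holds = λ { m (bit o) → proj₁ (f m) o } ; off = λ m n → proj₂ (f m) (λ o → n (bit o)) }) }
    where
    go : ∀ Ψ → K (Σ (All (λ _ → Bool) Ψ) λ q → ∀ {E} (m : E ∈ Ψ) → (T (All.lookup q m) → X E) × (¬ T (All.lookup q m) → X E → Ans))
    go [] = return ([] , λ ())
    go (A ∷ Ψ) = go Ψ >>= λ { (q , f) → em (X A) >>= λ
      { (inj₁ x) → return (true ∷ q , λ { (here refl) → (λ _ → x) , (λ n → ⊥-elim (n tt)) ; (there m) → f m })
      ; (inj₂ k) → return (false ∷ q , λ { (here refl) → (λ ()) , (λ _ → k) ; (there m) → f m }) } }

  on : ∀ {X q E} → Real X q → (m : E ∈ Φ) → X E → K (On q m)
  on {q = q} r m x with On? q m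
  ... | yes o = return o
  ... | no ¬o = λ _ → off r m ¬o x

  K-off : ∀ {X q E} → Real X q → (m : E ∈ Φ) → (X E → Ans) → K (¬ On q m)
  K-off {q = q} r m n with On? q m
  ... | yes o = λ _ → n (holds r m o)
  ... | no ¬o = return ¬o

  K-≤ : ∀ {X Y q r} → Real X q → Real Y r → (∀ {A} → X A → Y A) → K (q ≤ᵗ r)
  K-≤ {q = q} a b f = K-∈ (λ m → K-imp (On? q m) (λ o → on b m (f (holds a m o))))

  -- The clause for `A ⊸ B` is modus ponens at one world, in the form available there: `A` and
  -- `∇ (A ⊸ B)` give `B`. This is the reason for having `∇ (A ⊸ B)` in Φ.
  Law : State → ∀ {E} → E ∈ Φ → Set
  Law q {atom _} m = ⊤
  Law q {⊤′} m = On q m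
  Law q {⊥′} m = ¬ On q m
  Law q {𝟏} m = On q m
  Law q {A ∧ B} m = (On q m → On q (sub₁∧ m) × On q (sub₂∧ m)) × (On q (sub₁∧ m) → On q (sub₂∧ m) → On q m)
  Law q {A ∨ B} m = (On q m → On q (sub₁∨ m) ⊎ On q (sub₂∨ m)) × (On q (sub₁∨ m) ⊎ On q (sub₂∨ m) → On q m)
  Law q {A ⊗ B} m = (On q m → On q (sub₁⊗ m) × On q (sub₂⊗ m)) × (On q (sub₁⊗ m) → On q (sub₂⊗ m) → On q m)
  Law q {A ⊸ B} m = On q (sub∇⊸ m) → On q (sub₁⊸ m) → On q (sub₂⊸ m)
  Law q {∇ A} m = ⊤

  record Laws (q : State) : Set where
    field
      law      : ∀ {E} (m : E ∈ Φ) → Law q m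
      -- Φ may list a formula repeatedly and a type has one bit for each occurrence; these must
      -- agree.
      coherent : ∀ {E} (m m′ : E ∈ Φ) → On q m → On q m′

  open Laws public

  K-law : (X : World) → ∀ {q E} → Real (mem X) q → (m : E ∈ Φ) → K (Law q m)
  K-law X {E = atom _} r m = return tt
  K-law X {E = ⊤′} r m = on r m (closed X [] R⊤)
  K-law X {E = ⊥′} r m = K-off r m (proper X)
  K-law X {E = 𝟏} r m = on r m (closed X [] R1)
  K-law X {q} {A ∧ B} r m = K-×
    (K-imp (On? q m) (λ o → K-× (on r _ (entails X (holds r m o) (L∧₁ {Γ = []} ax)))
                                (on r _ (entails X (holds r m o) (L∧₂ {Γ = []} ax)))))
    (K-imp (On? q _) λ a → K-imp (On? q _) λ b →
      on r m (closed X (holds r _ a ∷ holds r _ b ∷ []) (R∧ (hyp (here refl)) (hyp (there (here refl))))))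
  K-law X {q} {A ∨ B} r m = K-×
    (K-imp (On? q m) (λ o → prime X (holds r m o) >>= λ
      { (inj₁ a) → on r _ a >>= return ∘ inj₁ ; (inj₂ b) → on r _ b >>= return ∘ inj₂ }))
    (K-× (K-imp (On? q _) (λ a → on r m (entails X (holds r _ a) (R∨₁ ax))))
         (K-imp (On? q _) (λ b → on r m (entails X (holds r _ b) (R∨₂ ax)))) >>= λ { (f , g) → return [ f , g ]′ })
  K-law X {q} {A ⊗ B} r m = K-×
    (K-imp (On? q m) (λ o → K-× (on r _ (entails X (holds r m o) (L⊗ {Γ = []} (hyp (here refl)))))
                                (on r _ (entails X (holds r m o) (L⊗ {Γ = []} (hyp (there (here refl))))))))
    (K-imp (On? q _) λ a → K-imp (On? q _) λ b →
      on r m (closed X (holds r _ a ∷ holds r _ b ∷ []) (R⊗ ax ax)))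
  K-law X {q} {A ⊸ B} r m = K-imp (On? q _) λ i → K-imp (On? q _) λ a →
    on r _ (closed X (holds r _ a ∷ holds r _ i ∷ []) mp)
  K-law X {E = ∇ A} r m = return tt

  K-laws : (X : World) → ∀ {q} → Real (mem X) q → K (Laws q)
  K-laws X {q} r = K-× (K-∈ (K-law X r)) (K-∈ λ m → coh m) >>= λ { (l , c) → return record { law = l ; coherent = λ m m′ → c m m′ } }
    where
    coh : ∀ {E} (m : E ∈ Φ) → K (∀ (m′ : E ∈ Φ) → On q m → On q m′)
    coh {E} m = K-∈ {Q = λ {E′} m′ → (e : E ≡ E′) → On q m → On q m′} step >>= λ f → return λ m′ → f m′ refl
      where
      step : ∀ {E′} (m′ : E′ ∈ Φ) → K ((e : E ≡ E′) → On q m → On q m′)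
      step {E′} m′ = K-imp (E ≟ E′) λ { refl → K-imp (On? q m) (λ o → on r m′ (holds r m o)) }

  infix 4 _⊆ᵗ_
  record _⊆ᵗ_ (q r : State) : Set where
    constructor incl
    field app : q ≤ᵗ r
  open _⊆ᵗ_ public

  ⊆ᵗ-refl : ∀ {q} → q ⊆ᵗ q
  ⊆ᵗ-refl = incl λ _ o → o

  ⊆ᵗ-trans : ∀ {p q r} → p ⊆ᵗ q → q ⊆ᵗ r → p ⊆ᵗ r
  ⊆ᵗ-trans (incl f) (incl g) = incl λ m o → g m (f m o)

  K-⊆ : ∀ {X Y q r} → Real X q → Real Y r → (∀ {A} → A ∈ Φ → X A → Y A) → K (q ⊆ᵗ r)
  K-⊆ {q = q} a b f k = K-∈ (λ m → K-imp (On? q m) (λ o → on b m (f m (holds a m o)))) (λ g → k (incl g))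

  -- r is the type of the image, under the operator of the model, of a point of type q.
  record Pred (q r : State) : Set where
    field
      down∇ : ∀ {A} (m : ∇ A ∈ Φ) → On q m → On r (sub∇ m)
      up∇   : ∀ {A} (m : ∇ A ∈ Φ) → On r (sub∇ m) → On q m
  open Pred public

  K-Pred : ∀ {M M′ : Theory} {q r} → Real M q → Real M′ r → (∀ {A} → M (∇ A) → M′ A) → (∀ {A} → M′ A → M (∇ A)) → K (Pred q r)
  K-Pred {q = q} {r} a b f g k = K-∈ goal λ e → k record { down∇ = λ m → proj₁ (e m) ; up∇ = λ m → proj₂ (e m) }
    where
    Goal : ∀ {E} → E ∈ Φ → Set
    Goal {∇ B} m = (On q m → On r (sub∇ m)) × (On r (sub∇ m) → On q m)
    Goal _ = ⊤
    goal : ∀ {E} (m : E ∈ Φ) → K (Goal m)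
    goal {atom _} m = return tt
    goal {⊤′} m = return tt
    goal {⊥′} m = return tt
    goal {𝟏} m = return tt
    goal {_ ∧ _} m = return tt
    goal {_ ∨ _} m = return tt
    goal {_ ⊗ _} m = return tt
    goal {_ ⊸ _} m = return tt
    goal {∇ B} m = K-× (K-imp (On? q m) λ o → on b _ (f (holds a m o))) (K-imp (On? r _) λ o → on a m (g (holds b _ o)))

  record Everywhere (Q : ∀ {E} → E ∈ Φ → Set) : Set where
    constructor everywhere
    field each : ∀ {E} (m : E ∈ Φ) → Q m
  open Everywhere public

  K-Everywhere : ∀ {Q : ∀ {E} → E ∈ Φ → Set} → (∀ {E} (m : E ∈ Φ) → K (Q m)) → K (Everywhere Q)
  K-Everywhere f k = K-∈ f (λ g → k (everywhere g))

module Labels (𝓡 : SchemeSet) (Ans : Set) (Φ : List Formula) (cl : Closed Φ) where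
  open States 𝓡 Ans Φ cl

  infix 4 _∋ᵗ_
  _∋ᵗ_ : State → Formula → Set
  q ∋ᵗ E = Σ (E ∈ Φ) λ m → On q m

  pick : ∀ {q E} → Laws q → q ∋ᵗ E → (m : E ∈ Φ) → On q m
  pick l (m , o) m′ = coherent l m m′ o

  -- What is left of `Labelled` when labels are types obeying `Laws`: the propositional clauses are
  -- automatic, and those about accessibility remain.
  record Points : Set₁ where
    field
      X    : Set
      R₀   : X → X → Set
      st   : X → State
      ok   : X → Formula → Set
      laws : ∀ {x E} → ok x E → Laws (st x)
      ok∧  : ∀ {x A B} → ok x (A ∧ B) → ok x A × ok x B
      ok∨  : ∀ {x A B} → ok x (A ∨ B) → ok x A × ok x B
      ok⊗  : ∀ {x A B} → ok x (A ⊗ B) → ok x A × ok x B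
      ok⊸  : ∀ {x y A B} → ok x (A ⊸ B) → R₀ x y → ok y A × ok y B
      ok∇  : ∀ {x y A} → ok x (∇ A) → R₀ y x → ok y A
      ⊸⁻   : ∀ {x y A B} (m : (A ⊸ B) ∈ Φ) → ok x (A ⊸ B) → On (st x) m → R₀ x y → On (st y) (sub₁⊸ m) → On (st y) (sub₂⊸ m)
      ⊸?   : ∀ {x A B} (m : (A ⊸ B) ∈ Φ) → ok x (A ⊸ B) →
             On (st x) m ⊎ Σ X λ y → R₀ x y × On (st y) (sub₁⊸ m) × ¬ On (st y) (sub₂⊸ m)
      ∇⁺   : ∀ {x y A} (m : ∇ A ∈ Φ) → ok x (∇ A) → R₀ y x → On (st y) (sub∇ m) → On (st x) m
      ∇⁻   : ∀ {x A} (m : ∇ A ∈ Φ) → ok x (∇ A) → On (st x) m → Σ X λ y → R₀ y x × On (st y) (sub∇ m)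

  module _ (Q : Points) where
    open Points Q

    labelled : Labelled
    labelled = record
      { X = X ; R₀ = R₀ ; _∋_ = λ x E → st x ∋ᵗ E ; rel = λ x E → E ∈ Φ × ok x E
      ; rel∧ = λ { (m , o) → let (p , q) = ok∧ o in (sub₁∧ m , p) , (sub₂∧ m , q) }
      ; rel∨ = λ { (m , o) → let (p , q) = ok∨ o in (sub₁∨ m , p) , (sub₂∨ m , q) }
      ; rel⊗ = λ { (m , o) → let (p , q) = ok⊗ o in (sub₁⊗ m , p) , (sub₂⊗ m , q) }
      ; rel⊸ = λ { (m , o) r → let (p , q) = ok⊸ o r in (sub₁⊸ m , p) , (sub₂⊸ m , q) }
      ; rel∇ = λ { (m , o) r → sub∇ m , ok∇ o r }
      ; ∋⊤ = λ { (m , o) → m , law (laws o) m }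
      ; ∋𝟏 = λ { (m , o) → m , law (laws o) m }
      ; ∌⊥ = λ { (m , o) a → law (laws o) m (pick (laws o) a m) }
      ; ∧⁺ = λ { (m , o) a b → m , proj₂ (law (laws o) m) (pick (laws o) a _) (pick (laws o) b _) }
      ; ∧⁻ = λ { (m , o) a → let (p , q) = proj₁ (law (laws o) m) (pick (laws o) a m) in (_ , p) , (_ , q) }
      ; ⊗⁺ = λ { (m , o) a b → m , proj₂ (law (laws o) m) (pick (laws o) a _) (pick (laws o) b _) }
      ; ⊗⁻ = λ { (m , o) a → let (p , q) = proj₁ (law (laws o) m) (pick (laws o) a m) in (_ , p) , (_ , q) }
      ; ∨⁺ = λ { (m , o) (inj₁ a) → m , proj₂ (law (laws o) m) (inj₁ (pick (laws o) a _))
               ; (m , o) (inj₂ b) → m , proj₂ (law (laws o) m) (inj₂ (pick (laws o) b _)) }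
      ; ∨⁻ = λ { (m , o) a → or (proj₁ (law (laws o) m) (pick (laws o) a m)) }
      ; ⊸⁻ = λ { (m , o) a r b → _ , ⊸⁻ m o (pick (laws o) a m) r (pick (laws (proj₁ (ok⊸ o r))) b _) }
      ; ⊸? = λ { (m , o) → imp m o (⊸? m o) }
      ; ∇⁺ = λ { (m , o) r a → m , ∇⁺ m o r (pick (laws (ok∇ o r)) a _) }
      ; ∇⁻ = λ { (m , o) a → let (y , r , b) = ∇⁻ m o (pick (laws o) a m) in y , r , _ , b } }
      where
      or : ∀ {q A B} {m : A ∈ Φ} {n : B ∈ Φ} → On q m ⊎ On q n → q ∋ᵗ A ⊎ q ∋ᵗ B
      or (inj₁ a) = inj₁ (_ , a)
      or (inj₂ b) = inj₂ (_ , b)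
      imp : ∀ {x A B} (m : (A ⊸ B) ∈ Φ) → ok x (A ⊸ B) →
        On (st x) m ⊎ Σ X (λ y → R₀ x y × On (st y) (sub₁⊸ m) × ¬ On (st y) (sub₂⊸ m)) →
        st x ∋ᵗ A ⊸ B ⊎ Σ X (λ y → R₀ x y × st y ∋ᵗ A × (st y ∋ᵗ B → ⊥))
      imp m o (inj₁ a) = inj₁ (m , a)
      imp m o (inj₂ (y , r , a , n)) = inj₂ (y , r , (_ , a) , λ b → n (pick (laws (proj₁ (ok⊸ o r))) b _))

  ∋ᵗ-up : ∀ {q r E} → q ≤ᵗ r → q ∋ᵗ E → r ∋ᵗ E
  ∋ᵗ-up l (m , o) = m , l m o

  ≤ᵗ-refl : ∀ {q} → q ≤ᵗ q
  ≤ᵗ-refl _ o = o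

  ≤ᵗ-trans : ∀ {p q r} → p ≤ᵗ q → q ≤ᵗ r → p ≤ᵗ r
  ≤ᵗ-trans f g m o = g m (f m o)

-- As `Ans` is derivability of the given sequent, a derivation of `A` from `Γ` is itself an answer;
-- so a world containing `Γ` and avoiding `A` always exists.
module Root (𝓡 : SchemeSet) (Γ : List Formula) (A : Formula) where
  open Calculus 𝓡
  Ans : Set
  Ans = 𝓡 ⊢ Γ ⇒ A
  Φ : List Formula
  Φ = sfs (A ∷ Γ)
  cl : Closed Φ
  cl = sfs-closed (A ∷ Γ)
  open Canonical 𝓡 Ans

  open Avoid (_∈ Γ) A (λ ms d → weaken (All.lookup ms) d) public
    using () renaming (world to root; world-⊇ to root-⊇; world-avoids to root-avoids)

  A∈Φ : A ∈ Φ
  A∈Φ = sfs-⊇ (A ∷ Γ) (here refl)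

  Γ⊑Φ : Γ ⊑ Φ
  Γ⊑Φ m = sfs-⊇ (A ∷ Γ) (there m)

-- Countermodels whose points are types.

module Finitary (𝓡 : SchemeSet) (Γ : List Formula) (A : Formula)
  (valid : ∀ (ℓ : Level) (M : KripkeModel ℓ) → IsK M 𝓡 → Valid M Γ A) where

  open Root 𝓡 Γ A
  open Calculus 𝓡
  open Classical Ans
  open Canonical 𝓡 Ans
  open States 𝓡 Ans Φ cl
  open Labels 𝓡 Ans Φ cl

  Realized : State → Set₁
  Realized q = Laws q × Σ World λ Z → Real (mem Z) q

  -- The trace of canonical accessibility. Under P inclusion is imposed separately: the first clause
  -- speaks only about `B` with `∇ B` in Φ.
  Step : State → State → Set
  Step q r = (∀ {B} (m : ∇ B ∈ Φ) → On q (sub∇ m) → On r m) × (P ∈R 𝓡 → q ≤ᵗ r)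

  Step-compat : ∀ {q r q′ r′} → Step q r → q′ ≤ᵗ q → r ≤ᵗ r′ → Step q′ r′
  Step-compat (f , g) l l′ = (λ m o → l′ m (f m (l _ o))) , λ p m o → l′ m (g p m (l m o))

  K-Step : ∀ {Y Z q r} → Real (mem Y) q → Real (mem Z) r → Y ↦ Z → K (Step q r)
  K-Step {Y} {Z} {q} {r} a b f k = K-∈ step′ λ g →
    K-imp (T? (𝓡 P)) (λ p → K-≤ a b λ y → entails Z (f y) (schP p ax)) λ h → k ((λ m → g m) , h)
    where
    Goal : ∀ {E} → E ∈ Φ → Set
    Goal {∇ B} m = On q (sub∇ m) → On r m
    Goal _ = ⊤
    step′ : ∀ {E} (m : E ∈ Φ) → K (Goal m)
    step′ {atom _} m = return tt
    step′ {⊤′} m = return tt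
    step′ {⊥′} m = return tt
    step′ {𝟏} m = return tt
    step′ {_ ∧ _} m = return tt
    step′ {_ ∨ _} m = return tt
    step′ {_ ⊗ _} m = return tt
    step′ {_ ⊸ _} m = return tt
    step′ {∇ B} m = K-imp (On? q (sub∇ m)) λ o → on b m (f (holds a _ o))

  module _ (sel : Selection Realized) where
    private
      s = proj₁ sel

    Pt : Set
    Pt = Σ State (T ∘ s)

    world-of : ∀ (x : Pt) → Realized (proj₁ x)
    world-of x = proj₁ (proj₂ sel) (proj₂ x)

    point : ∀ Z → K (Σ Pt λ x → Real (mem Z) (proj₁ x))
    point Z = realize (mem Z) >>= λ { (q , r) → K-laws Z r >>= λ l → proj₂ (proj₂ sel) (l , Z , r) >>= λ t → return ((q , t) , r) }

    Demand : Pt → ∀ {E} → E ∈ Φ → Set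
    Demand (q , _) {B ⊸ C} m = On q m ⊎ Σ Pt λ y → Step q (proj₁ y) × On (proj₁ y) (sub₁⊸ m) × ¬ On (proj₁ y) (sub₂⊸ m)
    Demand (q , _) {∇ B} m = (On q m → Σ Pt λ y → Step (proj₁ y) q × On (proj₁ y) (sub∇ m)) × (F ∈R 𝓡 → On q (sub∇ m) → On q m)
    Demand _ _ = ⊤

    demand : ∀ x {E} (m : E ∈ Φ) → K (Demand x m)
    demand x {atom _} m = return tt
    demand x {⊤′} m = return tt
    demand x {⊥′} m = return tt
    demand x {𝟏} m = return tt
    demand x {_ ∧ _} m = return tt
    demand x {_ ∨ _} m = return tt
    demand x {_ ⊗ _} m = return tt
    demand x {B ⊸ C} m with On? (proj₁ x) m | world-of x
    ... | yes o | _ = return (inj₁ o)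
    ... | no n | _ , Z , r =
      let (Y , f , b , nc) = refute-⊸ Z (off r m n) in
      point Y >>= λ { (y , r′) → K-Step {Z} {Y} r r′ f >>= λ st → on r′ _ b >>= λ ob → K-off r′ _ nc >>= λ oc →
      return (inj₂ (y , st , ob , oc)) }
    demand x {∇ B} m with world-of x
    ... | _ , Z , r = K-×
      (K-imp (On? (proj₁ x) m) λ o → let (Y , f , b) = witness-∇ Z (holds r m o) in
        point Y >>= λ { (y , r′) → K-Step {Y} {Z} r′ r f >>= λ st → on r′ _ b >>= λ ob → return (y , st , ob) })
      (K-imp (T? (𝓡 F)) λ f → K-imp (On? (proj₁ x) (sub∇ m)) λ o → on r m (entails Z (holds r _ o) (schF f ax)))

    module _ (demands : ∀ x {E} (m : E ∈ Φ) → Demand x m)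
      (serials : ∀ (x : Pt) → wF ∈R 𝓡 → Σ Pt λ y → Step (proj₁ x) (proj₁ y))
      (x₀ : Pt) (r₀ : Real (mem root) (proj₁ x₀)) (n₀ : ¬ On (proj₁ x₀) A∈Φ) (g₀ : All (proj₁ x₀ ∋ᵗ_) Γ) where

      points : Points
      points = record
        { X = Pt ; R₀ = λ x y → Step (proj₁ x) (proj₁ y) ; st = proj₁ ; ok = λ _ _ → ⊤ ; laws = λ {x} _ → proj₁ (world-of x)
        ; ok∧ = λ _ → tt , tt ; ok∨ = λ _ → tt , tt ; ok⊗ = λ _ → tt , tt ; ok⊸ = λ _ _ → tt , tt ; ok∇ = λ _ _ → tt
        -- Accessibility carries `A ⊸ B` at `x` to `∇ (A ⊸ B)` at `y`, where the local law applies;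
        -- coherence switches between occurrences of `A ⊸ B`.
        ; ⊸⁻ = λ {x} {y} m _ o st a → law (proj₁ (world-of y)) m (proj₁ st (sub∇⊸ m) (coherent (proj₁ (world-of x)) m _ o)) a
        ; ⊸? = λ {x} m _ → demands x m
        ; ∇⁺ = λ m _ st a → proj₁ st m a
        ; ∇⁻ = λ {x} m _ o → proj₁ (demands x m) o }

      module Fr = Relational.Frame (labelled points) (λ x y → proj₁ x ≤ᵗ proj₁ y) (λ {x} → ≤ᵗ-refl {proj₁ x}) (λ {x} {y} {z} → ≤ᵗ-trans {proj₁ x} {proj₁ y} {proj₁ z})
        (λ {x} {y} {x′} {y′} → Step-compat {proj₁ x} {proj₁ y} {proj₁ x′} {proj₁ y′})
        (λ {p} {x} {y} l → ∋ᵗ-up {proj₁ x} {proj₁ y} l)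

      hyps : All (λ B → (B ∈ Φ × ⊤) × proj₁ x₀ ∋ᵗ B) Γ
      hyps = All.map (λ a → (proj₁ a , tt) , a) g₀

      conclude : ∀ {M} → IsK M 𝓡 → (Valid M Γ A → ⊥) → Ans
      conclude k f = ⊥-elim (f (valid 0ℓ _ k))

      no-conclusion : proj₁ x₀ ∋ᵗ A → ⊥
      no-conclusion a = n₀ (pick (proj₁ (world-of x₀)) a A∈Φ)

      trivial : F ∈R 𝓡 → P ∈R 𝓡 → Ans
      trivial f p = conclude (λ S _ → isK S) (refuting x₀ hyps (A∈Φ , tt) no-conclusion)
        where
        -- Under F inclusion already implies the first clause of `Step`: `B` passes to the larger
        -- type, and there `∇ B` follows from `B`.
        open Fr.Trivial (λ st → proj₂ st p) (λ {x} {y} l → (λ m o → l m (proj₂ (demands x m) f o)) , λ _ → l)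

      inclusive : ¬ (N ∈R 𝓡) → ¬ (H ∈R 𝓡) → ¬ (F ∈R 𝓡) → P ∈R 𝓡 → Ans
      inclusive nn nh nf p = conclude isK (refuting x₀ hyps (A∈Φ , tt) no-conclusion)
        where
        open Fr.Inclusive (λ st → proj₂ st p)
        isK : IsK model 𝓡
        isK N i = ⊥-elim (nn i)
        isK H i = ⊥-elim (nh i)
        isK P i = condP
        isK F i = ⊥-elim (nf i)
        isK wF i = condwF (λ x → serials x i)

      plain : ¬ (N ∈R 𝓡) → ¬ (H ∈R 𝓡) → ¬ (P ∈R 𝓡) → Ans
      plain nn nh np = conclude isK (refuting x₀ hyps (A∈Φ , tt) no-conclusion)
        where
        open Fr.Plain
        isK : IsK model 𝓡
        isK N i = ⊥-elim (nn i)
        isK H i = ⊥-elim (nh i)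
        isK P i = ⊥-elim (np i)
        isK F i = condF (λ x → (λ m o → proj₂ (demands x m) i o) , λ p → ⊥-elim (np p))
        isK wF i = condwF (λ x → serials x i)

  Outcome : Set
  Outcome = (F ∈R 𝓡 → P ∈R 𝓡 → Ans) × (¬ (N ∈R 𝓡) → ¬ (H ∈R 𝓡) → ¬ (F ∈R 𝓡) → P ∈R 𝓡 → Ans)
    × (¬ (N ∈R 𝓡) → ¬ (H ∈R 𝓡) → ¬ (P ∈R 𝓡) → Ans)

  outcome : K Outcome
  outcome =
    select Realized finite-State >>= λ sel →
    finite-T (proj₁ sel) finite-State (λ x → K-∈ (demand sel x)) >>= λ demands →
    finite-T (proj₁ sel) finite-State (λ x → K-imp (T? (𝓡 wF)) λ w →
      let (_ , Z , r) = world-of sel x ; (Y , f) = serial w Z in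
      point sel Y >>= λ { (y , r′) → K-Step {Z} {Y} r r′ f >>= λ st → return (y , st) }) >>= λ serials →
    point sel root >>= λ { (x₀ , r₀) →
    K-off r₀ A∈Φ root-avoids >>= λ n₀ →
    K-All (λ m → on r₀ (Γ⊑Φ m) (root-⊇ m) >>= λ o → return (Γ⊑Φ m , o)) >>= λ g₀ →
    return ( trivial sel (λ x m → demands x m) serials x₀ r₀ n₀ g₀
           , inclusive sel (λ x m → demands x m) serials x₀ r₀ n₀ g₀
           , plain sel (λ x m → demands x m) serials x₀ r₀ n₀ g₀) }

-- Monotone sequences indexed by the integers, and surgery on them.

module Bounds (Ans : Set) where
  open Classical Ans

  Bounded : ∀ {a} → Set a → Setω
  Bounded A = ∀ {ℓ} {R : A → ℕ → Set ℓ} → (∀ {x k l} → k ℕ.≤ l → R x k → R x l) → (∀ x → K (∃ (R x))) → K (∃ λ k → ∀ x → R x k)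

  bounded-Bool : Bounded Bool
  bounded-Bool raise f = f true >>= λ { (k , p) → f false >>= λ { (l , q) →
    return (k ℕ.⊔ l , λ { true → raise (ℕₚ.m≤m⊔n k l) p ; false → raise (ℕₚ.m≤n⊔m k l) q }) } }

  bounded-Vec : ∀ {a} {A : Set a} {n} → Bounded A → Bounded (Vec A n)
  bounded-Vec {n = zero} ba raise f = f [] >>= λ { (k , p) → return (k , λ { [] → p }) }
  bounded-Vec {n = suc n} ba {R = R} raise f =
    ba {R = λ x k → ∀ xs → R (x ∷ xs) k} (λ l g xs → raise l (g xs)) (λ x → bounded-Vec ba raise (λ xs → f (x ∷ xs))) >>= λ
      { (k , g) → return (k , λ { (x ∷ xs) → g x xs }) }

cancel : ∀ i k → (i - k) + k ≡ i
cancel = solve 2 (λ i k → (i :- k) :+ k := i) refl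
  where open +-*-Solver

cancel′ : ∀ i k → (i + k) - k ≡ i
cancel′ = solve 2 (λ i k → (i :+ k) :- k := i) refl
  where open +-*-Solver

i≤i+n : ∀ i n → i ≤ i + + n
i≤i+n i n = ≤-trans (≤-reflexive (sym (+-identityʳ i))) (+-monoʳ-≤ i (ℤ.+≤+ ℕ.z≤n))

i-n≤i : ∀ i n → i - + n ≤ i
i-n≤i i n = ≤-trans (i≤i+n (i - + n) n) (≤-reflexive (cancel i (+ n)))

between : ∀ {i j} → i ≤ j → ∃ λ n → j ≡ i + + n
between {i} {j} l with j - i in e | ≤-trans (≤-reflexive (sym (+-inverseʳ i))) (+-monoˡ-≤ (- i) l)
... | + n | _ = n , trans (sym (trans (cong (_+ i) (sym e)) (cancel j i))) (+-comm (+ n) i)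

suc-+ : ∀ j k → sucℤ j + k ≡ sucℤ (j + k)
suc-+ j k = +-assoc 1ℤ j k

module Sequences (Ty : Set) (_⊑_ : Ty → Ty → Set) (⊑-refl : ∀ {q} → q ⊑ q) (⊑-trans : ∀ {p q r} → p ⊑ q → q ⊑ r → p ⊑ r)
  (⊑-antisym : ∀ {p q} → p ⊑ q → q ⊑ p → p ≡ q) (Q : Ty → Ty → Set) where

  ≡⇒⊑ : ∀ {p q} → p ≡ q → p ⊑ q
  ≡⇒⊑ refl = ⊑-refl

  -- The bounds beyond which the sequence is constant are part of the data, so that statements about
  -- all levels reduce to finitely many.
  record Seq : Set where
    field
      at   : ℤ → Ty
      mono : ∀ {i j} → i ≤ j → at i ⊑ at j
      loc  : ∀ j → Q (at j) (at (sucℤ j))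
      lo hi : ℤ
      below : ∀ {j} → j ≤ lo → at lo ⊑ at j
      above : ∀ {j} → hi ≤ j → at j ⊑ at hi

  open Seq public

  infix 4 _≤ᶠ_
  _≤ᶠ_ : Seq → Seq → Set
  t ≤ᶠ u = ∀ j → at t j ⊑ at u j

  shift : ℤ → Seq → Seq
  shift k t = record
    { at = λ j → at t (j + k)
    ; mono = λ l → mono t (+-monoˡ-≤ k l)
    ; loc = λ j → subst (λ i → Q (at t (j + k)) (at t i)) (sym (suc-+ j k)) (loc t (j + k))
    ; lo = lo t - k ; hi = hi t - k
    ; below = λ {j} l → subst (λ i → at t i ⊑ at t (j + k)) (sym (cancel (lo t) k))
        (below t (≤-trans (+-monoˡ-≤ k l) (≤-reflexive (cancel (lo t) k))))
    ; above = λ {j} l → subst (λ i → at t (j + k) ⊑ at t i) (sym (cancel (hi t) k))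
        (above t (≤-trans (≤-reflexive (sym (cancel (hi t) k))) (+-monoˡ-≤ k l))) }

  constant : (Z : Ty) → Q Z Z → Seq
  constant Z q = record { at = λ _ → Z ; mono = λ _ → ⊑-refl ; loc = λ _ → q ; lo = 0ℤ ; hi = 0ℤ ; below = λ _ → ⊑-refl ; above = λ _ → ⊑-refl }

  -- The two sequences share the entry at `b`, so each pair of neighbours lies entirely in `u` or
  -- entirely in `v` and inherits the local condition.
  module Glue (b : ℤ) (u v : Seq) (e : at u b ≡ at v b) where

    choose : ∀ j → Dec (j ≤ b) → Ty
    choose j (yes _) = at u j
    choose j (no _) = at v j

    val : ℤ → Ty
    val j = choose j (j ≤? b)

    left : ∀ {j} → j ≤ b → val j ≡ at u j
    left {j} l with j ≤? b
    ... | yes _ = refl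
    ... | no n = ⊥-elim (n l)

    right : ∀ {j} → b ≤ j → val j ≡ at v j
    right {j} l with j ≤? b
    ... | yes l′ rewrite ≤-antisym l l′ = e
    ... | no _ = refl

    val-mono : ∀ {i j} → i ≤ j → val i ⊑ val j
    val-mono {i} {j} l with i ≤? b | j ≤? b
    ... | yes _ | yes _ = mono u l
    ... | yes p | no n = ⊑-trans (mono u p) (⊑-trans (≡⇒⊑ e) (mono v (<⇒≤ (≰⇒> n))))
    ... | no n | yes p = ⊥-elim (n (≤-trans l p))
    ... | no _ | no _ = mono v l

    val-loc : ∀ j → Q (val j) (val (sucℤ j))
    val-loc j with b ≤? j
    ... | yes l = subst₂ Q (sym (right l)) (sym (right (≤-trans l (i≤suc[i] j)))) (loc v j)
    ... | no n = subst₂ Q (sym (left (<⇒≤ (≰⇒> n)))) (sym (left (i<j⇒suc[i]≤j (≰⇒> n)))) (loc u j)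

    glue : Seq
    glue = record
      { at = val ; mono = val-mono ; loc = val-loc ; lo = lo u ⊓ b ; hi = hi v ⊔ b
      ; below = λ {j} l → subst₂ _⊑_ (sym (left (i⊓j≤j (lo u) b))) (sym (left (≤-trans l (i⊓j≤j (lo u) b))))
          (⊑-trans (mono u (i⊓j≤i (lo u) b)) (below u (≤-trans l (i⊓j≤i (lo u) b))))
      ; above = λ {j} l → subst₂ _⊑_ (sym (right (≤-trans (i≤j⊔i (hi v) b) l))) (sym (right (i≤j⊔i (hi v) b)))
          (⊑-trans (above v (≤-trans (i≤i⊔j (hi v) b) l)) (mono v (i≤i⊔j (hi v) b))) }

  open Glue public using (glue)

  glue-left : ∀ b u v e {j} → j ≤ b → at (glue b u v e) j ≡ at u j
  glue-left b u v e = Glue.left b u v e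

  glue-right : ∀ b u v e {j} → b ≤ j → at (glue b u v e) j ≡ at v j
  glue-right b u v e = Glue.right b u v e

  same : ∀ {t p e i} → at t e ⊑ at t p → p ≤ i → i ≤ e → at t i ≡ at t p
  same {t} f l l′ = ⊑-antisym (⊑-trans (mono t l′) f) (mono t l)

  delete : (b : ℤ) (t : Seq) → at t (b + 1ℤ) ⊑ at t b → Seq
  delete b t f = glue b t (shift 1ℤ t) (⊑-antisym (mono t (i≤i+n b 1)) f)

  delete-left : ∀ b t f {j} → j ≤ b → at (delete b t f) j ≡ at t j
  delete-left b t f = glue-left b t (shift 1ℤ t) (⊑-antisym (mono t (i≤i+n b 1)) f)

  delete-right : ∀ b t f {j} → b ≤ j → at (delete b t f) j ≡ at t (j + 1ℤ)
  delete-right b t f = glue-right b t (shift 1ℤ t) (⊑-antisym (mono t (i≤i+n b 1)) f)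

  loop : ∀ t {b} → at t (b + 1ℤ) ⊑ at t b → Q (at t b) (at t b)
  loop t {b} f = subst (Q (at t b)) (⊑-antisym (⊑-trans (≡⇒⊑ (cong (at t) (+-comm 1ℤ b))) f) (mono t (i≤suc[i] b))) (loc t b)

  lift : (b : ℤ) (t : Seq) → at t (b + 1ℤ) ⊑ at t b → Seq
  lift b t f = glue b (constant (at t b) (loop t f)) t refl

  LeftConst ConstAfter : Seq → ℤ → Set
  LeftConst t p = ∀ {i} → i ≤ p → at t p ⊑ at t i
  ConstAfter t h = ∀ {i} → h ≤ i → at t i ⊑ at t h

module Arithmetic where
  open +-*-Solver

  move-minus : ∀ b x s j → b + (x + s) ≤ j → b + x ≤ j - s
  move-minus b x s j l = ≤-trans (≤-reflexive (lemma b x s)) (+-monoˡ-≤ (- s) l)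
    where
    lemma : ∀ b x s → b + x ≡ (b + (x + s)) - s
    lemma = solve 3 (λ b x s → b :+ x := (b :+ (x :+ s)) :- s) refl

  window-end : ∀ j s → (j - s) + (1ℤ + (s + s)) ≡ (j + 1ℤ) + s
  window-end = solve 2 (λ j s → (j :- s) :+ (con 1ℤ :+ (s :+ s)) := (j :+ con 1ℤ) :+ s) refl

  rebase : ∀ p q r → (p + r) + (q - p) ≡ q + r
  rebase = solve 3 (λ p q r → (p :+ r) :+ (q :- p) := q :+ r) refl

  rebase-minus : ∀ p q r → (p - r) + (q - p) ≡ q - r
  rebase-minus = solve 3 (λ p q r → (p :- r) :+ (q :- p) := q :- r) refl

  step-out : ∀ p x → (p + x) + 1ℤ ≡ p + (1ℤ + x)
  step-out = solve 2 (λ p x → (p :+ x) :+ con 1ℤ := p :+ (con 1ℤ :+ x)) refl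

  step-in : ∀ p r → (p + 1ℤ) + r ≡ p + (1ℤ + r)
  step-in = solve 2 (λ p r → (p :+ con 1ℤ) :+ r := p :+ (con 1ℤ :+ r)) refl

  shift-back : ∀ i k → (i + - k) + k ≡ i
  shift-back = solve 2 (λ i k → (i :+ (:- k)) :+ k := i) refl

  window-top : ∀ s → (- s) + (s + s) ≡ s
  window-top = solve 1 (λ s → (:- s) :+ (s :+ s) := s) refl

  neg-diff : ∀ k s → (- s) + k ≡ k - s
  neg-diff = solve 2 (λ k s → (:- s) :+ k := k :- s) refl

  early : ∀ s k d → k + (d + (- s - k)) ≡ (- s) + d
  early = solve 3 (λ s k d → k :+ (d :+ ((:- s) :- k)) := (:- s) :+ d) refl

  late : ∀ k d x → k + (d - (k - x)) ≡ x + d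
  late = solve 3 (λ k d x → k :+ (d :- (k :- x)) := x :+ d) refl

  level : ∀ s → ((- s) + (s + (s + s))) - s ≡ s
  level = solve 1 (λ s → ((:- s) :+ (s :+ (s :+ s))) :- s := s) refl

  later-shift : ∀ i d k x → i + (d - (k - x)) ≡ (i - (k - x)) + d
  later-shift = solve 4 (λ i d k x → i :+ (d :- (k :- x)) := (i :- (k :- x)) :+ d) refl

  regroup : ∀ i d e → i + (d + e) ≡ (i + d) + e
  regroup = solve 3 (λ i d e → i :+ (d :+ e) := (i :+ d) :+ e) refl

  to-diff : ∀ j e → j + (e - j) ≡ e
  to-diff = solve 2 (λ j e → j :+ (e :- j) := e) refl

open Arithmetic

-- Fires δ at a level of a consistent sequence (one in 𝒲, below) demands a consistent extension with Wit δ there.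
module Barrier (Ans : Set) (Ty : Set) (_⊑_ : Ty → Ty → Set) (⊑-refl : ∀ {q} → q ⊑ q) (⊑-trans : ∀ {p q r} → p ⊑ q → q ⊑ r → p ⊑ r)
  (⊑-antisym : ∀ {p q} → p ⊑ q → q ⊑ p → p ≡ q) (_⊑?_ : ∀ p q → Dec (p ⊑ q))
  (off : Ty → ℕ) (off-strict : ∀ {p q} → p ⊑ q → ¬ (q ⊑ p) → off q ℕ.< off p)
  (Q : Ty → Ty → Set) (D : Set) (Fires Wit : D → Ty → Set) where

  open Classical Ans
  open Bounds Ans
  open Sequences Ty _⊑_ ⊑-refl ⊑-trans ⊑-antisym Q public

  -- The answer counts up to translation, so a class used for coinduction need not contain all
  -- translates of its members.
  record Reply (𝒱 : Seq → Set) (t : Seq) (δ : D) (j : ℤ) : Set where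
    constructor reply
    field
      answer : Seq
      by     : ℤ
      valid  : 𝒱 answer
      over   : t ≤ᶠ shift by answer
      wit    : Wit δ (at (shift by answer) j)

  tab : ∀ L → Seq → ℤ → Vec Ty (suc L)
  tab zero t p = at t p ∷ []
  tab (suc L) t p = at t p ∷ tab L t (p + 1ℤ)

  tab-at : ∀ L {t u p q} → tab L t p ≡ tab L u q → ∀ r → r ℕ.≤ L → at t (p + + r) ≡ at u (q + + r)
  tab-at zero {t} {u} {p} {q} e zero _ = trans (cong (at t) (+-identityʳ p)) (trans (proj₁ (∷-injective e)) (cong (at u) (sym (+-identityʳ q))))
  tab-at (suc L) {t} {u} {p} {q} e zero _ = trans (cong (at t) (+-identityʳ p)) (trans (proj₁ (∷-injective e)) (cong (at u) (sym (+-identityʳ q))))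
  tab-at (suc L) {t} {u} {p} {q} e (suc r) (ℕ.s≤s l) =
    trans (cong (at t) (sym (step-in p (+ r)))) (trans (tab-at L {t} {u} (proj₂ (∷-injective e)) r l) (cong (at u) (step-in q (+ r))))

  tab-cong : ∀ L {t u p} → (∀ {i} → p ≤ i → at t i ≡ at u i) → tab L t p ≡ tab L u p
  tab-cong zero f = cong (_∷ []) (f ≤-refl)
  tab-cong (suc L) {p = p} f = cong₂ _∷_ (f ≤-refl) (tab-cong L (λ l → f (≤-trans (i≤i+n p 1) l)))

  -- Each block of length `g` that is not constant strictly lowers `off`, which is below `m` at `p`;
  -- so one of `m` consecutive blocks is constant.
  pigeon : ∀ m g u p → off (at u p) ℕ.< m → ∃ λ b → p ≤ b × b + + g ≤ p + + (m ℕ.* g) × at u (b + + g) ⊑ at u b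
  pigeon (suc m) g u p l with at u (p + + g) ⊑? at u p
  ... | yes f = p , ≤-refl , +-monoʳ-≤ p (ℤ.+≤+ (ℕₚ.m≤m+n g _)) , f
  ... | no n with pigeon m g u (p + + g) (ℕₚ.<-≤-trans (off-strict (mono u (i≤i+n p g)) n) (ℕ.s≤s⁻¹ l))
  ... | b , l₁ , l₂ , f = b , ≤-trans (i≤i+n p g) l₁ , ≤-trans l₂ (≤-reflexive (+-assoc p (+ g) (+ (m ℕ.* g)))) , f

  settle : ∀ u p S → ∃ λ k → ConstAfter u (p + + (S ℕ.+ k))
  settle u p S with ≤-total (hi u) p
  ... | inj₁ l = 0 , λ {i} l′ → ⊑-trans (above u (≤-trans l (≤-trans (i≤i+n p _) l′))) (mono u (≤-trans l (i≤i+n p _)))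
  ... | inj₂ l with between l
  ... | n , e = n , λ {i} l′ → ⊑-trans (above u (≤-trans h l′)) (mono u h)
    where
    h : hi u ≤ p + + (S ℕ.+ n)
    h = ≤-trans (≤-reflexive e) (+-monoʳ-≤ p (ℤ.+≤+ (ℕₚ.m≤n+m n S)))

  up-shift : ∀ {t u d} → 0ℤ ≤ d → t ≤ᶠ u → t ≤ᶠ shift d u
  up-shift {u = u} {d} l f j = ⊑-trans (f j) (mono u (≤-trans (≤-reflexive (sym (+-identityʳ j))) (+-monoʳ-≤ j l)))

  ConstAfter-shift : ∀ {u p S k} → ConstAfter u (p + + (S ℕ.+ suc k)) → ConstAfter (shift 1ℤ u) (p + + (S ℕ.+ k))
  ConstAfter-shift {u} {p} {S} {k} c {i} l =
    ⊑-trans (c (≤-trans (≤-reflexive (sym e)) (+-monoˡ-≤ 1ℤ l))) (≡⇒⊑ (cong (at u) (sym e)))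
    where
    e : (p + + (S ℕ.+ k)) + 1ℤ ≡ p + + (S ℕ.+ suc k)
    e = trans (step-out p (+ (S ℕ.+ k))) (cong (λ x → p + + x) (sym (ℕₚ.+-suc S k)))

  -- `𝒲` stands for the consistent sequences. By `W-coind` it contains every class whose demands are
  -- met within the union of that class and `𝒲`.
  module Within (𝒲 : Seq → Set)
    (W-shift : ∀ {t} k → 𝒲 t → 𝒲 (shift k t))
    (W-reply : ∀ {t} → 𝒲 t → ∀ δ j → Fires δ (at t j) → K (∃ λ u → 𝒲 u × t ≤ᶠ u × Wit δ (at u j)))
    (W-coind : (𝒢 : Seq → Set) → (∀ {t} → 𝒢 t → ∀ δ j → Fires δ (at t j) → K (Reply (λ y → 𝒲 y ⊎ 𝒢 y) t δ j)) → ∀ {t} → 𝒢 t → 𝒲 t)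
    (bnd : ∀ {L} {R : Vec Ty L → ℕ → Set} → (∀ {x k l} → k ℕ.≤ l → R x k → R x l) → (∀ x → K (∃ (R x))) → K (∃ λ k → ∀ x → R x k)) where

    reply₀ : ∀ {𝒱 t δ j} (y : Seq) → 𝒱 y → t ≤ᶠ y → Wit δ (at y j) → Reply 𝒱 t δ j
    reply₀ {t = t} {δ} {j} y v o w = reply y 0ℤ v (up-shift {t} {y} ≤-refl o) (subst (λ i → Wit δ (at y i)) (sym (+-identityʳ j)) w)

    -- Constant blocks of length g whose type omits fewer than m formulas can be shortened, or extended to −∞.
    record Good (m g : ℕ) : Set where
      field
        pos  : 1 ℕ.≤ g
        del  : ∀ {t b} → 𝒲 t → off (at t b) ℕ.< m → at t (b + + g) ⊑ at t b → (f : at t (b + 1ℤ) ⊑ at t b) → 𝒲 (delete b t f)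
        lft  : ∀ {t b} → 𝒲 t → off (at t b) ℕ.< m → at t (b + + g) ⊑ at t b → (f : at t (b + 1ℤ) ⊑ at t b) → 𝒲 (lift b t f)

      short : ∀ t b → at t (b + + g) ⊑ at t b → at t (b + 1ℤ) ⊑ at t b
      short t b = ⊑-trans (mono t (+-monoʳ-≤ b (ℤ.+≤+ pos)))

    ≤-delete : ∀ {t b f} → t ≤ᶠ delete b t f
    ≤-delete {t} {b} {f} i with ≤-total i b
    ... | inj₁ l = ≡⇒⊑ (sym (delete-left b t f l))
    ... | inj₂ l = ⊑-trans (mono t (i≤i+n i 1)) (≡⇒⊑ (sym (delete-right b t f l)))

    module Step (m g : ℕ) (good : Good m g) where
      open Good good

      S : ℕ
      S = m ℕ.* g

      -- The `S` positions after `p` contain a block that may be shortened. Deleting one entry draws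
      -- the constant tail one position nearer and changes nothing up to `p`; `k` deletions bring it
      -- to `p + S`.
      trim : ∀ k {u p} → 𝒲 u → off (at u p) ℕ.< m → ConstAfter u (p + + (S ℕ.+ k)) →
        ∃ λ u′ → 𝒲 u′ × u ≤ᶠ u′ × (∀ {i} → i ≤ p → at u′ i ≡ at u i) × ConstAfter u′ (p + + S)
      trim zero {u} {p} w l c = u , w , (λ _ → ⊑-refl) , (λ _ → refl) , subst (λ x → ConstAfter u (p + + x)) (ℕₚ.+-identityʳ S) c
      trim (suc k) {u} {p} w l c with pigeon m g u p l
      ... | b , l₁ , l₂ , f =
        let (u′ , w′ , o , a , c′) = trim k {u₁} {p} (del w lb f f₁) (subst (λ q → off q ℕ.< m) (sym (agree ≤-refl)) l) c₁
        in u′ , w′ , (λ i → ⊑-trans (≤-delete {u} {b} {f₁} i) (o i)) , (λ i≤p → trans (a i≤p) (agree i≤p)) , c′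
        where
        f₁ = short u b f
        u₁ = delete b u f₁
        agree : ∀ {i} → i ≤ p → at u₁ i ≡ at u i
        agree i≤p = delete-left b u f₁ (≤-trans i≤p l₁)
        lb : off (at u b) ℕ.< m
        lb with at u b ⊑? at u p
        ... | yes e = subst (λ q → off q ℕ.< m) (⊑-antisym (mono u l₁) e) l
        ... | no n = ℕₚ.<-trans (off-strict (mono u l₁) n) l
        far : b ≤ p + + (S ℕ.+ k)
        far = ≤-trans (i≤i+n b g) (≤-trans l₂ (+-monoʳ-≤ p (ℤ.+≤+ (ℕₚ.m≤m+n S k))))
        c₁ : ConstAfter u₁ (p + + (S ℕ.+ k))
        c₁ {i} h = subst₂ _⊑_ (sym (delete-right b u f₁ (≤-trans far h))) (sym (delete-right b u f₁ far))
          (ConstAfter-shift {u} {p} {S} {k} c h)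

      smaller : ∀ {q Z} → off Z ℕ.< suc m → Z ⊑ q → ¬ (q ⊑ Z) → off q ℕ.< m
      smaller l f n = ℕₚ.<-≤-trans (off-strict f n) (ℕ.s≤s⁻¹ l)

      -- The entry at `j` must survive. If the type exceeds `Z` at `j + 1`, it omits fewer than `m`
      -- formulas there and `trim` applies from there on. Otherwise `Z` fills the stretch from
      -- `j − S` to `j + 1`, and translating by one moves the tail without altering the entry at
      -- `j`.
      tidy : ∀ k {u j Z} → 𝒲 u → off Z ℕ.< suc m → Z ⊑ at u (j - + S) → at u (j - + S) ⊑ Z → ConstAfter u ((j + 1ℤ) + + (S ℕ.+ k)) →
        ∃ λ u′ → 𝒲 u′ × u ≤ᶠ u′ × at u′ j ≡ at u j × at u′ (j - + S) ⊑ Z × ConstAfter u′ ((j + 1ℤ) + + S)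
      tidy zero {u} {j} w l z₁ z₂ c = u , w , (λ _ → ⊑-refl) , refl , z₂ , subst (λ x → ConstAfter u ((j + 1ℤ) + + x)) (ℕₚ.+-identityʳ S) c
      tidy (suc k) {u} {j} {Z} w l z₁ z₂ c with at u (j + 1ℤ) ⊑? Z
      ... | no n =
        let (u′ , w′ , o , a , c′) = trim (suc k) {u} {j + 1ℤ} w (smaller l (⊑-trans z₁ (mono u (≤-trans (i-n≤i j S) (i≤i+n j 1)))) n) c
        in u′ , w′ , o , a (i≤i+n j 1) , ⊑-trans (≡⇒⊑ (a (≤-trans (i-n≤i j S) (i≤i+n j 1)))) z₂ , c′
      ... | yes y =
        let (u′ , w′ , o , e , z , c′) = tidy k {shift 1ℤ u} {j} {Z} (W-shift 1ℤ w) l (⊑-trans z₁ (mono u (i≤i+n (j - + S) 1)))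
              (⊑-trans (mono u (+-monoˡ-≤ 1ℤ (i-n≤i j S))) y) (ConstAfter-shift {u} {j + 1ℤ} {S} {k} c)
        in u′ , w′ , (λ i → ⊑-trans (mono u (i≤i+n i 1)) (o i))
         , trans e (⊑-antisym (⊑-trans y (⊑-trans z₁ (mono u (i-n≤i j S)))) (mono u (i≤i+n j 1))) , z , c′

      -- The window runs from `S` places before a demanded level to `S` places after its successor.
      L : ℕ
      L = suc (S ℕ.+ S)

      -- A window occurring after arbitrarily long blocks will turn out to be consistent after an infinite one.
      After : Vec Ty (suc L) → ℕ → Set
      After w k = ∃ λ t → ∃ λ p → 𝒲 t × tab L t p ≡ w × ConstAfter t (p + + L) × at t p ⊑ at t (p - + k) × off (at t p) ℕ.< suc m

      After-mono : ∀ {w k l} → k ℕ.≤ l → After w l → After w k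
      After-mono {l = l} h (t , p , w , e , c , f , o) =
        t , p , w , e , c , ⊑-trans f (mono t (+-monoʳ-≤ p (ℤₚ.neg-mono-≤ (ℤ.+≤+ h)))) , o

      Verdict : Vec Ty (suc L) → ℕ → Set
      Verdict w k = (After w k → Ans) ⊎ (∀ l → K (After w l))

      -- There are finitely many windows, so a single threshold separates those bounded in the
      -- length of the preceding block from those that follow blocks of every length.
      verdicts : K (∃ λ k → ∀ w → Verdict w k)
      verdicts = bnd (λ { h (inj₁ n) → inj₁ (n ∘ After-mono h) ; h (inj₂ a) → inj₂ a })
        (λ w → em (∃ λ k → After w k → Ans) >>= λ { (inj₁ (k , n)) → return (k , inj₁ n)
                                                  ; (inj₂ n) → return (0 , inj₂ λ l a → n (l , a)) })

      module Next (G₀ : ℕ) (verdict : ∀ w → Verdict w G₀) where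

        -- `G₀` entries for the block before a window, `S` for the part of the window before the
        -- demanded level, and one for an entry that may be deleted.
        κ : ℕ
        κ = suc (G₀ ℕ.+ S)

        𝒢₂ : Seq → Set
        𝒢₂ x = ∃ λ p → LeftConst x p × ConstAfter x (p + + L) × off (at x p) ℕ.< suc m × (∀ k → K (After (tab L x p) k))

        -- Here `x` is `t` with its long block prolonged to -∞. A demand inside the flat part is
        -- raised at `e` instead, which has the same type, and the reply is translated; as sequences
        -- are monotone, this only enlarges it.
        core : ∀ {t b e x} → 𝒲 t → at t e ⊑ at t b → b + + κ ≤ e → off (at t b) ℕ.< suc m →
          (∀ {i} → b ≤ i → at x i ≡ at t i) → (∀ {i} → i ≤ e → at x i ≡ at t b) →
          ∀ δ j → Fires δ (at x j) → K (Reply (λ y → 𝒲 y ⊎ 𝒢₂ y) x δ j)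
        core {t} {b} {e} {x} w blk len o agr flat δ j fi = go (≤-total e j)
          where
          b≤e : b ≤ e
          b≤e = ≤-trans (i≤i+n b κ) len
          main : ∀ d j′ → 0ℤ ≤ d → j′ ≡ j + d → e ≤ j′ → at x j ≡ at t j′ → K (Reply (λ y → 𝒲 y ⊎ 𝒢₂ y) x δ j)
          main d j′ d≥0 refl e≤j′ eq = W-reply w δ j′ (subst (Fires δ) eq fi) >>= λ { (u , wu , t≤u , wt) → cases u wu t≤u wt (at u p′ ⊑? at t b) }
            where
            p′ = j′ - + S
            p′≤j′ : p′ ≤ j′
            p′≤j′ = i-n≤i j′ S
            b+G≤p′ : b + + G₀ ≤ p′
            b+G≤p′ = move-minus b (+ G₀) (+ S) j′ (≤-trans (≤-trans (+-monoʳ-≤ b (ℤ.+≤+ (ℕₚ.n≤1+n _))) len) e≤j′)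
            b≤p′ : b ≤ p′
            b≤p′ = ≤-trans (i≤i+n b G₀) b+G≤p′
            cases : ∀ u → 𝒲 u → t ≤ᶠ u → Wit δ (at u j′) → Dec (at u p′ ⊑ at t b) → K (Reply (λ y → 𝒲 y ⊎ 𝒢₂ y) x δ j)
            -- The reply has left the block type before the window, so it omits fewer than `m`
            -- formulas there; a block met before the demanded level can be prolonged to -∞ by
            -- induction.
            cases u wu t≤u wt (no n) with pigeon m g u p′ (smaller o (⊑-trans (mono t b≤p′) (t≤u p′)) n)
            ... | b′ , l₁ , l₂ , f = return (reply y₀ d (inj₁ (lft wu lb f (short u b′ f))) (up-shift {x} {y₀} d≥0 over) (subst (Wit δ) (sym (glue-right b′ _ u refl b′≤j′)) wt))
              where
              y₀ = lift b′ u (short u b′ f)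
              b′≤j′ : b′ ≤ j′
              b′≤j′ = ≤-trans (i≤i+n b′ g) (≤-trans l₂ (≤-reflexive (cancel j′ (+ S))))
              lb : off (at u b′) ℕ.< m
              lb with at u b′ ⊑? at t b
              ... | yes q = ⊥-elim (n (⊑-trans (mono u l₁) q))
              ... | no q = smaller o (⊑-trans (mono t (≤-trans b≤p′ l₁)) (t≤u b′)) q
              over : x ≤ᶠ y₀
              over i with ≤-total i b′
              ... | inj₁ l = ⊑-trans (mono x l) (⊑-trans (≡⇒⊑ (agr (≤-trans b≤p′ l₁))) (⊑-trans (t≤u b′) (≡⇒⊑ (sym (glue-left b′ (constant (at u b′) (loop u (short u b′ f))) u refl l)))))
              ... | inj₂ l = ⊑-trans (≡⇒⊑ (agr (≤-trans b≤p′ (≤-trans l₁ l)))) (⊑-trans (t≤u i) (≡⇒⊑ (sym (glue-right b′ (constant (at u b′) (loop u (short u b′ f))) u refl l))))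
            -- The reply still has the block type at `p′`. Prolonging it leftwards from there is
            -- justified by the verdict: the tidied window follows a block of length at least `G₀`,
            -- hence arbitrarily long ones.
            cases u wu t≤u wt (yes z₂) with settle u (j′ + 1ℤ) S
            ... | k , c with tidy k {u} {j′} wu o (⊑-trans (mono t b≤p′) (t≤u p′)) z₂ c
            ... | u′ , wu′ , u≤u′ , eqj , z , c′ = decide (verdict (tab L y₀ p′))
              where
              Z = at t b
              Z≡ : Z ≡ at u′ p′
              Z≡ = ⊑-antisym (⊑-trans (⊑-trans (mono t b≤p′) (t≤u p′)) (u≤u′ p′)) z
              cst = constant Z (loop t {b} (⊑-trans (mono t (≤-trans (+-monoʳ-≤ b (ℤ.+≤+ (ℕ.s≤s ℕ.z≤n))) len)) blk))
              y₀ = glue p′ cst u′ Z≡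
              c″ : ConstAfter u′ (p′ + + L)
              c″ = subst (ConstAfter u′) (sym (window-end j′ (+ S))) c′
              p′≤end : p′ ≤ p′ + + L
              p′≤end = i≤i+n p′ L
              after : After (tab L y₀ p′) G₀
              after = u′ , p′ , wu′ , tab-cong L (λ l → sym (glue-right p′ cst u′ Z≡ l)) , c″
                , ⊑-trans z (⊑-trans (mono t (≤-trans (≤-reflexive (sym (cancel′ b (+ G₀)))) (+-monoˡ-≤ (- + G₀) b+G≤p′))) (⊑-trans (t≤u _) (u≤u′ _)))
                , subst (λ q → off q ℕ.< suc m) Z≡ o
              member : (∀ l → K (After (tab L y₀ p′) l)) → 𝒢₂ y₀
              member a = p′
                , (λ l → ≡⇒⊑ (trans (glue-left p′ cst u′ Z≡ ≤-refl) (sym (glue-left p′ cst u′ Z≡ l))))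
                , (λ l → subst₂ _⊑_ (sym (glue-right p′ cst u′ Z≡ (≤-trans p′≤end l))) (sym (glue-right p′ cst u′ Z≡ p′≤end)) (c″ l))
                , subst (λ q → off q ℕ.< suc m) (sym (glue-left p′ cst u′ Z≡ ≤-refl)) o , a
              over : x ≤ᶠ y₀
              over i with ≤-total i p′
              ... | inj₁ l = ⊑-trans (mono x l) (⊑-trans (≡⇒⊑ (agr b≤p′)) (⊑-trans (t≤u p′) (⊑-trans z₂ (≡⇒⊑ (sym (glue-left p′ cst u′ Z≡ l))))))
              ... | inj₂ l = ⊑-trans (≡⇒⊑ (agr (≤-trans b≤p′ l))) (⊑-trans (t≤u i) (⊑-trans (u≤u′ i) (≡⇒⊑ (sym (glue-right p′ cst u′ Z≡ l)))))
              decide : Verdict (tab L y₀ p′) G₀ → K (Reply (λ y → 𝒲 y ⊎ 𝒢₂ y) x δ j)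
              decide (inj₁ n) _ = n after
              decide (inj₂ a) = return (reply y₀ d (inj₂ (member a)) (up-shift {x} {y₀} d≥0 over)
                (subst (Wit δ) (sym (trans (glue-right p′ cst u′ Z≡ p′≤j′) eqj)) wt))
          go : e ≤ j ⊎ j ≤ e → K (Reply (λ y → 𝒲 y ⊎ 𝒢₂ y) x δ j)
          go (inj₁ l) = main 0ℤ j ≤-refl (sym (+-identityʳ j)) l (agr (≤-trans b≤e l))
          go (inj₂ l) = main (e - j) e (i≤j⇒0≤j-i l) (sym (to-diff j e)) ≤-refl (trans (flat l) (sym (same {t} blk b≤e ≤-refl)))

        -- A member of `𝒢₂` agrees with a consistent sequence in which its window follows a block of
        -- length `κ`, the block being prolonged to -∞; `core` then answers its demands within `𝒲`
        -- and `𝒢₂`.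
        𝒢₂⊆𝒲 : ∀ {x} → 𝒢₂ x → 𝒲 x
        𝒢₂⊆𝒲 = W-coind 𝒢₂ λ { {x} (p , lc , ca , o , a) δ j fi → a κ >>= λ { (t , pt , w , e , c , f , _) → closed′ {x} p lc ca o t pt w e c f δ j fi } }
          where
          closed′ : ∀ {x} p → LeftConst x p → ConstAfter x (p + + L) → off (at x p) ℕ.< suc m →
            ∀ t pt → 𝒲 t → tab L t pt ≡ tab L x p → ConstAfter t (pt + + L) → at t pt ⊑ at t (pt - + κ) →
            ∀ δ j → Fires δ (at x j) → K (Reply (λ y → 𝒲 y ⊎ 𝒢₂ y) x δ j)
          closed′ {x} p lc ca o t pt w e c f = core {shift (pt - p) t} {p - + κ} {p} {x} (W-shift (pt - p) w)
              (subst₂ _⊑_ (cong (at t) (sym at-p)) (cong (at t) (sym (rebase-minus p pt (+ κ)))) f)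
              (≤-reflexive (cancel p (+ κ)))
              (subst (λ q → off q ℕ.< suc m) (trans (sym b≡) refl) o)
              agr (λ l → trans (⊑-antisym (mono x l) (lc l)) (sym b≡))
            where
            at-p : p + (pt - p) ≡ pt
            at-p = to-diff p pt
            t^ = shift (pt - p) t
            right : ∀ r → at x (p + + r) ≡ at t^ (p + + r)
            right r with ℕₚ.≤-total r L
            ... | inj₁ l = trans (sym (tab-at L {t} {x} e r l)) (cong (at t) (sym (rebase p pt (+ r))))
            ... | inj₂ l = trans (⊑-antisym (ca lr) (mono x lr)) (trans (trans (sym (tab-at L {t} {x} e L ℕₚ.≤-refl)) (⊑-antisym (mono t lr′) (c lr′)))
                              (cong (at t) (sym (rebase p pt (+ r)))))
              where
              lr : p + + L ≤ p + + r
              lr = +-monoʳ-≤ p (ℤ.+≤+ l)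
              lr′ : pt + + L ≤ pt + + r
              lr′ = +-monoʳ-≤ pt (ℤ.+≤+ l)
            right′ : ∀ {i} → p ≤ i → at x i ≡ at t^ i
            right′ l with between l
            ... | r , refl = right r
            b≡ : at t^ (p - + κ) ≡ at x p
            b≡ = trans (trans (cong (at t) (rebase-minus p pt (+ κ)))
                   (⊑-antisym (mono t (i-n≤i pt κ)) f)) (trans (cong (at t) (sym at-p)) (sym (right′ ≤-refl)))
            agr : ∀ {i} → p - + κ ≤ i → at x i ≡ at t^ i
            agr {i} l with ≤-total p i
            ... | inj₁ l′ = right′ l′
            ... | inj₂ l′ = trans (⊑-antisym (mono x l′) (lc l′)) (trans (sym b≡)
                  (sym (same {t^} {p - + κ} {p} (≡⇒⊑ (trans (sym (right′ ≤-refl)) (sym b≡))) l l′)))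

        join : ∀ {x δ j} → K (Reply (λ y → 𝒲 y ⊎ 𝒢₂ y) x δ j) → ∀ {𝒢 : Seq → Set} → K (Reply (λ y → 𝒲 y ⊎ 𝒢 y) x δ j)
        join r = r >>= λ { (reply y k (inj₁ w) o wt) → return (reply y k (inj₁ w) o wt)
                         ; (reply y k (inj₂ w) o wt) → return (reply y k (inj₁ (𝒢₂⊆𝒲 w)) o wt) }

        lift-ok : ∀ {t b} → 𝒲 t → off (at t b) ℕ.< suc m → at t (b + + κ) ⊑ at t b → (f : at t (b + 1ℤ) ⊑ at t b) → 𝒲 (lift b t f)
        lift-ok {t} {b} w o blk f = W-coind (_≡ lift b t f) (λ { refl δ j fi → join (core {t} {b} {b + + κ} {lift b t f} w blk ≤-refl o
            (λ l → glue-right b cst t refl l) flat δ j fi) }) refl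
          where
          cst = constant (at t b) (loop t f)
          flat : ∀ {i} → i ≤ b + + κ → at (lift b t f) i ≡ at t b
          flat {i} l with ≤-total i b
          ... | inj₁ l′ = glue-left b cst t refl l′
          ... | inj₂ l′ = trans (glue-right b cst t refl l′) (same {t} blk l′ l)

        -- The coinductive class keeps the shortened right part of `t` fixed while the part left of
        -- `b` ranges over consistent enlargements of `t` with unchanged type at `b`.
        delete-ok : ∀ {t b} → 𝒲 t → off (at t b) ℕ.< suc m → at t (b + + κ) ⊑ at t b → (f : at t (b + 1ℤ) ⊑ at t b) → 𝒲 (delete b t f)
        delete-ok {t} {b} w o blk f = W-coind 𝒢 closed′ (t , w , (λ _ → ⊑-refl) , b≡ , refl)
          where
          t₁ = shift 1ℤ t
          b≡ : at t b ≡ at t₁ b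
          b≡ = ⊑-antisym (mono t (i≤i+n b 1)) f
          tL = lift b t f
          cst = constant (at t b) (loop t f)
          𝒢 : Seq → Set
          𝒢 y = ∃ λ u → 𝒲 u × t ≤ᶠ u × Σ (at u b ≡ at t₁ b) λ e → y ≡ glue b u t₁ e
          b≤tL : ∀ i → at t b ⊑ at tL i
          b≤tL i with ≤-total i b
          ... | inj₁ l = ≡⇒⊑ (sym (glue-left b cst t refl l))
          ... | inj₂ l = ⊑-trans (mono t l) (≡⇒⊑ (sym (glue-right b cst t refl l)))
          closed′ : ∀ {y} → 𝒢 y → ∀ δ j → Fires δ (at y j) → K (Reply (λ y → 𝒲 y ⊎ 𝒢 y) y δ j)
          closed′ (u , wu , t≤u , e , refl) δ j fi with ≤-total b j
          -- The demand is put to the lifted sequence, not to `u`: its constant left part, moved by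
          -- one, dominates whatever stands left of the cut.
          ... | inj₁ b≤j = W-reply (lift-ok w o blk f) δ (j + 1ℤ) (subst (Fires δ) (trans (glue-right b u t₁ e b≤j) (sym (glue-right b cst t refl (≤-trans b≤j (i≤i+n j 1))))) fi) >>= λ
              { (v , wv , tL≤v , wt) → return (reply v 1ℤ (inj₁ wv) (over v tL≤v) wt) }
            where
            over : ∀ v → tL ≤ᶠ v → glue b u t₁ e ≤ᶠ shift 1ℤ v
            over v tL≤v i with ≤-total i b
            ... | inj₁ l = ⊑-trans (≡⇒⊑ (glue-left b u t₁ e l)) (⊑-trans (mono u l) (⊑-trans (≡⇒⊑ (trans e (sym b≡))) (⊑-trans (b≤tL (i + 1ℤ)) (tL≤v (i + 1ℤ)))))
            ... | inj₂ l = ⊑-trans (≡⇒⊑ (trans (glue-right b u t₁ e l) (sym (glue-right b cst t refl (≤-trans l (i≤i+n i 1)))))) (tL≤v (i + 1ℤ))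
          ... | inj₂ j≤b = W-reply wu δ j (subst (Fires δ) (glue-left b u t₁ e j≤b) fi) >>= λ
              { (u′ , wu′ , u≤u′ , wt) → cases u′ wu′ u≤u′ wt (at u′ b ⊑? at t b) }
            where
            cases : ∀ u′ → 𝒲 u′ → u ≤ᶠ u′ → Wit δ (at u′ j) → Dec (at u′ b ⊑ at t b) → K (Reply (λ y → 𝒲 y ⊎ 𝒢 y) (glue b u t₁ e) δ j)
            cases u′ wu′ u≤u′ wt (yes z) = return (reply₀ y′ (inj₂ (u′ , wu′ , t≤u′ , e′ , refl)) over (subst (Wit δ) (sym (glue-left b u′ t₁ e′ j≤b)) wt))
              where
              t≤u′ : t ≤ᶠ u′
              t≤u′ i = ⊑-trans (t≤u i) (u≤u′ i)
              e′ : at u′ b ≡ at t₁ b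
              e′ = trans (⊑-antisym z (t≤u′ b)) b≡
              y′ = glue b u′ t₁ e′
              over : glue b u t₁ e ≤ᶠ y′
              over i with ≤-total i b
              ... | inj₁ l = subst₂ _⊑_ (sym (glue-left b u t₁ e l)) (sym (glue-left b u′ t₁ e′ l)) (u≤u′ i)
              ... | inj₂ l = ≡⇒⊑ (trans (glue-right b u t₁ e l) (sym (glue-right b u′ t₁ e′ l)))
            -- The reply has outgrown the cut, so the entry is deleted from a later block instead,
            -- within the reach of the induction. Between cut and block the shortened sequence still
            -- has the type of `t` at `b`.
            cases u′ wu′ u≤u′ wt (no n) with pigeon m g u′ b (smaller o (⊑-trans (t≤u b) (u≤u′ b)) n)
            ... | b′ , l₁ , l₂ , fb = return (reply₀ y′ (inj₁ (del wu′ lb fb fs)) over (subst (Wit δ) (sym (delete-left b′ u′ fs (≤-trans j≤b l₁))) wt))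
              where
              fs = short u′ b′ fb
              y′ = delete b′ u′ fs
              t≤u′ : t ≤ᶠ u′
              t≤u′ i = ⊑-trans (t≤u i) (u≤u′ i)
              lb : off (at u′ b′) ℕ.< m
              lb = smaller o (⊑-trans (mono t l₁) (t≤u′ b′)) (λ q → n (⊑-trans (mono u′ l₁) q))
              over : glue b u t₁ e ≤ᶠ y′
              over i with ≤-total i b | ≤-total i b′
              ... | inj₁ l | _ = subst₂ _⊑_ (sym (glue-left b u t₁ e l)) (sym (delete-left b′ u′ fs (≤-trans l l₁))) (u≤u′ i)
              ... | inj₂ l | inj₁ l′ = subst₂ _⊑_ (sym (glue-right b u t₁ e l)) (sym (delete-left b′ u′ fs l′))
                  (⊑-trans (mono t near) (⊑-trans blk (⊑-trans (t≤u′ b) (mono u′ l))))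
                where
                near : i + 1ℤ ≤ b + + κ
                near = ≤-trans (+-monoˡ-≤ 1ℤ (≤-trans l′ (≤-trans (i≤i+n b′ g) l₂)))
                  (≤-trans (≤-reflexive (step-out b (+ S))) (+-monoʳ-≤ b (ℤ.+≤+ (ℕ.s≤s (ℕₚ.m≤n+m S G₀)))))
              ... | inj₂ l | inj₂ l′ = subst₂ _⊑_ (sym (glue-right b u t₁ e l)) (sym (delete-right b′ u′ fs l′)) (t≤u′ (i + 1ℤ))

        next : Good (suc m) κ
        next = record { pos = ℕ.s≤s ℕ.z≤n ; del = delete-ok ; lft = lift-ok }

    goods : ∀ m → K (∃ (Good m))
    goods zero = return (1 , record { pos = ℕₚ.≤-refl ; del = λ { _ () } ; lft = λ { _ () } })
    goods (suc m) = goods m >>= λ { (g , good) → Step.verdicts m g good >>= λ { (G₀ , v) → return (_ , Step.Next.next m g good G₀ v) } }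

    module Conclude (M : ℕ) (off≤M : ∀ q → off q ℕ.≤ M) (Fires? : ∀ δ q → Dec (Fires δ q))
      (finD : ∀ {ℓ} {R : D → Set ℓ} → (∀ δ → K (R δ)) → K (∀ δ → R δ)) (finV : ∀ {L} → Finite (Vec Ty L)) where

      record Certificate (t₀ : Seq) : Set₁ where
        field
          Pt     : Set
          seq    : Pt → Seq
          start  : Pt
          starts : at (seq start) 0ℤ ≡ at t₀ 0ℤ
          answers : ∀ x δ k → Fires δ (at (seq x) k) →
            ∃ λ y → ∃ λ d → seq x ≤ᶠ shift d (seq y) × Wit δ (at (shift d (seq y)) k)

      module _ (g : ℕ) (good : Good (suc M) g) where
        open Good good
        open Step (suc M) g good using (S; trim)

        small : ∀ q → off q ℕ.< suc M
        small q = ℕ.s≤s (off≤M q)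

        -- Once `m` exceeds the number of all formulas every type qualifies: the right end is
        -- trimmed, and a block among the `S` entries before `j` is prolonged to -∞.
        confine : ∀ {u} j → 𝒲 u → ∃ λ y → 𝒲 y × u ≤ᶠ y × at y j ≡ at u j × LeftConst y (j - + S) × ConstAfter y (j + + S)
        confine {u} j w with settle u j S
        ... | k , c with trim k {u} {j} w (small _) c
        ... | u′ , w′ , o , a , c′ with pigeon (suc M) g u′ (j - + S) (small _)
        ... | b , l₁ , l₂ , f = y , lft w′ (small _) f fs , over
              , trans (glue-right b cst u′ refl b≤j) (a ≤-refl)
              , (λ l → ≡⇒⊑ (trans (glue-left b cst u′ refl l₁) (sym (glue-left b cst u′ refl (≤-trans l l₁)))))
              , (λ l → subst₂ _⊑_ (sym (glue-right b cst u′ refl (≤-trans b≤end l))) (sym (glue-right b cst u′ refl b≤end)) (c′ l))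
          where
          fs = short u′ b f
          cst = constant (at u′ b) (loop u′ fs)
          y = lift b u′ fs
          b≤j : b ≤ j
          b≤j = ≤-trans (i≤i+n b g) (≤-trans l₂ (≤-reflexive (cancel j (+ S))))
          b≤end : b ≤ j + + S
          b≤end = ≤-trans b≤j (i≤i+n j S)
          over : u ≤ᶠ y
          over i with ≤-total i b
          ... | inj₁ l = ⊑-trans (o i) (⊑-trans (mono u′ l) (≡⇒⊑ (sym (glue-left b cst u′ refl l))))
          ... | inj₂ l = ⊑-trans (o i) (≡⇒⊑ (sym (glue-right b cst u′ refl l)))

        Rep : Vec Ty (suc (S ℕ.+ S)) → Set
        Rep w = ∃ λ t → 𝒲 t × LeftConst t (- + S) × ConstAfter t (+ S) × tab (S ℕ.+ S) t (- + S) ≡ w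

        determined : ∀ {t u} → LeftConst t (- + S) → ConstAfter t (+ S) → LeftConst u (- + S) → ConstAfter u (+ S) →
          tab (S ℕ.+ S) t (- + S) ≡ tab (S ℕ.+ S) u (- + S) → ∀ i → at t i ≡ at u i
        determined {t} {u} lt ct lu cu e i with ≤-total i (- + S)
        ... | inj₁ l = trans (⊑-antisym (mono t l) (lt l)) (trans start (⊑-antisym (lu l) (mono u l)))
          where
          start : at t (- + S) ≡ at u (- + S)
          start = subst (λ x → at t x ≡ at u x) (+-identityʳ (- + S)) (tab-at (S ℕ.+ S) {t} {u} e 0 ℕ.z≤n)
        ... | inj₂ l with between l
        ... | r , refl with ℕₚ.≤-total r (S ℕ.+ S)
        ... | inj₁ h = tab-at (S ℕ.+ S) {t} {u} e r h
        ... | inj₂ h = trans (⊑-antisym (ct far) (mono t far)) (trans end (⊑-antisym (mono u far) (cu far)))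
          where
          end : at t (+ S) ≡ at u (+ S)
          end = subst (λ x → at t x ≡ at u x) (window-top (+ S)) (tab-at (S ℕ.+ S) {t} {u} e (S ℕ.+ S) ℕₚ.≤-refl)
          far : + S ≤ - + S + + r
          far = ≤-trans (≤-reflexive (sym (window-top (+ S)))) (+-monoʳ-≤ (- + S) (ℤ.+≤+ h))

        module _ (sel : Selection Rep) where

          Point : Set
          Point = Σ (Vec Ty (suc (S ℕ.+ S))) (T ∘ proj₁ sel)

          rep : (x : Point) → Rep (proj₁ x)
          rep x = proj₁ (proj₂ sel) (proj₂ x)

          sequence : Point → Seq
          sequence x = proj₁ (rep x)

          represent : ∀ {y} k → 𝒲 y → LeftConst y (k - + S) → ConstAfter y (k + + S) → K (∃ λ x → ∀ i → at (shift (- k) (sequence x)) i ≡ at y i)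
          represent {y} k w lc ca = proj₂ (proj₂ sel) {tab (S ℕ.+ S) z (- + S)} (z , W-shift k w , lz , cz , refl) >>= λ t →
            return ((_ , t) , λ i → trans (agree (_ , t) refl (i + - k)) (cong (at y) (shift-back i k)))
            where
            z = shift k y
            lz : LeftConst z (- + S)
            lz {i} l = subst (λ x → at y x ⊑ at y (i + k)) (sym (neg-diff k (+ S)))
              (lc (≤-trans (+-monoˡ-≤ k l) (≤-reflexive (neg-diff k (+ S)))))
            cz : ConstAfter z (+ S)
            cz {i} l = subst (λ x → at y (i + k) ⊑ at y x) (+-comm k (+ S))
              (ca (≤-trans (≤-reflexive (+-comm k (+ S))) (+-monoˡ-≤ k l)))
            agree : ∀ x → proj₁ x ≡ tab (S ℕ.+ S) z (- + S) → ∀ i → at (sequence x) i ≡ at z i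
            agree x e with rep x
            ... | t , _ , lt , ct , e′ = determined {t} {z} lt ct lz cz (trans e′ e)

          -- The last conjunct holds because confined answers are constant to the left of `k − S`.
          -- It keeps an answer above `x` when it is moved to later levels.
          Answer : Point → D → ℤ → Set
          Answer x δ k = Fires δ (at (sequence x) k) → ∃ λ y → ∃ λ d → sequence x ≤ᶠ shift d (sequence y) ×
            Wit δ (at (shift d (sequence y)) k) × (∀ i → at (sequence x) (k - + S) ⊑ at (shift d (sequence y)) i)

          answer₁ : ∀ x δ k → K (Answer x δ k)
          answer₁ x δ k = K-imp (Fires? δ _) λ fi → W-reply (proj₁ (proj₂ (rep x))) δ k fi >>= λ { (u , wu , o , wt) → finish u wu o wt (confine k wu) }
            where
            finish : ∀ u → 𝒲 u → sequence x ≤ᶠ u → Wit δ (at u k) →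
              (∃ λ y → 𝒲 y × u ≤ᶠ y × at y k ≡ at u k × LeftConst y (k - + S) × ConstAfter y (k + + S)) → K _
            finish u wu o wt (y , wy , u≤y , e , lc , ca) = represent {y} k wy lc ca >>= λ { (z , eq) → return
              ( z , - k , (λ i → ⊑-trans (o i) (⊑-trans (u≤y i) (≡⇒⊑ (sym (eq i)))))
              , subst (Wit δ) (sym (trans (eq k) e)) wt
              , λ i → ⊑-trans (⊑-trans (o _) (u≤y _)) (⊑-trans (low i) (≡⇒⊑ (sym (eq i))))) }
              where
              low : ∀ i → at y (k - + S) ⊑ at y i
              low i with ≤-total i (k - + S)
              ... | inj₁ l = lc l
              ... | inj₂ l = mono y l

          -- The table covers the levels -S to 2S. At 2S the answer lies everywhere above the entry
          -- of `x` at S, its largest, so it can be moved to any later level; demands before -S use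
          -- the answer at -S, moved to earlier levels.
          top : ℕ
          top = S ℕ.+ (S ℕ.+ S)

          module _ (table : ∀ (p : Point × D × Fin (suc top)) → Answer (proj₁ p) (proj₁ (proj₂ p)) (- + S + + toℕ (proj₂ (proj₂ p)))) where

            lookup : ∀ x δ r → r ℕ.≤ top → Answer x δ (- + S + + r)
            lookup x δ r l = subst (λ n → Answer x δ (- + S + + n)) (toℕ-fromℕ< (ℕ.s≤s l)) (table (x , δ , fromℕ< (ℕ.s≤s l)))

            all-answers : ∀ x δ k → Fires δ (at (sequence x) k) →
              ∃ λ y → ∃ λ d → sequence x ≤ᶠ shift d (sequence y) × Wit δ (at (shift d (sequence y)) k)
            all-answers x δ k fi with ≤-total k (- + S)
            ... | inj₁ l with lookup x δ 0 ℕ.z≤n (subst (Fires δ)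
                    (trans (⊑-antisym (mono (sequence x) l) (proj₁ (proj₂ (proj₂ (rep x))) l)) (cong (at (sequence x)) (sym (+-identityʳ (- + S))))) fi)
            ... | y , d , o , wt , _ = y , d + (- + S - k) ,
                  (λ i → ⊑-trans (o i) (mono (sequence y) (≤-trans (≤-reflexive (sym (+-identityʳ _))) (≤-trans (+-monoʳ-≤ (i + d) (i≤j⇒0≤j-i l)) (≤-reflexive (sym (regroup i d _)))))))
                , subst (λ z → Wit δ (at (sequence y) z)) (trans (cong (_+ d) (+-identityʳ (- + S))) (sym (early (+ S) k d))) wt
            all-answers x δ k fi | inj₂ l with between l
            ... | r , refl with ℕₚ.≤-total r top
            ... | inj₁ h = let (y , d , o , wt , _) = lookup x δ r h fi in y , d , o , wt
            ... | inj₂ h with lookup x δ top ℕₚ.≤-refl (subst (Fires δ) (⊑-antisym (⊑-trans (cax far) (mono (sequence x) S≤e)) (mono (sequence x) e≤k)) fi)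
              where
              cax : ConstAfter (sequence x) (+ S)
              cax = proj₁ (proj₂ (proj₂ (proj₂ (rep x))))
              e≤k : - + S + + top ≤ - + S + + r
              e≤k = +-monoʳ-≤ (- + S) (ℤ.+≤+ h)
              S≤e : + S ≤ - + S + + top
              S≤e = ≤-trans (≤-reflexive (sym (window-top (+ S)))) (+-monoʳ-≤ (- + S) (ℤ.+≤+ (ℕₚ.m≤n+m (S ℕ.+ S) S)))
              far : + S ≤ - + S + + r
              far = ≤-trans S≤e e≤k
            ... | y , d , o , wt , low = y , d - (k′ - e) ,
                (λ i → ⊑-trans (x≤S i) (⊑-trans (low (i - (k′ - e))) (≡⇒⊑ (cong (at (sequence y)) (sym (later-shift i d k′ e))))))
                , subst (λ z → Wit δ (at (sequence y) z)) (sym (late k′ d e)) wt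
              where
              e = - + S + + top
              k′ = - + S + + r
              cax : ConstAfter (sequence x) (+ S)
              cax = proj₁ (proj₂ (proj₂ (proj₂ (rep x))))
              x≤S : ∀ i → at (sequence x) i ⊑ at (sequence x) (e - + S)
              x≤S i with ≤-total i (+ S)
              ... | inj₁ l′ = ⊑-trans (mono (sequence x) l′) (≡⇒⊑ (cong (at (sequence x)) (sym (level (+ S)))))
              ... | inj₂ l′ = ⊑-trans (cax l′) (≡⇒⊑ (cong (at (sequence x)) (sym (level (+ S)))))

        certificate : ∀ {t₀} → 𝒲 t₀ → K (Certificate t₀)
        certificate {t₀} w₀ = select Rep finV >>= λ sel →
          finite-Σ (finite-T (proj₁ sel) finV) (λ _ → finite-Σ finD (λ _ → finite-Fin)) (λ { (x , δ , r) → answer₁ sel x δ (- + S + + toℕ r) }) >>= λ table →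
          begin′ sel table (confine 0ℤ w₀)
          where
          begin′ : ∀ sel → _ → _ → K (Certificate t₀)
          begin′ sel table (y , wy , _ , e , lc , ca) = represent sel {y} 0ℤ wy lc ca >>= λ { (x , eq) → return record
            { Pt = Point sel ; seq = sequence sel ; start = x ; starts = trans (eq 0ℤ) e ; answers = all-answers sel table } }

      certify : ∀ {t₀} → 𝒲 t₀ → K (Certificate t₀)
      certify w = goods (suc M) >>= λ { (g , good) → certificate g good w }

-- Integer powers of ∇ in the presence of H.

iter : (Formula → Formula) → ℕ → Formula → Formula
iter f zero A = A
iter f (suc k) A = f (iter f k A)

module Levels (𝓡 : SchemeSet) (h : H ∈R 𝓡) where
  open Calculus 𝓡
  open Automorphism h

  infix 3 _≈_
  _≈_ : Formula → Formula → Set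
  A ≈ B = (𝓡 ⊢ A ∷ [] ⇒ B) × (𝓡 ⊢ B ∷ [] ⇒ A)

  ≈-refl : ∀ {A} → A ≈ A
  ≈-refl = ax , ax

  ≈-sym : ∀ {A B} → A ≈ B → B ≈ A
  ≈-sym (p , q) = q , p

  ≈-trans : ∀ {A B C} → A ≈ B → B ≈ C → A ≈ C
  ≈-trans (p , q) (r , s) = (p ⨟ r) , (s ⨟ q)

  ∇-cong : ∀ {A B} → A ≈ B → ∇ A ≈ ∇ B
  ∇-cong (p , q) = ∇rule p , ∇rule q

  □-cong : ∀ {A B} → A ≈ B → □ A ≈ □ B
  □-cong (p , q) = □-mono p , □-mono q

  sh : ℤ → Formula → Formula
  sh (+ k) = iter ∇ k
  sh -[1+ k ] = iter □ (suc k)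

  sh-≡ : ∀ {i j A} → i ≡ j → sh i A ≈ sh j A
  sh-≡ refl = ≈-refl

  sh-suc : ∀ j {A} → sh (sucℤ j) A ≈ ∇ (sh j A)
  sh-suc (+ k) = ≈-refl
  sh-suc -[1+ zero ] = ∇□-intro , ∇□-elim
  sh-suc -[1+ suc k ] = ∇□-intro , ∇□-elim

  sh-pred : ∀ j {A} → sh (predℤ j) A ≈ □ (sh j A)
  sh-pred (+ zero) = ≈-refl
  sh-pred (+ suc k) = □∇-intro , □∇-elim
  sh-pred -[1+ k ] = ≈-refl

  sh-cong : ∀ i {A B} → A ≈ B → sh i A ≈ sh i B
  sh-cong (+ zero) e = e
  sh-cong (+ suc k) e = ∇-cong (sh-cong (+ k) e)
  sh-cong -[1+ zero ] e = □-cong e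
  sh-cong -[1+ suc k ] e = □-cong (sh-cong -[1+ k ] e)

  sh-+ : ∀ i j {A} → sh i (sh j A) ≈ sh (i + j) A
  sh-+ (+ zero) j = sh-≡ (sym (+-identityˡ j))
  sh-+ (+ suc k) j = ≈-trans (∇-cong (sh-+ (+ k) j)) (≈-trans (≈-sym (sh-suc (+ k + j))) (sh-≡ (sym (+-assoc 1ℤ (+ k) j))))
  sh-+ -[1+ zero ] j = ≈-sym (sh-pred j)
  sh-+ -[1+ suc k ] j = ≈-trans (□-cong (sh-+ -[1+ k ] j)) (≈-trans (≈-sym (sh-pred (-[1+ k ] + j))) (sh-≡ (sym (+-assoc -1ℤ -[1+ k ] j))))

  sh-nec : ∀ i {Γ A} → 𝓡 ⊢ Γ ⇒ A → 𝓡 ⊢ map (sh i) Γ ⇒ sh i A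
  sh-nec (+ zero) {Γ} d = weaken (λ m → ∈-map⁺ (sh (+ zero)) m) d
  sh-nec (+ suc k) {Γ} d = weaken sub (nec (sh-nec (+ k) d))
    where
    sub : ∇* (map (sh (+ k)) Γ) ⊑ map (sh (+ suc k)) Γ
    sub m with ∈-map⁻ ∇ m
    ... | _ , m′ , refl with ∈-map⁻ (sh (+ k)) m′
    ... | _ , m″ , refl = ∈-map⁺ (sh (+ suc k)) m″
  sh-nec -[1+ zero ] d = □-nec d
  sh-nec -[1+ suc k ] {Γ} d = weaken sub (□-nec (sh-nec -[1+ k ] d))
    where
    sub : map □ (map (sh -[1+ k ]) Γ) ⊑ map (sh -[1+ suc k ]) Γ
    sub m with ∈-map⁻ □ m
    ... | _ , m′ , refl with ∈-map⁻ (sh -[1+ k ]) m′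
    ... | _ , m″ , refl = ∈-map⁺ (sh -[1+ suc k ]) m″

  sh-∨ : ∀ i {A B} → 𝓡 ⊢ sh i (A ∨ B) ∷ [] ⇒ sh i A ∨ sh i B
  sh-∨ (+ zero) = ax
  sh-∨ (+ suc k) = ∇rule (sh-∨ (+ k)) ⨟ ∇-∨
  sh-∨ -[1+ zero ] = □-∨
  sh-∨ -[1+ suc k ] = □-mono (sh-∨ -[1+ k ]) ⨟ □-∨

  sh-⊥ : ∀ i → 𝓡 ⊢ sh i ⊥′ ∷ [] ⇒ ⊥′
  sh-⊥ (+ zero) = ax
  sh-⊥ (+ suc k) = ∇rule (sh-⊥ (+ k)) ⨟ ∇-⊥
  sh-⊥ -[1+ zero ] = □-⊥
  sh-⊥ -[1+ suc k ] = □-mono (sh-⊥ -[1+ k ]) ⨟ □-⊥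

  sh-⇒ : ∀ i {A B} → 𝓡 ⊢ ∇ (sh i A ⊸ sh i B) ∷ [] ⇒ sh i (∇ (A ⊸ B))
  sh-⇒ (+ zero) = ax
  sh-⇒ (+ suc k) = ∇rule (∇⊸ ⨟ sh-⇒ (+ k))
  sh-⇒ -[1+ zero ] = □⊸
  sh-⇒ -[1+ suc k ] = □⊸ ⨟ □-mono (sh-⇒ -[1+ k ])

  -- With F a point grows along the operator of the model, with P against it; levels are numbered so that points grow.
  σ : Drift → ℤ
  σ up = 1ℤ
  σ down = -1ℤ

  orient : Drift → ℤ → ℤ
  orient up j = j
  orient down j = - j

  lev : Drift → ℤ → Formula → Formula
  lev d j = sh (orient d j)

  orient-+ : ∀ d i j → orient d i + orient d j ≡ orient d (i + j)
  orient-+ up i j = refl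
  orient-+ down i j = sym (neg-distrib-+ i j)

  orient-σ : ∀ d → orient d (σ d) ≡ 1ℤ
  orient-σ up = refl
  orient-σ down = refl

  lev-0 : ∀ d {A} → lev d 0ℤ A ≡ A
  lev-0 up = refl
  lev-0 down = refl

  lev-+ : ∀ d i j {A} → lev d i (lev d j A) ≈ lev d (i + j) A
  lev-+ d i j = ≈-trans (sh-+ (orient d i) (orient d j)) (sh-≡ (orient-+ d i j))

  lev-∇ : ∀ d j {A} → lev d j (∇ A) ≈ lev d (j + σ d) A
  lev-∇ d j {A} = ≈-trans (sh-cong (orient d j) (sh-≡ {j = orient d (σ d)} {A = A} (sym (orient-σ d)))) (lev-+ d j (σ d))

  Grows : Drift → Set
  Grows up = F ∈R 𝓡
  Grows down = P ∈R 𝓡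

  lev-mono : ∀ d → Grows d → ∀ j {A} → 𝓡 ⊢ lev d j A ∷ [] ⇒ lev d (sucℤ j) A
  lev-mono up f j = schF f ax ⨟ proj₂ (sh-suc j)
  lev-mono down p j = proj₁ (≈-trans (sh-≡ {i = - j} (trans (sym (+-identityˡ (- j))) (+-assoc 1ℤ -1ℤ (- j)))) (sh-suc (-1ℤ + - j))) ⨟ schP p ax
    ⨟ proj₁ (sh-≡ (sym (neg-distrib-+ 1ℤ j)))

  module _ (Ans : Set) where
    open Canonical 𝓡 Ans

    translate : Drift → ℤ → World → World
    translate d j X .mem C = mem X (lev d j C)
    translate d j X .closed ps e = closed X (Allₚ.map⁺ ps) (sh-nec (orient d j) e)
    translate d j X .prime c = prime X (entails X c (sh-∨ (orient d j)))
    translate d j X .proper c = proper X (entails X c (sh-⊥ (orient d j)))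
    translate d j X .stable k = stable X k

    -- As `∇ (A ⊸ B)` is intuitionistic implication, its failure at any level is witnessed by an
    -- extension of `X` itself, hence by an enlargement of all its levels at once.
    refute-⇒ : (X : World) → ∀ d j {A B} → (mem X (lev d j (∇ (A ⊸ B))) → Ans) →
      Σ World λ Y → (∀ {C} → mem X C → mem Y C) × mem Y (lev d j A) × (mem Y (lev d j B) → Ans)
    refute-⇒ X d j {A} {B} k = world , (λ x → world-⊇ (inj₂ x)) , world-⊇ (inj₁ refl) , world-avoids
      where
      a = lev d j A
      T₀ : Theory
      T₀ C = C ≡ a ⊎ mem X C
      gather : ∀ {Γ} → All T₀ Γ → ∃ λ Δ → All (mem X) Δ × Γ ⊑ a ∷ Δ
      gather [] = [] , [] , λ ()
      gather (inj₁ refl ∷ ps) with gather ps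
      ... | Δ , xs , sub = Δ , xs , λ { (here refl) → here refl ; (there m) → sub m }
      gather (inj₂ x ∷ ps) with gather ps
      ... | Δ , xs , sub = _ ∷ Δ , x ∷ xs , λ { (here refl) → there (here refl) ; (there m) → keep (sub m) }
        where
        keep : ∀ {C E Ξ} → C ∈ a ∷ Ξ → C ∈ a ∷ E ∷ Ξ
        keep (here e) = here e
        keep (there m) = there (there m)
      avoids : ∀ {Γ} → All T₀ Γ → 𝓡 ⊢ Γ ⇒ lev d j B → Ans
      avoids ps e = let (Δ , xs , sub) = gather ps in k (closed X xs (⇒-intro (weaken sub e) ⨟ sh-⇒ (orient d j)))
      open Avoid T₀ (lev d j B) avoids

-- Comparing types; thresholds of monotone membership.

infix 4 _⊴_
_⊴_ : ∀ {Ψ : List Formula} → All (λ _ → Bool) Ψ → All (λ _ → Bool) Ψ → Set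
q ⊴ r = ∀ {E} (m : E ∈ _) → T (All.lookup q m) → T (All.lookup r m)

⊴-antisym : ∀ {Ψ} (q r : All (λ _ → Bool) Ψ) → q ⊴ r → r ⊴ q → q ≡ r
⊴-antisym [] [] f g = refl
⊴-antisym (b ∷ q) (c ∷ r) f g = cong₂ _∷_ (same-bit b c (f (here refl)) (g (here refl))) (⊴-antisym q r (f ∘ there) (g ∘ there))
  where
  same-bit : ∀ b c → (T b → T c) → (T c → T b) → b ≡ c
  same-bit true true _ _ = refl
  same-bit false false _ _ = refl
  same-bit true false f _ = ⊥-elim (f tt)
  same-bit false true _ g = ⊥-elim (g tt)

_⊴?_ : ∀ {Ψ} (q r : All (λ _ → Bool) Ψ) → Dec (q ⊴ r)
[] ⊴? [] = yes λ ()
(b ∷ q) ⊴? (c ∷ r) with q ⊴? r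
... | no n = no (λ f → n (f ∘ there))
((false ∷ q) ⊴? (c ∷ r)) | yes f = yes λ { (here refl) () ; (there m) → f m }
((true ∷ q) ⊴? (true ∷ r)) | yes f = yes λ { (here refl) → id ; (there m) → f m }
((true ∷ q) ⊴? (false ∷ r)) | yes f = no (λ g → g (here refl) tt)

missing : ∀ {Ψ : List Formula} → All (λ _ → Bool) Ψ → ℕ
missing [] = 0
missing (true ∷ q) = missing q
missing (false ∷ q) = suc (missing q)

missing-mono : ∀ {Ψ} (q r : All (λ _ → Bool) Ψ) → q ⊴ r → missing r ℕ.≤ missing q
missing-mono [] [] f = ℕ.z≤n
missing-mono (true ∷ q) (true ∷ r) f = missing-mono q r (f ∘ there)
missing-mono (true ∷ q) (false ∷ r) f = ⊥-elim (f (here refl) tt)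
missing-mono (false ∷ q) (true ∷ r) f = ℕₚ.m≤n⇒m≤1+n (missing-mono q r (f ∘ there))
missing-mono (false ∷ q) (false ∷ r) f = ℕ.s≤s (missing-mono q r (f ∘ there))

missing-strict : ∀ {Ψ} (q r : All (λ _ → Bool) Ψ) → q ⊴ r → ¬ (r ⊴ q) → missing r ℕ.< missing q
missing-strict [] [] f n = ⊥-elim (n f)
missing-strict (true ∷ q) (true ∷ r) f n = missing-strict q r (f ∘ there) (λ g → n λ { (here refl) → id ; (there m) → g m })
missing-strict (true ∷ q) (false ∷ r) f n = ⊥-elim (f (here refl) tt)
missing-strict (false ∷ q) (true ∷ r) f n = ℕ.s≤s (missing-mono q r (f ∘ there))
missing-strict (false ∷ q) (false ∷ r) f n = ℕ.s≤s (missing-strict q r (f ∘ there) (λ g → n λ { (here refl) () ; (there m) → g m }))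

missing-bound : ∀ {Ψ} (q : All (λ _ → Bool) Ψ) → missing q ℕ.≤ length Ψ
missing-bound [] = ℕ.z≤n
missing-bound (true ∷ q) = ℕₚ.m≤n⇒m≤1+n (missing-bound q)
missing-bound (false ∷ q) = ℕ.s≤s (missing-bound q)

-- Under F or P membership of a formula is monotone in the level, so classically it begins at some
-- level, always holds, or never does; finitely many thresholds describe an orbit.
data Threshold : Set where
  never always : Threshold
  from : ℤ → Threshold

reached : Threshold → ℤ → Bool
reached never j = false
reached always j = true
reached (from z) j = ⌊ z ≤? j ⌋

reached-mono : ∀ θ {i j} → i ≤ j → T (reached θ i) → T (reached θ j)
reached-mono always l t = tt
reached-mono (from z) {i} {j} l t = fromWitness (≤-trans (toWitness t) l)

lowest highest : ∀ {Ψ : List Formula} → All (λ _ → Threshold) Ψ → ℤ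
lowest [] = 0ℤ
lowest (from z ∷ θs) = predℤ z ⊓ lowest θs
lowest (_ ∷ θs) = lowest θs
highest [] = 0ℤ
highest (from z ∷ θs) = z ⊔ highest θs
highest (_ ∷ θs) = highest θs

lowest-spec : ∀ {Ψ E} (θs : All (λ _ → Threshold) Ψ) (m : E ∈ Ψ) {i j} → i ≤ lowest θs → T (reached (All.lookup θs m) i) → T (reached (All.lookup θs m) j)
lowest-spec (never ∷ θs) (here refl) l t = t
lowest-spec (always ∷ θs) (here refl) l t = t
lowest-spec (from z ∷ θs) (here refl) l t = ⊥-elim (<⇒≱ (i≤pred[j]⇒i<j (≤-trans l (i⊓j≤i (predℤ z) _))) (toWitness t))
lowest-spec (never ∷ θs) (there m) l t = lowest-spec θs m l t
lowest-spec (always ∷ θs) (there m) l t = lowest-spec θs m l t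
lowest-spec (from z ∷ θs) (there m) l t = lowest-spec θs m (≤-trans l (i⊓j≤j (predℤ z) _)) t

highest-spec : ∀ {Ψ E} (θs : All (λ _ → Threshold) Ψ) (m : E ∈ Ψ) {i j} → highest θs ≤ i → T (reached (All.lookup θs m) j) → T (reached (All.lookup θs m) i)
highest-spec (never ∷ θs) (here refl) l ()
highest-spec (always ∷ θs) (here refl) l t = tt
highest-spec (from z ∷ θs) (here refl) l t = fromWitness (≤-trans (i≤i⊔j z _) l)
highest-spec (never ∷ θs) (there m) l t = highest-spec θs m l t
highest-spec (always ∷ θs) (there m) l t = highest-spec θs m l t
highest-spec (from z ∷ θs) (there m) l t = highest-spec θs m (≤-trans (i≤j⊔i z _) l) t

snapshot : ∀ {Ψ : List Formula} → All (λ _ → Threshold) Ψ → ℤ → All (λ _ → Bool) Ψ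
snapshot [] j = []
snapshot (θ ∷ θs) j = reached θ j ∷ snapshot θs j

lookup-snapshot : ∀ {Ψ E} (θs : All (λ _ → Threshold) Ψ) j (m : E ∈ Ψ) → All.lookup (snapshot θs j) m ≡ reached (All.lookup θs m) j
lookup-snapshot (_ ∷ θs) j (here refl) = refl
lookup-snapshot (_ ∷ θs) j (there m) = lookup-snapshot θs j m

module Search (Ans : Set) where
  open Classical Ans
  open Bounds Ans

  bounded-All : ∀ {Ψ : List Formula} → Bounded (All (λ _ → Bool) Ψ)
  bounded-All {[]} mn f = f [] >>= λ { (k , p) → return (k , λ { [] → p }) }
  bounded-All {_ ∷ Ψ} {R = R} mn f =
    bounded-Bool {R = λ x k → ∀ xs → R (x ∷ xs) k} (λ l g xs → mn l (g xs)) (λ x → bounded-All mn (λ xs → f (x ∷ xs))) >>= λ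
      { (k , g) → return (k , λ { (x ∷ xs) → g x xs }) }

  -- The statement does not vary beyond either end, so finitely many levels represent all of ℤ.
  K-ℤ : ∀ {R : ℤ → Set} b c → (∀ {i j} → i ≤ b → j ≤ b → R i → R j) → (∀ {i j} → c ≤ i → c ≤ j → R i → R j) → (∀ j → K (R j)) → K (∀ j → R j)
  K-ℤ {R} b c low high f with between (i≤j⊔i c b)
  ... | n , e = finite-Fin {suc n} {P = λ r → R (b + + toℕ r)} (λ r → f _) >>= λ g → return (everywhere g)
    where
    module _ (g : ∀ (r : Fin (suc n)) → R (b + + toℕ r)) where
      at-most : ∀ r → r ℕ.≤ n → R (b + + r)
      at-most r l = subst (λ x → R (b + + x)) (toℕ-fromℕ< (ℕ.s≤s l)) (g (fromℕ< (ℕ.s≤s l)))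
      everywhere : ∀ j → R j
      everywhere j with ≤-total j b
      ... | inj₁ l = low (≤-reflexive (+-identityʳ b)) l (at-most 0 ℕ.z≤n)
      ... | inj₂ l with between l
      ... | r , refl with ℕₚ.≤-total r n
      ... | inj₁ h = at-most r h
      ... | inj₂ h = high top (≤-trans top (+-monoʳ-≤ b (ℤ.+≤+ h))) (at-most n ℕₚ.≤-refl)
        where
        top : c ≤ b + + n
        top = ≤-trans (i≤i⊔j c b) (≤-reflexive e)

  module _ (M : ℤ → Set) (step : ∀ j → M j → M (sucℤ j)) (stab : ∀ j → K (M j) → M j) where

    steps : ∀ {i} n → M i → M (i + + n)
    steps {i} zero p = subst M (sym (+-identityʳ i)) p
    steps {i} (suc n) p = subst M (trans (sym (+-assoc 1ℤ i (+ n))) (trans (cong (_+ + n) (+-comm 1ℤ i)) (+-assoc i 1ℤ (+ n)))) (step _ (steps n p))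

    mono-≤ : ∀ {i j} → i ≤ j → M i → M j
    mono-≤ l p with between l
    ... | n , refl = steps n p

    boundary : ∀ n {i} → (M i → Ans) → M (i + + n) → K (∃ λ z → (M z → Ans) × M (sucℤ z))
    boundary zero {i} k p _ = k (subst M (+-identityʳ i) p)
    boundary (suc n) {i} k p = em (M (sucℤ i)) >>= λ
      { (inj₁ q) → return (i , k , q)
      ; (inj₂ k′) → boundary n {sucℤ i} k′ (subst M (trans (sym (+-assoc i 1ℤ (+ n))) (cong (_+ + n) (+-comm i 1ℤ))) p) }

    threshold : K (∃ λ θ → ∀ j → (T (reached θ j) → M j) × (¬ T (reached θ j) → M j → Ans))
    threshold = em (∃ M) >>= λ
      { (inj₂ k) → return (never , λ j → (λ ()) , λ _ p → k (j , p))
      ; (inj₁ (j₁ , p₁)) → em (∃ λ j → M j → Ans) >>= λ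
        { (inj₂ k) → return (always , λ j → (λ _ → stab j (λ n → k (j , n))) , λ n → ⊥-elim (n tt))
        ; (inj₁ (j₀ , n₀)) → search j₁ p₁ j₀ n₀ (≤-total j₁ j₀) } }
      where
      search : ∀ j₁ → M j₁ → ∀ j₀ → (M j₀ → Ans) → j₁ ≤ j₀ ⊎ j₀ ≤ j₁ → K _
      search j₁ p₁ j₀ n₀ (inj₁ l) _ = n₀ (mono-≤ l p₁)
      search j₁ p₁ j₀ n₀ (inj₂ l) with between l
      ... | n , refl = boundary n n₀ p₁ >>= λ { (z , nz , pz) → return (from (sucℤ z) ,
            λ j → (λ t → mono-≤ (toWitness t) pz) , λ nt p → nz (mono-≤ (below z j nt) p)) }
        where
        below : ∀ z j → ¬ T (reached (from (sucℤ z)) j) → j ≤ z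
        below z j nt with ≤-total j z
        ... | inj₁ l′ = l′
        ... | inj₂ l′ with j ≤? z
        ... | yes q = q
        ... | no q = ⊥-elim (nt (fromWitness (i<j⇒suc[i]≤j (≰⇒> q))))

-- Consistent sequences for H with one of F and P.

module Growing (𝓡 : SchemeSet) (h : H ∈R 𝓡) (Ans : Set) (Φ : List Formula) (cl : Closed Φ) (d : Drift)
  (grows : Levels.Grows 𝓡 h d) (noP : P ∈R 𝓡 → d ≡ down) (noF : F ∈R 𝓡 → d ≡ up) where

  open Calculus 𝓡
  open Automorphism h
  open Levels 𝓡 h
  open Classical Ans
  open Bounds Ans
  open Search Ans
  open Canonical 𝓡 Ans
  open States 𝓡 Ans Φ cl

  ⊆ᵗ-antisym : ∀ {q r} → q ⊆ᵗ r → r ⊆ᵗ q → q ≡ r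
  ⊆ᵗ-antisym {q} {r} (incl f) (incl g) = ⊴-antisym q r (λ m o → On.isOn (f m (bit o))) (λ m o → On.isOn (g m (bit o)))

  _⊆ᵗ?_ : ∀ q r → Dec (q ⊆ᵗ r)
  q ⊆ᵗ? r = map′ (λ f → incl (λ { m (bit o) → bit (f m o) })) (λ { (incl f) m o → On.isOn (f m (bit o)) }) (q ⊴? r)

  missing-⊆ᵗ : ∀ {q r} → q ⊆ᵗ r → ¬ (r ⊆ᵗ q) → missing r ℕ.< missing q
  missing-⊆ᵗ {q} {r} (incl f) n = missing-strict q r (λ m o → On.isOn (f m (bit o))) (λ g → n (incl λ { m (bit o) → bit (g m o) }))

  Adjacent : Drift → State → State → Set
  Adjacent up q r = Pred q r
  Adjacent down q r = Pred r q

  D : Set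
  D = Σ Formula (_∈ Φ)

  -- A demand is a failure of the intuitionistic implication `∇ (A ⊸ B)` at a level; it is
  -- witnessed, at the same level of a larger sequence, by `A` without `B`.
  Fires Wit : D → State → Set
  Fires (A ⊸ B , m) q = ¬ On q (sub∇⊸ m)
  Fires _ q = ⊥
  Wit (A ⊸ B , m) q = On q (sub₁⊸ m) × ¬ On q (sub₂⊸ m)
  Wit _ q = ⊤

  Fires? : ∀ δ q → Dec (Fires δ q)
  Fires? (atom _ , m) q = no λ ()
  Fires? (⊤′ , m) q = no λ ()
  Fires? (⊥′ , m) q = no λ ()
  Fires? (𝟏 , m) q = no λ ()
  Fires? (_ ∧ _ , m) q = no λ ()
  Fires? (_ ∨ _ , m) q = no λ ()
  Fires? (_ ⊗ _ , m) q = no λ ()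
  Fires? (∇ _ , m) q = no λ ()
  Fires? (A ⊸ B , m) q with On? q (sub∇⊸ m)
  ... | yes o = no (λ n → n o)
  ... | no n = yes n

  open Barrier Ans State _⊆ᵗ_ ⊆ᵗ-refl ⊆ᵗ-trans ⊆ᵗ-antisym _⊆ᵗ?_
    missing missing-⊆ᵗ (λ q r → Laws q × Adjacent d q r) D Fires Wit public

  laws-at : ∀ t k → Laws (at t k)
  laws-at t k = proj₁ (loc t k)

  pred-at : ∀ t k → Pred (at t k) (at t (k + σ d))
  pred-at t k = go d (λ j → proj₂ (loc t j))
    where
    go : ∀ c → (∀ j → Adjacent c (at t j) (at t (sucℤ j))) → Pred (at t k) (at t (k + σ c))
    go up f = subst (λ x → Pred (at t k) (at t x)) (+-comm 1ℤ k) (f k)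
    go down f = subst (λ x → Pred (at t x) (at t (k + -1ℤ))) (solve 1 (λ k → con 1ℤ :+ (k :+ con -1ℤ) := k) refl k) (f (k + -1ℤ))
      where open +-*-Solver

  RealSeq : World → Seq → Set
  RealSeq X t = ∀ j → Real (mem (translate Ans d j X)) (at t j)

  extract : ∀ X → K (∃ (RealSeq X))
  extract X = K-thresholds Φ (λ m → m) >>= λ { (θs , spec) → build θs spec }
    where
    level-threshold : ∀ E → K (∃ λ θ → ∀ j → (T (reached θ j) → mem X (lev d j E)) × (¬ T (reached θ j) → mem X (lev d j E) → Ans))
    level-threshold E = threshold (λ j → mem X (lev d j E)) (λ j x → entails X x (lev-mono d grows j)) (λ j → stable X)
    K-thresholds : ∀ Ψ → (∀ {E} → E ∈ Ψ → E ∈ Φ) → K (Σ (All (λ _ → Threshold) Ψ) λ θs → ∀ {E} (m : E ∈ Ψ) j →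
      (T (reached (All.lookup θs m) j) → mem X (lev d j E)) × (¬ T (reached (All.lookup θs m) j) → mem X (lev d j E) → Ans))
    K-thresholds [] _ = return ([] , λ ())
    K-thresholds (E ∷ Ψ) i = level-threshold E >>= λ { (θ , s) → K-thresholds Ψ (i ∘ there) >>= λ { (θs , ss) →
      return (θ ∷ θs , λ { (here refl) → s ; (there m) → ss m }) } }
    module _ (θs : All (λ _ → Threshold) Φ) (spec : ∀ {E} (m : E ∈ Φ) j →
      (T (reached (All.lookup θs m) j) → mem X (lev d j E)) × (¬ T (reached (All.lookup θs m) j) → mem X (lev d j E) → Ans)) where
      f = snapshot θs
      lift⊆ : ∀ {i j} → (∀ {E} (m : E ∈ Φ) → T (reached (All.lookup θs m) i) → T (reached (All.lookup θs m) j)) → f i ⊆ᵗ f j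
      lift⊆ {i} {j} g = incl λ { m (bit o) → bit (subst T (sym (lookup-snapshot θs j m)) (g m (subst T (lookup-snapshot θs i m) o))) }
      real : ∀ j → Real (mem (translate Ans d j X)) (f j)
      real j = record { holds = λ { m (bit o) → proj₁ (spec m j) (subst T (lookup-snapshot θs j m) o) }
                      ; off = λ m n → proj₂ (spec m j) (λ o → n (bit (subst T (sym (lookup-snapshot θs j m)) o))) }
      const-low : ∀ {i j} → i ≤ lowest θs → j ≤ lowest θs → f i ≡ f j
      const-low l l′ = ⊆ᵗ-antisym (lift⊆ (λ m → lowest-spec θs m l)) (lift⊆ (λ m → lowest-spec θs m l′))
      const-high : ∀ {i j} → highest θs ≤ i → highest θs ≤ j → f i ≡ f j
      const-high l l′ = ⊆ᵗ-antisym (lift⊆ (λ m → highest-spec θs m l′)) (lift⊆ (λ m → highest-spec θs m l))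
      adjacent : ∀ c → d ≡ c → ∀ j → K (Adjacent c (f j) (f (sucℤ j)))
      adjacent up refl j = K-Pred (real j) (real (sucℤ j))
        (λ {A} x → entails X x (proj₁ (≈-trans (lev-∇ up j) (sh-≡ (+-comm j 1ℤ)))))
        (λ {A} x → entails X x (proj₂ (≈-trans (lev-∇ up j) (sh-≡ (+-comm j 1ℤ)))))
      adjacent down refl j = K-Pred (real (sucℤ j)) (real j)
        (λ {A} x → entails X x (proj₁ (≈-trans (lev-∇ down (sucℤ j)) (sh-≡ (cong -_ e)))))
        (λ {A} x → entails X x (proj₂ (≈-trans (lev-∇ down (sucℤ j)) (sh-≡ (cong -_ e)))))
        where
        open +-*-Solver
        e : sucℤ j + -1ℤ ≡ j
        e = solve 1 (λ j → (con 1ℤ :+ j) :+ con -1ℤ := j) refl j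
      build : K (∃ (RealSeq X))
      -- Adjacency at `j` also looks at `j + 1`, so its left end lies one level before that of the
      -- types.
      build = K-ℤ {R = λ j → Laws (f j) × Adjacent d (f j) (f (sucℤ j))} (predℤ (lowest θs)) (highest θs)
          (λ {i} {j} l l′ → subst₂ (λ q r → Laws q × Adjacent d q r) (const-low (low l) (low l′)) (const-low (low′ l) (low′ l′)))
          (λ {i} {j} l l′ → subst₂ (λ q r → Laws q × Adjacent d q r) (const-high l l′)
            (const-high (≤-trans l (i≤suc[i] i)) (≤-trans l′ (i≤suc[i] j))))
          (λ j → K-× (K-laws (translate Ans d j X) (real j)) (adjacent d refl j)) >>= λ adj → return (record
            { at = f ; mono = λ l → lift⊆ (λ m → reached-mono (All.lookup θs m) l) ; loc = adj ; lo = lowest θs ; hi = highest θs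
            ; below = λ l → lift⊆ (λ m → lowest-spec θs m ≤-refl) ; above = λ l → lift⊆ (λ m → highest-spec θs m ≤-refl) } , real)
        where
        low : ∀ {i} → i ≤ predℤ (lowest θs) → i ≤ lowest θs
        low l = ≤-trans l (i≤j⇒pred[i]≤j ≤-refl)
        low′ : ∀ {i} → i ≤ predℤ (lowest θs) → sucℤ i ≤ lowest θs
        low′ l = ≤-trans (suc-mono l) (≤-reflexive (suc-pred (lowest θs)))

  Pos : Seq → Theory
  Pos t C = ∃ λ j → ∃ λ E → Σ (E ∈ Φ) λ m → On (at t j) m × C ≡ lev d j E

  data Neg (t : Seq) : Theory where
    neg : ∀ j {E} (m : E ∈ Φ) → ¬ On (at t j) m → Neg t (lev d j E)
    bot : Neg t ⊥′
    or  : ∀ {B C} → Neg t B → Neg t C → Neg t (B ∨ C)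

  -- A small substitute for realisability of all levels by one canonical world; `realizer` and
  -- `consistent` give the equivalence.
  Cons : Seq → Set
  Cons t = ∀ Γ B → All (Pos t) Γ → Neg t B → 𝓡 ⊢ Γ ⇒ B → Ans

  realizer : ∀ {t} → Cons t → Σ World λ X → RealSeq X t
  realizer {t} c = world , λ j → record
    { holds = λ m o → world-⊇ (j , _ , m , o , refl) ; off = λ m n → world-avoids (neg j m n) }
    where open Lindenbaum (Pos t) (Neg t) or bot (c _ _)

  consistent : ∀ X {t} → RealSeq X t → Cons t
  consistent X {t} r Γ B ps n e = refute n (closed X (All.map present ps) e)
    where
    present : ∀ {C} → Pos t C → mem X C
    present (j , _ , m , o , refl) = holds (r j) m o
    refute : ∀ {C} → Neg t C → mem X C → Ans
    refute (neg j m n) x = off (r j) m n x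
    refute bot x = proper X x
    refute (or p q) x = prime X x λ { (inj₁ y) → refute p y ; (inj₂ y) → refute q y }

  W-shift : ∀ {t} k → Cons t → Cons (shift k t)
  W-shift {t} k c = let (X , r) = realizer c in consistent (translate Ans d k X) λ j → record
    { holds = λ {E} m o → entails X (holds (r (j + k)) m o) (proj₂ (e j {E}))
    ; off = λ {E} m n x → off (r (j + k)) m n (entails X x (proj₁ (e j {E}))) }
    where
    e : ∀ j {E} → lev d k (lev d j E) ≈ lev d (j + k) E
    e j = ≈-trans (lev-+ d k j) (sh-≡ (cong (orient d) (+-comm k j)))

  K-≤ᶠ : ∀ {X Y t u} → RealSeq X t → RealSeq Y u → (∀ {C} → mem X C → mem Y C) → K (t ≤ᶠ u)
  K-≤ᶠ {t = t} {u} r s f = K-ℤ {R = λ j → at t j ⊆ᵗ at u j} (lo t ⊓ lo u) (hi t ⊔ hi u)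
    (λ l l′ (incl g) → incl λ m o → app (⊑u (≤-trans l (i⊓j≤j (lo t) (lo u))) (≤-trans l′ (i⊓j≤j (lo t) (lo u)))) m
      (g m (app (⊑t (≤-trans l′ (i⊓j≤i (lo t) (lo u))) (≤-trans l (i⊓j≤i (lo t) (lo u)))) m o)))
    (λ l l′ (incl g) → incl λ m o → app (⊒u (≤-trans (i≤j⊔i (hi t) (hi u)) l) (≤-trans (i≤j⊔i (hi t) (hi u)) l′)) m
      (g m (app (⊒t (≤-trans (i≤i⊔j (hi t) (hi u)) l′) (≤-trans (i≤i⊔j (hi t) (hi u)) l)) m o)))
    (λ j → K-⊆ (r j) (s j) (λ _ → f))
    where
    ⊑t : ∀ {i j} → i ≤ lo t → j ≤ lo t → at t i ⊆ᵗ at t j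
    ⊑t l l′ = incl λ m o → app (below t l′) m (app (mono t l) m o)
    ⊑u : ∀ {i j} → i ≤ lo u → j ≤ lo u → at u i ⊆ᵗ at u j
    ⊑u l l′ = incl λ m o → app (below u l′) m (app (mono u l) m o)
    ⊒t : ∀ {i j} → hi t ≤ i → hi t ≤ j → at t i ⊆ᵗ at t j
    ⊒t l l′ = incl λ m o → app (mono t l′) m (app (above t l) m o)
    ⊒u : ∀ {i j} → hi u ≤ i → hi u ≤ j → at u i ⊆ᵗ at u j
    ⊒u l l′ = incl λ m o → app (mono u l′) m (app (above u l) m o)

  W-reply : ∀ {t} → Cons t → ∀ δ j → Fires δ (at t j) → K (∃ λ u → Cons u × t ≤ᶠ u × Wit δ (at u j))
  W-reply {t} c (A ⊸ B , m) j n =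
    let (X , r) = realizer c
        (Y , f , a , nb) = refute-⇒ Ans X d j {A} {B} (off (r j) (sub∇⊸ m) n)
    in extract Y >>= λ { (u , s) → K-≤ᶠ {X} {Y} {t} {u} r s f >>= λ le → on (s j) _ a >>= λ oa → K-off (s j) _ nb >>= λ ob →
       return (u , consistent Y {u} s , le , oa , ob) }

  back : ∀ k → (k - σ d) + σ d ≡ k
  back k = cancel k (σ d)

  -- Soundness of the calculus, with disjunction and falsity relaxed by K, in the frame of all sequences of 𝒱.
  module Forcing (𝒱 : Seq → Set) (replies : ∀ {t} → 𝒱 t → ∀ δ j → Fires δ (at t j) → K (Reply 𝒱 t δ j)) where

    record Point : Set where
      constructor point
      field
        seq : Seq
        ok  : 𝒱 seq
        lvl : ℤ
    open Point

    infix 4 _≼_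
    _≼_ : Point → Point → Set
    p ≼ q = ∀ i → at (seq p) (i + lvl p) ⊆ᵗ at (seq q) (i + lvl q)

    π ρ : Point → Point
    π p = record p { lvl = lvl p + σ d }
    ρ p = record p { lvl = lvl p - σ d }

    ≼-level : ∀ t (v : 𝒱 t) {k l} → k ≡ l → point t v k ≼ point t v l
    ≼-level t v refl i = incl λ _ o → o

    ≼-trans : ∀ {p q r} → p ≼ q → q ≼ r → p ≼ r
    ≼-trans f g i = incl λ m o → app (g i) m (app (f i) m o)

    π-mono : ∀ {p q} → p ≼ q → π p ≼ π q
    π-mono {p} {q} f i = subst₂ (λ x y → at (seq p) x ⊆ᵗ at (seq q) y) (e (lvl p)) (e (lvl q)) (f (i + σ d))
      where
      e : ∀ k → (i + σ d) + k ≡ i + (k + σ d)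
      e k = trans (+-assoc i (σ d) k) (cong (_+_ i) (+-comm (σ d) k))

    π-reflects : ∀ {p q} → π p ≼ π q → p ≼ q
    π-reflects {p} {q} f i = subst₂ (λ x y → at (seq p) x ⊆ᵗ at (seq q) y) (e (lvl p)) (e (lvl q)) (f (i - σ d))
      where
      open +-*-Solver
      e : ∀ k → (i - σ d) + (k + σ d) ≡ i + k
      e k = solve 3 (λ i s k → (i :- s) :+ (k :+ s) := i :+ k) refl i (σ d) k

    πρ⁺ : ∀ p → p ≼ π (ρ p)
    πρ⁺ p = ≼-level (seq p) (ok p) (sym (back (lvl p)))

    πρ⁻ : ∀ p → π (ρ p) ≼ p
    πρ⁻ p = ≼-level (seq p) (ok p) (back (lvl p))

    grow : d ≡ up → ∀ p → p ≼ π p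
    grow refl p i = mono (seq p) (+-monoʳ-≤ i (i≤i+n (lvl p) 1))

    shrink : d ≡ down → ∀ p → π p ≼ p
    shrink refl p i = mono (seq p) (+-monoʳ-≤ i (i-n≤i (lvl p) 1))

    fc : Formula → Point → Set
    fc (atom x) p = K (Σ (atom x ∈ Φ) λ m → On (at (seq p) (lvl p)) m)
    fc ⊤′ p = ⊤
    fc ⊥′ p = Ans
    fc 𝟏 p = ⊤
    fc (A ∧ B) p = fc A p × fc B p
    fc (A ∨ B) p = K (fc A p ⊎ fc B p)
    fc (A ⊗ B) p = fc A p × fc B p
    fc (A ⊸ B) p = ∀ q → p ≼ π q → fc A q → fc B q
    fc (∇ A) p = fc A (π p)

    ≼-here : ∀ {p q} → p ≼ q → at (seq p) (lvl p) ⊆ᵗ at (seq q) (lvl q)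
    ≼-here {p} {q} f = subst₂ (λ x y → at (seq p) x ⊆ᵗ at (seq q) y) (+-identityˡ (lvl p)) (+-identityˡ (lvl q)) (f 0ℤ)

    fc-mono : ∀ A {p q} → p ≼ q → fc A p → fc A q
    fc-mono (atom x) {p} {q} l f = f >>= λ { (m , o) → return (m , app (≼-here {p} {q} l) m o) }
    fc-mono ⊤′ l f = tt
    fc-mono ⊥′ l f = f
    fc-mono 𝟏 l f = tt
    fc-mono (A ∧ B) {p} {q} l (f , g) = fc-mono A {p} {q} l f , fc-mono B {p} {q} l g
    fc-mono (A ∨ B) {p} {q} l f = f >>= λ { (inj₁ a) → return (inj₁ (fc-mono A {p} {q} l a)) ; (inj₂ b) → return (inj₂ (fc-mono B {p} {q} l b)) }
    fc-mono (A ⊗ B) {p} {q} l (f , g) = fc-mono A {p} {q} l f , fc-mono B {p} {q} l g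
    fc-mono (A ⊸ B) {p} {q} l f r l′ = f r (≼-trans {p} {q} {π r} l l′)
    fc-mono (∇ A) {p} {q} l f = fc-mono A {π p} {π q} (π-mono {p} {q} l) f

    fc-stable : ∀ A {p} → K (fc A p) → fc A p
    fc-stable (atom x) f = f >>= id
    fc-stable ⊤′ f = tt
    fc-stable ⊥′ f = f id
    fc-stable 𝟏 f = tt
    fc-stable (A ∧ B) f = fc-stable A (f >>= return ∘ proj₁) , fc-stable B (f >>= return ∘ proj₂)
    fc-stable (A ∨ B) f = f >>= id
    fc-stable (A ⊗ B) f = fc-stable A (f >>= return ∘ proj₁) , fc-stable B (f >>= return ∘ proj₂)
    fc-stable (A ⊸ B) f q l a = fc-stable B (f >>= λ g → return (g q l a))
    fc-stable (∇ A) f = fc-stable A f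

    Ctx : List Formula → Point → Set
    Ctx Γ p = All (λ B → fc B p) Γ

    swap-at : ∀ Γ {Δ Δ′ Θ p} → (Ctx Δ p → Ctx Δ′ p) → Ctx (Γ ++ Δ ++ Θ) p → Ctx (Γ ++ Δ′ ++ Θ) p
    swap-at Γ {Δ} f ps = let (qs , rs) = Allₚ.++⁻ Γ ps ; (ds , ts) = Allₚ.++⁻ Δ rs in Allₚ.++⁺ qs (Allₚ.++⁺ (f ds) ts)

    sound : ∀ {Γ A} → 𝓡 ⊢ Γ ⇒ A → ∀ p → Ctx Γ p → fc A p
    sound ax p (a ∷ []) = a
    sound R1 p _ = tt
    sound ∇1 p _ = tt
    sound R⊤ p _ = tt
    sound (L⊥ {Γ} {Δ} {A}) p ps with Allₚ.++⁻ Γ ps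
    ... | _ , b ∷ _ = fc-stable A (λ _ → b)
    sound (cut {Γ} {Π} {Δ} e f) p ps with Allₚ.++⁻ Π ps
    ... | qs , rs with Allₚ.++⁻ Γ rs
    ... | gs , ts = sound f p (Allₚ.++⁺ qs (sound e p gs ∷ ts))
    sound (L∧₁ {Γ} {Δ} {A} {B} e) p ps = sound e p (swap-at Γ {(A ∧ B) ∷ []} {A ∷ []} (λ { ((a , b) ∷ []) → a ∷ [] }) ps)
    sound (L∧₂ {Γ} {Δ} {A} {B} e) p ps = sound e p (swap-at Γ {(B ∧ A) ∷ []} {A ∷ []} (λ { ((b , a) ∷ []) → a ∷ [] }) ps)
    sound (R∧ e f) p ps = sound e p ps , sound f p ps
    sound (L∨ {Γ} {Δ} {A} {B} {C} e f) p ps with Allₚ.++⁻ Γ ps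
    ... | qs , o ∷ ts = fc-stable C (o >>= λ { (inj₁ a) → return (sound e p (Allₚ.++⁺ qs (a ∷ ts))) ; (inj₂ b) → return (sound f p (Allₚ.++⁺ qs (b ∷ ts))) })
    sound (R∨₁ e) p ps = return (inj₁ (sound e p ps))
    sound (R∨₂ e) p ps = return (inj₂ (sound e p ps))
    sound (L1 {Γ} e) p ps = sound e p (swap-at Γ {𝟏 ∷ []} {[]} (λ _ → []) ps)
    sound (L⊗ {Γ} {Δ} {A} {B} e) p ps = sound e p (swap-at Γ {(A ⊗ B) ∷ []} {A ∷ B ∷ []} (λ { ((a , b) ∷ []) → a ∷ b ∷ [] }) ps)
    sound (R⊗ {Γ} e f) p ps = let (qs , rs) = Allₚ.++⁻ Γ ps in sound e p qs , sound f p rs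
    sound (∇rule e) p (a ∷ []) = sound e (π p) (a ∷ [])
    sound (oplax e) p ((a , b) ∷ []) = sound e p (a ∷ b ∷ [])
    sound (L→ {Γ} {Π} e f) p ps with Allₚ.++⁻ Π ps
    ... | qs , rs with Allₚ.++⁻ Γ rs
    ... | gs , i ∷ ts = sound f p (Allₚ.++⁺ qs (i p (λ _ → ⊆ᵗ-refl) (sound e p gs) ∷ ts))
    sound (R→ {Γ} e) p ps q l a = sound e q (a ∷ Allₚ.map⁺ (All.map (λ {B} → fc-mono B {p} {π q} l) ps))
    sound (schN n e) p ps = sound e (π p) (Allₚ.map⁻ ps)
    sound (schP {A = A} n e) p ps = fc-mono A {π p} {p} (shrink (noP n) p) (sound e p ps)
    sound (schF {A = A} n e) p ps = fc-mono A {p} {π p} (grow (noF n) p) (sound e p ps)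
    sound (schwF {A} n e) p (a ∷ []) = sound e (ρ p) (fc-mono A {p} {π (ρ p)} (πρ⁺ p) a ∷ [])
    sound (schH {Γ} {ps} n e) p qs with Allₚ.++⁻ (∇* Γ) qs
    ... | gs , is = sound e (π p) (Allₚ.++⁺ (Allₚ.map⁻ gs) (imps-at ps is))
      where
      imps-at : ∀ ps → Ctx (∇imps ps) p → Ctx (imps ps) (π p)
      imps-at [] [] = []
      -- Invertibility of `π` is used here: `∇ A ⊸ ∇ B` at `p` is applied to `ρ q`, whose image
      -- under `π` is equivalent to `q`.
      imps-at ((A , B) ∷ ps) (i ∷ is) = (λ q l a → fc-mono B {π (ρ q)} {q} (πρ⁻ q)
          (i (ρ q) (≼-trans {p} {q} {π (ρ q)} (π-reflects {p} {q} l) (πρ⁺ q)) (fc-mono A {q} {π (ρ q)} (πρ⁺ q) a))) ∷ imps-at ps is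
    sound (weak {Γ} {A = A} e) p ps = sound e p (swap-at Γ {A ∷ []} {[]} (λ _ → []) ps)
    sound (contr {Γ} {A = A} e) p ps = sound e p (swap-at Γ {A ∷ []} {A ∷ A ∷ []} (λ { (a ∷ []) → a ∷ a ∷ [] }) ps)
    sound (exch {Γ} {A = A} {B} e) p ps = sound e p (swap-at Γ {B ∷ A ∷ []} {A ∷ B ∷ []} (λ { (b ∷ a ∷ []) → a ∷ b ∷ [] }) ps)

    truth⁺ : ∀ E (m : E ∈ Φ) p → On (at (seq p) (lvl p)) m → fc E p
    truth⁻ : ∀ E (m : E ∈ Φ) p → ¬ On (at (seq p) (lvl p)) m → fc E p → Ans

    truth-K : ∀ E (m : E ∈ Φ) p → fc E p → K (On (at (seq p) (lvl p)) m)
    truth-K E m p f k with On? (at (seq p) (lvl p)) m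
    ... | yes o = k o
    ... | no n = truth⁻ E m p n f

    truth⁺ (atom x) m p o = return (m , o)
    truth⁺ ⊤′ m p o = tt
    truth⁺ ⊥′ m p o = ⊥-elim (law (laws-at (seq p) (lvl p)) m o)
    truth⁺ 𝟏 m p o = tt
    truth⁺ (A ∧ B) m p o = let (a , b) = proj₁ (law (laws-at (seq p) (lvl p)) m) o in truth⁺ A _ p a , truth⁺ B _ p b
    truth⁺ (A ∨ B) m p o with proj₁ (law (laws-at (seq p) (lvl p)) m) o
    ... | inj₁ a = return (inj₁ (truth⁺ A _ p a))
    ... | inj₂ b = return (inj₂ (truth⁺ B _ p b))
    truth⁺ (A ⊗ B) m p o = let (a , b) = proj₁ (law (laws-at (seq p) (lvl p)) m) o in truth⁺ A _ p a , truth⁺ B _ p b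
    truth⁺ (A ⊸ B) m p o q l a = fc-stable B (truth-K A (sub₁⊸ m) q a >>= λ oa →
      return (truth⁺ B (sub₂⊸ m) q (law (laws-at (seq q) (lvl q)) m
        (up∇ (pred-at (seq q) (lvl q)) (sub∇⊸ m) (coherent (laws-at (seq q) _) m _ (app (≼-here {p} {π q} l) m o))) oa)))
    truth⁺ (∇ A) m p o = truth⁺ A (sub∇ m) (π p) (down∇ (pred-at (seq p) (lvl p)) m o)

    truth⁻ (atom x) m p n f = f λ { (m′ , o) → ⊥-elim (n (coherent (laws-at (seq p) (lvl p)) m′ m o)) }
    truth⁻ ⊤′ m p n f = ⊥-elim (n (law (laws-at (seq p) (lvl p)) m))
    truth⁻ ⊥′ m p n f = f
    truth⁻ 𝟏 m p n f = ⊥-elim (n (law (laws-at (seq p) (lvl p)) m))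
    truth⁻ (A ∧ B) m p n (f , g) = truth-K A _ p f λ a → truth-K B _ p g λ b → ⊥-elim (n (proj₂ (law (laws-at (seq p) (lvl p)) m) a b))
    truth⁻ (A ∨ B) m p n f = f λ { (inj₁ a) → truth-K A _ p a λ o → ⊥-elim (n (proj₂ (law (laws-at (seq p) (lvl p)) m) (inj₁ o)))
                                 ; (inj₂ b) → truth-K B _ p b λ o → ⊥-elim (n (proj₂ (law (laws-at (seq p) (lvl p)) m) (inj₂ o))) }
    truth⁻ (A ⊗ B) m p n (f , g) = truth-K A _ p f λ a → truth-K B _ p g λ b → ⊥-elim (n (proj₂ (law (laws-at (seq p) (lvl p)) m) a b))
    -- Accessibility is `p ≼ π q`, so the demand is raised at the level that `π` carries to the
    -- level of `p`.
    truth⁻ (A ⊸ B) m p n f = replies (ok p) (A ⊸ B , m) (lvl p - σ d) fires λ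
      { (reply y k v o (a , nb)) → truth⁻ B (sub₂⊸ m) (point y v ((lvl p - σ d) + k)) nb
          (f (point y v ((lvl p - σ d) + k)) (λ i → subst (λ x → at (seq p) (i + lvl p) ⊆ᵗ at y x) (e i k) (o (i + lvl p)))
            (truth⁺ A (sub₁⊸ m) (point y v ((lvl p - σ d) + k)) a)) }
      where
      open +-*-Solver
      e : ∀ i k → (i + lvl p) + k ≡ i + (((lvl p - σ d) + k) + σ d)
      e i k = solve 4 (λ i l k s → (i :+ l) :+ k := i :+ (((l :- s) :+ k) :+ s)) refl i (lvl p) k (σ d)
      fires : ¬ On (at (seq p) (lvl p - σ d)) (sub∇⊸ m)
      fires o = n (coherent (laws-at (seq p) (lvl p)) _ m (subst (λ x → On (at (seq p) x) (sub∇ (sub∇⊸ m))) (back (lvl p))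
        (down∇ (pred-at (seq p) (lvl p - σ d)) (sub∇⊸ m) o)))
    truth⁻ (∇ A) m p n f = truth⁻ A (sub∇ m) (π p) (λ o → n (up∇ (pred-at (seq p) (lvl p)) m o)) f

    at-level : ∀ A t (v : 𝒱 t) {k l} → k ≡ l → fc A (point t v k) → fc A (point t v l)
    at-level A t v refl f = f

    □-force : ∀ A p → (fc (□ A) p → fc A (ρ p)) × (fc A (ρ p) → fc (□ A) p)
    □-force A p = (λ f → f (ρ p) (πρ⁺ p) tt)
      , λ f q l _ → fc-mono A {ρ p} {q} (π-reflects {ρ p} {q} (≼-trans {π (ρ p)} {p} {π q} (πρ⁻ p) l)) f

    σ-orient : ∀ c n → σ c + orient c n ≡ orient c (1ℤ + n)
    σ-orient up n = refl
    σ-orient down n = orient-+ down 1ℤ n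

    σ-orient⁻ : ∀ c n → - σ c + orient c n ≡ orient c (-1ℤ + n)
    σ-orient⁻ up n = refl
    σ-orient⁻ down n = orient-+ down -1ℤ n

    shift-force : ∀ i A t (v : 𝒱 t) k → (fc (sh i A) (point t v k) → fc A (point t v (k + orient d i)))
      × (fc A (point t v (k + orient d i)) → fc (sh i A) (point t v k))
    shift-force (+ zero) A t v k = at-level A t v (sym e) , at-level A t v e
      where
      zero-orient : ∀ c → orient c 0ℤ ≡ 0ℤ
      zero-orient up = refl
      zero-orient down = refl
      e : k + orient d 0ℤ ≡ k
      e = trans (cong (_+_ k) (zero-orient d)) (+-identityʳ k)
    shift-force (+ suc n) A t v k = (λ f → at-level A t v e (proj₁ (shift-force (+ n) A t v (k + σ d)) f))
      , λ f → proj₂ (shift-force (+ n) A t v (k + σ d)) (at-level A t v (sym e) f)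
      where
      e : (k + σ d) + orient d (+ n) ≡ k + orient d (+ suc n)
      e = trans (+-assoc k (σ d) _) (cong (_+_ k) (σ-orient d (+ n)))
    shift-force -[1+ zero ] A t v k = (λ f → at-level A t v e (proj₁ (□-force A (point t v k)) f))
      , λ f → proj₂ (□-force A (point t v k)) (at-level A t v (sym e) f)
      where
      e : k - σ d ≡ k + orient d -1ℤ
      e = cong (_+_ k) (trans (sym (+-identityʳ (- σ d))) (trans (cong (_+_ (- σ d)) (z d)) (σ-orient⁻ d 0ℤ)))
        where
        z : ∀ c → 0ℤ ≡ orient c 0ℤ
        z up = refl
        z down = refl
    shift-force -[1+ suc n ] A t v k =
        (λ f → at-level A t v e (proj₁ (shift-force -[1+ n ] A t v (k - σ d)) (proj₁ (□-force (sh -[1+ n ] A) (point t v k)) f)))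
      , λ f → proj₂ (□-force (sh -[1+ n ] A) (point t v k)) (proj₂ (shift-force -[1+ n ] A t v (k - σ d)) (at-level A t v (sym e) f))
      where
      e : (k - σ d) + orient d -[1+ n ] ≡ k + orient d -[1+ suc n ]
      e = trans (+-assoc k (- σ d) _) (cong (_+_ k) (σ-orient⁻ d -[1+ n ]))

    level-force : ∀ j A t (v : 𝒱 t) → (fc (lev d j A) (point t v 0ℤ) → fc A (point t v j)) × (fc A (point t v j) → fc (lev d j A) (point t v 0ℤ))
    level-force j A t v = (λ f → at-level A t v e (proj₁ (shift-force (orient d j) A t v 0ℤ) f))
      , λ f → proj₂ (shift-force (orient d j) A t v 0ℤ) (at-level A t v (sym e) f)
      where
      twice : ∀ c → orient c (orient c j) ≡ j
      twice up = refl
      twice down = neg-involutive j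
      e : 0ℤ + orient d (orient d j) ≡ j
      e = trans (+-identityˡ _) (twice d)

    -- The class is a model in which the labels are correct. At level 0 of `t` all positive facts
    -- are forced, and forcing a negative one yields `Ans`; soundness does the rest.
    consistent′ : ∀ {t} → 𝒱 t → Cons t
    consistent′ {t} v Γ B ps n e = refute n (sound e (point t v 0ℤ) (All.map present ps))
      where
      present : ∀ {C} → Pos t C → fc C (point t v 0ℤ)
      present (j , E , m , o , refl) = proj₂ (level-force j E t v) (truth⁺ E m (point t v j) o)
      refute : ∀ {C} → Neg t C → fc C (point t v 0ℤ) → Ans
      refute (neg j {E} m n) f = truth⁻ E m (point t v j) n (proj₁ (level-force j E t v) f)
      refute bot f = f
      refute (or p q) f = f λ { (inj₁ g) → refute p g ; (inj₂ g) → refute q g }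

  W-coind : (𝒢 : Seq → Set) → (∀ {t} → 𝒢 t → ∀ δ j → Fires δ (at t j) → K (Reply (λ y → Cons y ⊎ 𝒢 y) t δ j)) → ∀ {t} → 𝒢 t → Cons t
  W-coind 𝒢 f g = Forcing.consistent′ (λ t → Cons t ⊎ 𝒢 t) replies (inj₂ g)
    where
    replies : ∀ {t} → Cons t ⊎ 𝒢 t → ∀ δ j → Fires δ (at t j) → K (Reply (λ y → Cons y ⊎ 𝒢 y) t δ j)
    replies (inj₂ g) δ j fi = f g δ j fi
    replies {t} (inj₁ c) δ j fi = W-reply c δ j fi >>= λ { (u , cu , l , w) → return
      (reply u 0ℤ (inj₁ cu) (λ i → subst (λ x → at t i ⊆ᵗ at u x) (sym (+-identityʳ i)) (l i)) (subst (λ x → Wit δ (at u x)) (sym (+-identityʳ j)) w)) }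

  finite-D : Finite D
  finite-D f k = K-∈ (λ m → f (_ , m)) (λ g → k λ { (E , m) → g m })

  open Within Cons W-shift W-reply W-coind (λ up f → bounded-Vec bounded-All up f) public
  module Certs = Conclude (length Φ) missing-bound Fires? finite-D (finite-Vec finite-State)

  certified : ∀ X → K (∃ λ t → RealSeq X t × Certs.Certificate t)
  certified X = extract X >>= λ { (t , r) → Certs.certify (consistent X {t} r) >>= λ c → return (t , r , c) }

-- The countermodel for H with one of F and P.

module GrowingModel (𝓡 : SchemeSet) (Γ : List Formula) (A : Formula)
  (valid : ∀ (ℓ : Level) (M : KripkeModel ℓ) → IsK M 𝓡 → Valid M Γ A) (h : H ∈R 𝓡) (d : Drift)
  (grows : Levels.Grows 𝓡 h d) (noP : P ∈R 𝓡 → d ≡ down) (noF : F ∈R 𝓡 → d ≡ up) where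

  open Root 𝓡 Γ A
  open Levels 𝓡 h
  open Classical Ans
  open Canonical 𝓡 Ans
  open States 𝓡 Ans Φ cl
  open Labels 𝓡 Ans Φ cl
  open Growing 𝓡 h Ans Φ cl d grows noP noF

  module _ (t₀ : Seq) (c : Certs.Certificate t₀) where
    open Certs.Certificate c

    X : Set
    X = Pt × ℤ

    st : X → State
    st (x , k) = at (seq x) k

    π ρ : X → X
    π (x , k) = x , k + σ d
    ρ (x , k) = x , k - σ d

    _≼_ : X → X → Set
    (x , k) ≼ (y , l) = ∀ i → at (seq x) (i + k) ⊆ᵗ at (seq y) (i + l)

    ≼-here : ∀ {u v} → u ≼ v → st u ⊆ᵗ st v
    ≼-here {x , k} {y , l} f = subst₂ (λ i j → at (seq x) i ⊆ᵗ at (seq y) j) (+-identityˡ k) (+-identityˡ l) (f 0ℤ)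

    move : ∀ (e : ℤ) {x y k l} → (x , k) ≼ (y , l) → (x , k + e) ≼ (y , l + e)
    move e {x} {y} {k} {l} f i = subst₂ (λ a b → at (seq x) a ⊆ᵗ at (seq y) b) (eq k) (eq l) (f (i + e))
      where
      eq : ∀ k → (i + e) + k ≡ i + (k + e)
      eq k = trans (+-assoc i e k) (cong (_+_ i) (+-comm e k))

    points : Points
    points = record
      { X = X ; R₀ = λ u v → u ≼ π v ; st = st ; ok = λ _ _ → ⊤ ; laws = λ {u} _ → laws-at (seq (proj₁ u)) (proj₂ u)
      ; ok∧ = λ _ → tt , tt ; ok∨ = λ _ → tt , tt ; ok⊗ = λ _ → tt , tt ; ok⊸ = λ _ _ → tt , tt ; ok∇ = λ _ _ → tt
      ; ⊸⁻ = λ {u} {v} m _ o l a → law (laws-at (seq (proj₁ v)) (proj₂ v)) m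
          (up∇ (pred-at (seq (proj₁ v)) (proj₂ v)) (sub∇⊸ m) (coherent (laws-at (seq (proj₁ v)) _) m _ (app (≼-here {u} {π v} l) m o))) a
      ; ⊸? = λ {u} m _ → implication u m
      ; ∇⁺ = λ {u} {v} m _ l o → up∇ (pred-at (seq (proj₁ u)) (proj₂ u)) m (app (≼-here {v} {π u} l) _ o)
      ; ∇⁻ = λ {u} m _ o → π u , (λ i → ⊆ᵗ-refl) , down∇ (pred-at (seq (proj₁ u)) (proj₂ u)) m o }
      where
      implication : ∀ u {B C} (m : (B ⊸ C) ∈ Φ) → On (st u) m ⊎ Σ X λ v → u ≼ π v × On (st v) (sub₁⊸ m) × ¬ On (st v) (sub₂⊸ m)
      implication (x , k) {B} {C} m with On? (st (x , k)) m
      ... | yes o = inj₁ o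
      ... | no n with answers x (B ⊸ C , m) (k - σ d) fires
        where
        fires : ¬ On (at (seq x) (k - σ d)) (sub∇⊸ m)
        fires o = n (coherent (laws-at (seq x) k) _ m (subst (λ j → On (at (seq x) j) (sub∇ (sub∇⊸ m))) (back k)
          (down∇ (pred-at (seq x) (k - σ d)) (sub∇⊸ m) o)))
      ... | y , e , l , a , nb = inj₂ ((y , (k - σ d) + e) , (λ i → subst (λ j → at (seq x) (i + k) ⊆ᵗ at (seq y) j) (eq i) (l (i + k))) , a , nb)
        where
        open +-*-Solver
        eq : ∀ i → (i + k) + e ≡ i + (((k - σ d) + e) + σ d)
        eq i = solve 4 (λ i l k s → (i :+ l) :+ k := i :+ (((l :- s) :+ k) :+ s)) refl i k e (σ d)

    π-mono : ∀ {u v} → u ≼ v → π u ≼ π v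
    π-mono {x , k} {y , l} f = move (σ d) {x} {y} f

    ≼-atom : ∀ {p u v} → u ≼ v → st u ∋ᵗ atom p → st v ∋ᵗ atom p
    ≼-atom {p} {u} {v} l (m , o) = m , app (≼-here {u} {v} l) m o

    module Fr = Normal.Frame (labelled points) _≼_ (λ i → ⊆ᵗ-refl) (λ f g i → ⊆ᵗ-trans (f i) (g i)) π
      (λ {u} {v} → π-mono {u} {v}) id id (λ {p} {u} {v} → ≼-atom {p} {u} {v}) d

    grow : d ≡ up → ∀ u → u ≼ π u
    grow refl (x , k) i = mono (seq x) (+-monoʳ-≤ i (i≤i+n k 1))

    shrink : d ≡ down → ∀ u → π u ≼ u
    shrink refl (x , k) i = mono (seq x) (+-monoʳ-≤ i (i-n≤i k 1))

    ahead : ∀ k → (k + σ d) - σ d ≡ k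
    ahead k = cancel′ k (σ d)

    isK : IsK Fr.model 𝓡
    isK N _ = Fr.condN
    isK H _ = Fr.condH ρ (λ { {x , k} {y , l} f → move (- σ d) {x} {y} f }) (λ { (x , k) → cong (x ,_) (back k) }) (λ { (x , k) → cong (x ,_) (ahead k) })
    isK P p = Fr.condP (shrink (noP p)) (noP p)
    isK F f = Fr.condF (grow (noF f)) (noF f)
    isK wF _ = Fr.condwF (λ { (x , k) → (x , k - σ d) , λ i → subst (λ j → at (seq x) (i + k) ⊆ᵗ at (seq x) (i + j)) (sym (back k)) ⊆ᵗ-refl })

    conclude : RealSeq root t₀ → Ans
    conclude r = K-off r₀ A∈Φ root-avoids λ n → K-All (λ m → on r₀ (Γ⊑Φ m) (root-⊇ m) >>= λ o → return (Γ⊑Φ m , o)) λ g →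
      ⊥-elim (Fr.refuting (start , 0ℤ) (All.map (λ a → (proj₁ a , tt) , a) g) (A∈Φ , tt)
        (λ a → n (pick (laws-at (seq start) 0ℤ) a A∈Φ)) (valid 0ℓ _ isK))
      where
      r₀ : Real (mem root) (at (seq start) 0ℤ)
      r₀ = subst (Real (mem root)) (sym starts) (record
        { holds = λ {E} m o → subst (mem root) (lev-0 d) (holds (r 0ℤ) m o)
        ; off = λ {E} m n x → off (r 0ℤ) m n (subst (mem root) (sym (lev-0 d)) x) })

  result : Ans
  result = certified root λ { (t , r , c) → conclude t c r }

-- Depths, and windows along orbits.

∇-depth ⊸-depth : Formula → ℕ
∇-depth (A ∧ B) = ∇-depth A ℕ.⊔ ∇-depth B
∇-depth (A ∨ B) = ∇-depth A ℕ.⊔ ∇-depth B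
∇-depth (A ⊗ B) = ∇-depth A ℕ.⊔ ∇-depth B
∇-depth (A ⊸ B) = ∇-depth A ℕ.⊔ ∇-depth B
∇-depth (∇ A) = suc (∇-depth A)
∇-depth _ = 0
⊸-depth (A ∧ B) = ⊸-depth A ℕ.⊔ ⊸-depth B
⊸-depth (A ∨ B) = ⊸-depth A ℕ.⊔ ⊸-depth B
⊸-depth (A ⊗ B) = ⊸-depth A ℕ.⊔ ⊸-depth B
⊸-depth (A ⊸ B) = suc (⊸-depth A ℕ.⊔ ⊸-depth B)
⊸-depth (∇ A) = ⊸-depth A
⊸-depth _ = 0

-- At height n of a window of height L, the formulas whose truth only depends on that window.
Visible : ℕ → ℕ → Formula → Set
Visible L n E = ⊸-depth E ℕ.≤ n × n ℕ.+ ∇-depth E ℕ.≤ L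

module Visibility (L : ℕ) where

  both : ∀ {n a b c d} → (a ℕ.⊔ b) ℕ.≤ n → n ℕ.+ (c ℕ.⊔ d) ℕ.≤ L → (a ℕ.≤ n × n ℕ.+ c ℕ.≤ L) × (b ℕ.≤ n × n ℕ.+ d ℕ.≤ L)
  both {n} {a} {b} {c} {d} p q =
    (ℕₚ.≤-trans (ℕₚ.m≤m⊔n a b) p , ℕₚ.≤-trans (ℕₚ.+-monoʳ-≤ n (ℕₚ.m≤m⊔n c d)) q)
    , (ℕₚ.≤-trans (ℕₚ.m≤n⊔m a b) p , ℕₚ.≤-trans (ℕₚ.+-monoʳ-≤ n (ℕₚ.m≤n⊔m c d)) q)

  vis∧ : ∀ {n} A B → Visible L n (A ∧ B) → Visible L n A × Visible L n B
  vis∧ A B (p , q) = both {c = ∇-depth A} p q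
  vis∨ : ∀ {n} A B → Visible L n (A ∨ B) → Visible L n A × Visible L n B
  vis∨ A B (p , q) = both {c = ∇-depth A} p q
  vis⊗ : ∀ {n} A B → Visible L n (A ⊗ B) → Visible L n A × Visible L n B
  vis⊗ A B (p , q) = both {c = ∇-depth A} p q

  -- Evaluating `⊸` descends one height and evaluating `∇` climbs one; the two depths bound how far
  -- either can go.
  vis⊸ : ∀ {n} A B → Visible L (suc n) (A ⊸ B) → Visible L n A × Visible L n B
  vis⊸ A B (s≤s p , q) = both {c = ∇-depth A} p (ℕₚ.≤-trans (ℕₚ.n≤1+n _) q)

  vis∇ : ∀ {n} A → Visible L n (∇ A) → Visible L (suc n) A
  vis∇ {n} A (p , q) = ℕₚ.≤-trans p (ℕₚ.n≤1+n n) , ℕₚ.≤-trans (ℕₚ.≤-reflexive (sym (ℕₚ.+-suc n (∇-depth A)))) q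

  vis≤ : ∀ {n E} → Visible L n E → n ℕ.≤ L
  vis≤ {n} (p , q) = ℕₚ.≤-trans (ℕₚ.m≤m+n n _) q

  vis-suc : ∀ {n A} → Visible L n (∇ A) → suc n ℕ.≤ L
  vis-suc {n} {A} (p , q) = ℕₚ.≤-trans (s≤s (ℕₚ.m≤m+n n (∇-depth A))) (ℕₚ.≤-trans (ℕₚ.≤-reflexive (sym (ℕₚ.+-suc n (∇-depth A)))) q)

⨆ : (Formula → ℕ) → List Formula → ℕ
⨆ f [] = 0
⨆ f (A ∷ Γ) = f A ℕ.⊔ ⨆ f Γ

⨆-≤ : ∀ f {A Γ} → A ∈ Γ → f A ℕ.≤ ⨆ f Γ
⨆-≤ f (here refl) = ℕₚ.m≤m⊔n _ _
⨆-≤ f {Γ = B ∷ Γ} (there m) = ℕₚ.≤-trans (⨆-≤ f m) (ℕₚ.m≤n⊔m (f B) _)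

-- Beyond its length a vector is continued by its last entry.
ent : ∀ {A : Set} {L} → Vec A (suc L) → ℕ → A
ent {L = zero} (x ∷ []) n = x
ent {L = suc L} (x ∷ xs) zero = x
ent {L = suc L} (x ∷ xs) (suc n) = ent xs n

iter-suc : ∀ n A → iter ∇ n (∇ A) ≡ ∇ (iter ∇ n A)
iter-suc zero A = refl
iter-suc (suc n) A = cong ∇ (iter-suc n A)

iter-+ : ∀ m n A → iter ∇ m (iter ∇ n A) ≡ iter ∇ (m ℕ.+ n) A
iter-+ zero n A = refl
iter-+ (suc m) n A = cong ∇ (iter-+ m n A)

module Iterated (𝓡 : SchemeSet) (Ans : Set) (Φ : List Formula) (cl : Closed Φ) (nr : N ∈R 𝓡 ⊎ H ∈R 𝓡) where
  open Calculus 𝓡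
  open Classical Ans
  open Canonical 𝓡 Ans
  open States 𝓡 Ans Φ cl

  pre : ℕ → World → World
  pre zero X = X
  pre (suc n) X = predecessor nr (pre n X)

  pre-mem : ∀ n X A → mem (pre n X) A ≡ mem X (iter ∇ n A)
  pre-mem zero X A = refl
  pre-mem (suc n) X A = trans (pre-mem n X (∇ A)) (cong (mem X) (iter-suc n A))

  RealVec : ∀ {L} → World → Vec State (suc L) → Set
  RealVec {L} X s = ∀ n → n ℕ.≤ L → Real (mem (pre n X)) (ent s n)

  pre-pre : ∀ n X → (∀ {A} → mem (pre n (predecessor nr X)) A → mem (pre (suc n) X) A) × (∀ {A} → mem (pre (suc n) X) A → mem (pre n (predecessor nr X)) A)
  pre-pre zero X = id , id
  pre-pre (suc n) X = (λ {A} x → proj₁ (pre-pre n X) x) , λ {A} x → proj₂ (pre-pre n X) x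

  retarget : ∀ {M M′ : Theory} {q} → Real M q → (∀ {A} → M A → M′ A) → (∀ {A} → M′ A → M A) → Real M′ q
  retarget r f g = record { holds = λ m o → f (holds r m o) ; off = λ m n x → off r m n (g x) }

  realizeVec : ∀ L X → K (Σ (Vec State (suc L)) (RealVec X))
  realizeVec zero X = realize (mem X) >>= λ { (q , r) → return (q ∷ [] , λ { zero _ → r }) }
  realizeVec (suc L) X = realize (mem X) >>= λ { (q , r) → realizeVec L (predecessor nr X) >>= λ { (s , rs) →
    return (q ∷ s , λ { zero _ → r ; (suc n) (s≤s l) → retarget (rs n l) (proj₁ (pre-pre n X)) (proj₂ (pre-pre n X)) }) } }

  K-upto : ∀ L {Q : ℕ → Set} → (∀ n → n ℕ.≤ L → K (Q n)) → K (∀ n → n ℕ.≤ L → Q n)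
  K-upto L {Q} f = finite-Fin {suc L} {P = λ i → Q (toℕ i)} (λ i → f (toℕ i) (ℕ.s≤s⁻¹ (toℕ<n i))) >>= λ g →
    return λ n l → subst Q (toℕ-fromℕ< (s≤s l)) (g (fromℕ< (s≤s l)))

  -- Windows of types along the orbit of a canonical world, with the local laws they satisfy.
  Realized : ∀ {L} → Vec State (suc L) → Set₁
  Realized {L} s = ((∀ n → n ℕ.≤ L → Laws (ent s n)) × (∀ n → suc n ℕ.≤ L → Pred (ent s n) (ent s (suc n)))) × Σ World λ Z → RealVec Z s

  K-local : ∀ {L} X {s : Vec State (suc L)} → RealVec X s → K ((∀ n → n ℕ.≤ L → Laws (ent s n)) × (∀ n → suc n ℕ.≤ L → Pred (ent s n) (ent s (suc n))))
  K-local {L} X {s} r = K-× (K-upto L λ n l → K-laws (pre n X) (r n l))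
    (K-upto L {Q = λ n → suc n ℕ.≤ L → Pred (ent s n) (ent s (suc n))} (λ n l → K-imp (suc n ℕ.≤? L) λ l′ → K-Pred (r n l) (r (suc n) l′) id id) >>= λ f →
     return λ n l → f n (ℕₚ.≤-trans (ℕₚ.n≤1+n n) l) l)

  module Select {L} (sel : Selection (Realized {L})) where

    Pt : Set
    Pt = Σ (Vec State (suc L)) (T ∘ proj₁ sel)

    info : (x : Pt) → Realized (proj₁ x)
    info x = proj₁ (proj₂ sel) (proj₂ x)

    world-of : Pt → World
    world-of x = proj₁ (proj₂ (info x))

    real-of : (x : Pt) → RealVec (world-of x) (proj₁ x)
    real-of x = proj₂ (proj₂ (info x))

    lawsOf : (x : Pt) → ∀ n → n ℕ.≤ L → Laws (ent (proj₁ x) n)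
    lawsOf x = proj₁ (proj₁ (info x))

    predOf : (x : Pt) → ∀ n → suc n ℕ.≤ L → Pred (ent (proj₁ x) n) (ent (proj₁ x) (suc n))
    predOf x = proj₂ (proj₁ (info x))

    point : ∀ Z → K (Σ Pt λ x → RealVec Z (proj₁ x))
    point Z = realizeVec L Z >>= λ { (s , r) → K-local Z r >>= λ l → proj₂ (proj₂ sel) (l , Z , r) >>= λ t → return ((s , t) , r) }

-- The countermodel for H without F and P.

module HModel (𝓡 : SchemeSet) (Γ : List Formula) (A : Formula)
  (valid : ∀ (ℓ : Level) (M : KripkeModel ℓ) → IsK M 𝓡 → Valid M Γ A) (h : H ∈R 𝓡) (noP : ¬ (P ∈R 𝓡)) (noF : ¬ (F ∈R 𝓡)) where

  open Root 𝓡 Γ A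
  open Calculus 𝓡
  open Levels 𝓡 h
  open Classical Ans
  open Canonical 𝓡 Ans
  open States 𝓡 Ans Φ cl
  open Labels 𝓡 Ans Φ cl
  open Iterated 𝓡 Ans Φ cl (inj₂ h)

  -- The root is placed at height `δ`, leaving room below for nested implications and above for
  -- nested `∇`; windows therefore start at the translate of the root by -δ.
  δ L : ℕ
  δ = ⨆ ⊸-depth (A ∷ Γ)
  L = δ ℕ.+ ⨆ ∇-depth (A ∷ Γ)

  open Visibility L

  module _ (sel : Selection (Realized {L})) where
    open Select sel

    _≤ʷ_ : Pt → Pt → Set
    x ≤ʷ y = ∀ n → n ℕ.≤ L → ent (proj₁ x) n ⊆ᵗ ent (proj₁ y) n

    -- `B ⊸ C` at height `n + 1` is `∇ (B ⊸ C)` at height `n`, so by H it is answered by a larger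
    -- orbit at the same heights.
    Demand : Pt → ℕ → ∀ {E} → E ∈ Φ → Set
    Demand x n {B ⊸ C} m = suc n ℕ.≤ L → On (ent (proj₁ x) (suc n)) m ⊎
      Σ Pt λ y → x ≤ʷ y × On (ent (proj₁ y) n) (sub₁⊸ m) × ¬ On (ent (proj₁ y) n) (sub₂⊸ m)
    Demand _ _ _ = ⊤

    demand : ∀ x n {E} (m : E ∈ Φ) → K (Demand x n m)
    demand x n {atom _} m = return tt
    demand x n {⊤′} m = return tt
    demand x n {⊥′} m = return tt
    demand x n {𝟏} m = return tt
    demand x n {_ ∧ _} m = return tt
    demand x n {_ ∨ _} m = return tt
    demand x n {_ ⊗ _} m = return tt
    demand x n {∇ _} m = return tt
    demand x n {B ⊸ C} m = K-imp (suc n ℕ.≤? L) λ l → case l (On? (ent (proj₁ x) (suc n)) m)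
      where
      Z = world-of x
      case : suc n ℕ.≤ L → Dec (On (ent (proj₁ x) (suc n)) m) → K _
      case l (yes o) = return (inj₁ o)
      case l (no o) =
        let l′ = ℕₚ.≤-trans (ℕₚ.n≤1+n n) l
            (Y , f , b , nc) = refute-⇒ Ans Z up (+ n) {B} {C} (λ z → off (real-of x (suc n) l) m o
              (subst id (sym (pre-mem n Z (∇ (B ⊸ C)))) z))
        in point Y >>= λ { (y , r) →
           K-upto L (λ k lk → K-⊆ (real-of x k lk) (r k lk) (λ {E} _ z → subst id (sym (pre-mem k Y E)) (f (subst id (pre-mem k Z E) z)))) >>= λ le →
           on (r n l′) _ (subst id (sym (pre-mem n Y B)) b) >>= λ ob →
           K-off (r n l′) _ (nc ∘ subst id (pre-mem n Y C)) >>= λ oc →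
           return (inj₂ (y , le , ob , oc)) }

    module _ (demands : ∀ x n → n ℕ.≤ L → ∀ {E} (m : E ∈ Φ) → Demand x n m)
      (x₀ : Pt) (r₀ : RealVec (translate Ans up (ℤ.- + δ) root) (proj₁ x₀)) where

      X : Set
      X = Pt × ℤ

      -- Levels outside the window are there to make `π` bijective; no formula is declared reliable
      -- at them.
      blank : State
      blank = All.tabulate (λ _ → false)

      st′ : Pt → ∀ n → Dec (n ℕ.≤ L) → State
      st′ x n (yes _) = ent (proj₁ x) n
      st′ x n (no _) = blank

      st : X → State
      st (x , + n) = st′ x n (n ℕ.≤? L)
      st (x , -[1+ _ ]) = blank

      st-yes : ∀ x {n} → n ℕ.≤ L → st (x , + n) ≡ ent (proj₁ x) n
      st-yes x {n} l with n ℕ.≤? L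
      ... | yes _ = refl
      ... | no ¬l = ⊥-elim (¬l l)

      _≼_ : X → X → Set
      (x , k) ≼ (y , l) = k ≡ l × x ≤ʷ y

      ≼-st : ∀ {u v} → u ≼ v → st u ≤ᵗ st v
      ≼-st {x , + n} {y , .(+ n)} (refl , f) m o with n ℕ.≤? L
      ... | yes l = app (f n l) m o
      ... | no _ = o
      ≼-st {x , -[1+ n ]} (refl , f) m o = o

      π ρ : X → X
      π (x , k) = x , sucℤ k
      ρ (x , k) = x , predℤ k

      ok : X → Formula → Set
      ok (x , + n) E = Visible L n E
      ok (x , -[1+ _ ]) E = ⊥

      onˢ : ∀ {x n E} {m : E ∈ Φ} → n ℕ.≤ L → On (st (x , + n)) m → On (ent (proj₁ x) n) m
      onˢ {x} {n} {E} {m} l = subst (λ q → On q m) (st-yes x l)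

      ofˢ : ∀ {x n E} {m : E ∈ Φ} → n ℕ.≤ L → On (ent (proj₁ x) n) m → On (st (x , + n)) m
      ofˢ {x} {n} {E} {m} l = subst (λ q → On q m) (sym (st-yes x l))

      down1 : ∀ {n k} → + suc n ≡ sucℤ k → k ≡ + n
      down1 {n} {k} e = trans (sym (ℤₚ.pred-suc k)) (trans (cong predℤ (sym e)) (ℤₚ.pred-suc (+ n)))

      points : Points
      points = record
        { X = X ; R₀ = λ u v → u ≼ π v ; st = st ; ok = ok
        ; laws = λ { {x , + n} {E} o → subst Laws (sym (st-yes x (vis≤ {E = E} o))) (lawsOf x n (vis≤ {E = E} o)) }
        ; ok∧ = λ { {x , + n} {B} {C} → vis∧ B C } ; ok∨ = λ { {x , + n} {B} {C} → vis∨ B C } ; ok⊗ = λ { {x , + n} {B} {C} → vis⊗ B C }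
        ; ok⊸ = ok-imp ; ok∇ = λ { {x , + n} {y , k} {B} o (refl , _) → vis∇ B o }
        ; ⊸⁻ = λ {u} {v} → imp⁻ {u} {v}
        ; ⊸? = imp?
        ; ∇⁺ = λ { {x , + n} {y , _} {B} m o (refl , f) b → let l = vis-suc {A = B} o in
            ofˢ {x} (vis≤ {E = ∇ B} o) (up∇ (predOf x n l) m (app (f (suc n) l) _ (onˢ {y} l b))) }
        ; ∇⁻ = λ { {x , + n} {B} m o b → let l = vis-suc {A = B} o in
            (x , + suc n) , (refl , λ _ _ → ⊆ᵗ-refl) , ofˢ {x} l (down∇ (predOf x n l) m (onˢ {x} (vis≤ {E = ∇ B} o) b)) } }
        where
        ok-imp : ∀ {u v B C} → ok u (B ⊸ C) → u ≼ π v → ok v B × ok v C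
        ok-imp {x , + suc n} {y , k} {B} {C} o (e , _) with down1 {n} {k} e
        ... | refl = vis⊸ B C o
        imp⁻ : ∀ {u v B C} (m : (B ⊸ C) ∈ Φ) → ok u (B ⊸ C) → On (st u) m → u ≼ π v → On (st v) (sub₁⊸ m) → On (st v) (sub₂⊸ m)
        imp⁻ {x , + suc n} {y , k} {B} {C} m o i (e , f) b with down1 {n} {k} e
        ... | refl = ofˢ {y} l′ (law (lawsOf y n l′) m (up∇ (predOf y n l) (sub∇⊸ m)
                (coherent (lawsOf y (suc n) l) m _ (app (f (suc n) l) m (onˢ {x} l i)))) (onˢ {y} l′ b))
          where
          l = vis≤ {E = B ⊸ C} o
          l′ = ℕₚ.≤-trans (ℕₚ.n≤1+n n) l
        imp? : ∀ {u B C} (m : (B ⊸ C) ∈ Φ) → ok u (B ⊸ C) → On (st u) m ⊎ Σ X λ v → u ≼ π v × On (st v) (sub₁⊸ m) × ¬ On (st v) (sub₂⊸ m)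
        imp? {x , + suc n} {B} {C} m o = step (demands x n l′ m l)
          where
          l = vis≤ {E = B ⊸ C} o
          l′ = ℕₚ.≤-trans (ℕₚ.n≤1+n n) l
          step : _ → _
          step (inj₁ i) = inj₁ (ofˢ {x} l i)
          step (inj₂ (y , f , b , nc)) = inj₂ ((y , + n) , (refl , f) , ofˢ {y} l′ b , λ c → nc (onˢ {y} l′ c))

      ≼-trans : ∀ {u v w} → u ≼ v → v ≼ w → u ≼ w
      ≼-trans (refl , f) (refl , g) = refl , λ n l → ⊆ᵗ-trans (f n l) (g n l)

      π-mono : ∀ {u v} → u ≼ v → π u ≼ π v
      π-mono (e , f) = cong sucℤ e , f

      ≼-atom : ∀ {p u v} → u ≼ v → st u ∋ᵗ atom p → st v ∋ᵗ atom p
      ≼-atom {p} {u} {v} l (m , o) = m , ≼-st {u} {v} l m o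

      module Fr = Normal.Frame (labelled points) _≼_ (refl , λ _ _ → ⊆ᵗ-refl) (λ {u} {v} {w} → ≼-trans {u} {v} {w}) π
        (λ {u} {v} → π-mono {u} {v}) id id (λ {p} {u} {v} → ≼-atom {p} {u} {v}) up

      isK : IsK Fr.model 𝓡
      isK N _ = Fr.condN
      isK H _ = Fr.condH ρ (λ { (e , f) → cong predℤ e , f }) (λ { (x , k) → cong (x ,_) (ℤₚ.suc-pred k) }) (λ { (x , k) → cong (x ,_) (ℤₚ.pred-suc k) })
      isK P p = ⊥-elim (noP p)
      isK F f = ⊥-elim (noF f)
      isK wF _ = Fr.condwF (λ { (x , k) → (x , predℤ k) , sym (ℤₚ.suc-pred k) , λ _ _ → incl λ _ o → o })

      δ≤L : δ ℕ.≤ L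
      δ≤L = ℕₚ.m≤m+n δ _

      visible : ∀ {B} → B ∈ A ∷ Γ → Visible L δ B
      visible m = ⨆-≤ ⊸-depth m , ℕₚ.+-monoʳ-≤ δ (⨆-≤ ∇-depth m)

      back-to-root : ∀ {B} → lev up (ℤ.- + δ) (iter ∇ δ B) ≈ B
      back-to-root {B} = ≈-trans (sh-+ (ℤ.- + δ) (+ δ)) (sh-≡ (ℤₚ.+-inverseˡ (+ δ)))

      r₁ : Real (mem root) (ent (proj₁ x₀) δ)
      r₁ = retarget (r₀ δ δ≤L)
        (λ {B} x → entails root (subst id (pre-mem δ (translate Ans up (ℤ.- + δ) root) B) x) (proj₁ back-to-root))
        (λ {B} x → subst id (sym (pre-mem δ (translate Ans up (ℤ.- + δ) root) B)) (entails root x (proj₂ back-to-root)))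

      conclude : Ans
      conclude = K-off r₁ A∈Φ root-avoids λ n → K-All (λ m → on r₁ (Γ⊑Φ m) (root-⊇ m) >>= λ o → return (m , o)) λ g →
        ⊥-elim (Fr.refuting (x₀ , + δ) (All.map (λ { (m , o) → (Γ⊑Φ m , visible (there m)) , Γ⊑Φ m , ofˢ {x₀} δ≤L o }) g)
          (A∈Φ , visible (here refl)) (λ a → n (onˢ {x₀} δ≤L (pick (subst Laws (sym (st-yes x₀ δ≤L)) (lawsOf x₀ δ δ≤L)) a A∈Φ))) (valid 0ℓ _ isK))

  result : Ans
  result = (select Realized (finite-Vec finite-State) >>= λ sel →
    finite-T (proj₁ sel) (finite-Vec finite-State) (λ x → K-upto L (λ n _ → K-Everywhere (demand sel x n))) >>= λ demands →
    Select.point sel (translate Ans up (ℤ.- + δ) root) >>= λ { (x₀ , r₀) → return (conclude sel (λ x n l m → each (demands x n l) m) x₀ r₀) }) id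

-- The countermodel for N without H, F and P.

module NModel (𝓡 : SchemeSet) (Γ : List Formula) (A : Formula)
  (valid : ∀ (ℓ : Level) (M : KripkeModel ℓ) → IsK M 𝓡 → Valid M Γ A) (n : N ∈R 𝓡)
  (noH : ¬ (H ∈R 𝓡)) (noP : ¬ (P ∈R 𝓡)) (noF : ¬ (F ∈R 𝓡)) where

  open Root 𝓡 Γ A
  open Calculus 𝓡
  open Classical Ans
  open Canonical 𝓡 Ans
  open States 𝓡 Ans Φ cl
  open Labels 𝓡 Ans Φ cl
  open Iterated 𝓡 Ans Φ cl (inj₁ n)

  δ L : ℕ
  δ = ⨆ ⊸-depth (A ∷ Γ)
  L = δ ℕ.+ ⨆ ∇-depth (A ∷ Γ)

  open Visibility L

  module _ (sel : Selection (Realized {L})) where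
    open Select sel

    -- The trace of canonical accessibility from the predecessor number `i`: iterated `∇` of a
    -- formula there acquires one more `∇` in `y`, hence the displacement by one entry.
    Over : Pt → ℕ → Pt → Set
    Over x i y = ∀ r → r ℕ.≤ L → suc r ℕ.≤ L → i ℕ.+ r ℕ.≤ L → ent (proj₁ x) (i ℕ.+ r) ⊆ᵗ ent (proj₁ y) (suc r)

    K-Over : ∀ x i {Y y} → pre i (world-of x) ↦ Y → RealVec Y (proj₁ y) → K (Over x i y)
    K-Over x i {Y} f r = K-upto L λ k _ → K-imp (suc k ℕ.≤? L) λ l → K-imp (i ℕ.+ k ℕ.≤? L) λ l′ →
      K-⊆ (real-of x (i ℕ.+ k) l′) (r (suc k) l) λ {E} _ z →
        subst id (sym (pre-mem (suc k) Y E)) (f {iter ∇ k E} (subst id (e k E) z))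
      where
      e : ∀ k E → mem (pre (i ℕ.+ k) (world-of x)) E ≡ mem (pre i (world-of x)) (iter ∇ k E)
      e k E = trans (pre-mem (i ℕ.+ k) (world-of x) E) (trans (cong (mem (world-of x)) (sym (iter-+ i k E))) (sym (pre-mem i (world-of x) (iter ∇ k E))))

    Demand : Pt → ℕ → ∀ {E} → E ∈ Φ → Set
    Demand x i {B ⊸ C} m = On (ent (proj₁ x) i) m ⊎
      Σ Pt λ y → Over x i y × On (ent (proj₁ y) 0) (sub₁⊸ m) × ¬ On (ent (proj₁ y) 0) (sub₂⊸ m)
    Demand _ _ _ = ⊤

    demand : ∀ x i → i ℕ.≤ L → ∀ {E} (m : E ∈ Φ) → K (Demand x i m)
    demand x i l {atom _} m = return tt
    demand x i l {⊤′} m = return tt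
    demand x i l {⊥′} m = return tt
    demand x i l {𝟏} m = return tt
    demand x i l {_ ∧ _} m = return tt
    demand x i l {_ ∨ _} m = return tt
    demand x i l {_ ⊗ _} m = return tt
    demand x i l {∇ _} m = return tt
    demand x i l {B ⊸ C} m = case (On? (ent (proj₁ x) i) m)
      where
      case : Dec (On (ent (proj₁ x) i) m) → K _
      case (yes o) = return (inj₁ o)
      case (no o) =
        let (Y , f , b , nc) = refute-⊸ (pre i (world-of x)) (off (real-of x i l) m o) in
        point Y >>= λ { (y , r) → K-Over x i {Y} {y} f r >>= λ ov → on (r 0 z≤n) _ b >>= λ ob → K-off (r 0 z≤n) _ nc >>= λ oc →
        return (inj₂ (y , ov , ob , oc)) }

    module _ (demands : ∀ x i → i ℕ.≤ L → ∀ {E} (m : E ∈ Φ) → Demand x i m)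
      (serials : wF ∈R 𝓡 → ∀ x i → i ℕ.≤ L → Σ Pt (Over x i))
      (x₀ : Pt) (r₀ : RealVec root (proj₁ x₀)) where

      -- A window of which the first i entries have been consumed, raised by c; the points neg m only
      -- make the accessibility relation serial.
      data X : Set where
        pt  : Pt → (c i : ℕ) → X
        neg : Pt → (m : ℕ) → X

      st′ : Pt → ℕ → ∀ {k} → Dec (k ℕ.≤ L) → State
      st′ x i (yes _) = ent (proj₁ x) i
      st′ x i (no _) = All.tabulate (λ _ → false)

      st : X → State
      st (pt x c i) = st′ x i (c ℕ.+ i ℕ.≤? L)
      st (neg x m) = All.tabulate (λ _ → false)

      st-yes : ∀ x c i → c ℕ.+ i ℕ.≤ L → st (pt x c i) ≡ ent (proj₁ x) i
      st-yes x c i l with c ℕ.+ i ℕ.≤? L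
      ... | yes _ = refl
      ... | no ¬l = ⊥-elim (¬l l)

      infix 4 _≼_
      data _≼_ : X → X → Set where
        pts  : ∀ {x y c i d j} → c ℕ.+ i ≡ d ℕ.+ j →
               (∀ r → c ℕ.+ i ℕ.+ r ℕ.≤ L → ent (proj₁ x) (i ℕ.+ r) ⊆ᵗ ent (proj₁ y) (j ℕ.+ r)) → pt x c i ≼ pt y d j
        negs : ∀ {x y m} → (∀ r → r ℕ.≤ L → ent (proj₁ x) r ⊆ᵗ ent (proj₁ y) r) → neg x m ≼ neg y m

      ≼-refl : ∀ {u} → u ≼ u
      ≼-refl {pt _ _ _} = pts refl λ _ _ → incl λ _ o → o
      ≼-refl {neg _ _} = negs λ _ _ → incl λ _ o → o

      ≼-trans : ∀ {u v w} → u ≼ v → v ≼ w → u ≼ w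
      ≼-trans (pts e f) (pts e′ g) = pts (trans e e′) λ r l → incl λ m o → app (g r (subst (λ k → k ℕ.+ r ℕ.≤ L) e l)) m (app (f r l) m o)
      ≼-trans (negs f) (negs g) = negs λ r l → incl λ m o → app (g r l) m (app (f r l) m o)

      π : X → X
      π (pt x c i) = pt x c (suc i)
      π (neg x zero) = pt x 0 0
      π (neg x (suc m)) = neg x m

      π-mono : ∀ {u v} → u ≼ v → π u ≼ π v
      π-mono {pt x c i} {pt y d j} (pts e f) = pts (trans (ℕₚ.+-suc c i) (trans (cong suc e) (sym (ℕₚ.+-suc d j)))) λ r l →
        subst₂ (λ k k′ → ent (proj₁ x) k ⊆ᵗ ent (proj₁ y) k′) (ℕₚ.+-suc i r) (ℕₚ.+-suc j r) (f (suc r) (ℕₚ.≤-trans (ℕₚ.≤-reflexive (trans (ℕₚ.+-suc (c ℕ.+ i) r) (cong (ℕ._+ r) (sym (ℕₚ.+-suc c i))))) l))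
      π-mono {neg x zero} (negs f) = pts refl f
      π-mono {neg x (suc m)} (negs f) = negs f

      entry : ∀ {x y c i d j} → pt x c i ≼ pt y d j → c ℕ.+ i ℕ.≤ L → ent (proj₁ x) i ⊆ᵗ ent (proj₁ y) j
      entry {x} {y} {c} {i} {d} {j} (pts e f) l = subst₂ (λ k k′ → ent (proj₁ x) k ⊆ᵗ ent (proj₁ y) k′) (ℕₚ.+-identityʳ i) (ℕₚ.+-identityʳ j) (f 0 (ℕₚ.≤-trans (ℕₚ.≤-reflexive (ℕₚ.+-identityʳ _)) l))

      ≼-st : ∀ {u v} → u ≼ v → st u ≤ᵗ st v
      ≼-st {pt x c i} {pt y d j} l@(pts e _) m o with c ℕ.+ i ℕ.≤? L | d ℕ.+ j ℕ.≤? L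
      ... | yes p | yes _ = app (entry l p) m o
      ... | yes p | no ¬p = ⊥-elim (¬p (subst (ℕ._≤ L) e p))
      ... | no ¬p | yes p = ⊥-elim (¬p (subst (ℕ._≤ L) (sym e) p))
      ... | no _ | no _ = o
      ≼-st (negs f) m o = o

      ok : X → Formula → Set
      ok (pt x c i) E = Visible L (c ℕ.+ i) E
      ok (neg _ _) E = ⊥

      i≤ : ∀ {c i} → c ℕ.+ i ℕ.≤ L → i ℕ.≤ L
      i≤ {c} {i} l = ℕₚ.≤-trans (ℕₚ.m≤n+m i c) l

      onˢ : ∀ {x c i E} {m : E ∈ Φ} → c ℕ.+ i ℕ.≤ L → On (st (pt x c i)) m → On (ent (proj₁ x) i) m
      onˢ {x} {c} {i} {E} {m} l = subst (λ q → On q m) (st-yes x c i l)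

      ofˢ : ∀ {x c i E} {m : E ∈ Φ} → c ℕ.+ i ℕ.≤ L → On (ent (proj₁ x) i) m → On (st (pt x c i)) m
      ofˢ {x} {c} {i} {E} {m} l = subst (λ q → On q m) (sym (st-yes x c i l))

      lawsˢ : ∀ x c i → c ℕ.+ i ℕ.≤ L → Laws (st (pt x c i))
      lawsˢ x c i l = subst Laws (sym (st-yes x c i l)) (lawsOf x i (i≤ {c} l))

      enter : ∀ {x c i y k} → Over x i y → c ℕ.+ i ≡ suc k → pt x c i ≼ π (pt y k 0)
      enter {x} {c} {i} {y} {k} ov e = pts (trans e (sym (ℕₚ.+-comm k 1))) λ r l →
        let l′ = ℕₚ.≤-trans (ℕₚ.≤-reflexive (cong (ℕ._+ r) (sym e))) l in
        ov r (ℕₚ.≤-trans (ℕₚ.m≤n+m r (c ℕ.+ i)) l) (ℕₚ.≤-trans (s≤s (ℕₚ.m≤n+m r k)) l′)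
          (ℕₚ.≤-trans (ℕₚ.m≤n+m (i ℕ.+ r) c) (ℕₚ.≤-trans (ℕₚ.≤-reflexive (sym (ℕₚ.+-assoc c i r))) l))

      points : Points
      points = record
        { X = X ; R₀ = λ u v → u ≼ π v ; st = st ; ok = ok
        ; laws = λ { {pt x c i} {E} o → lawsˢ x c i (vis≤ {E = E} o) }
        ; ok∧ = λ { {pt _ _ _} {B} {C} → vis∧ B C } ; ok∨ = λ { {pt _ _ _} {B} {C} → vis∨ B C } ; ok⊗ = λ { {pt _ _ _} {B} {C} → vis⊗ B C }
        ; ok⊸ = λ {u} {v} → ok-imp {u} {v} ; ok∇ = ok-nab
        ; ⊸⁻ = λ {u} {v} → imp⁻ {u} {v}
        ; ⊸? = imp?
        ; ∇⁺ = nab⁺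
        ; ∇⁻ = nab⁻ }
        where
        ok-imp : ∀ {u v B C} → ok u (B ⊸ C) → u ≼ π v → ok v B × ok v C
        ok-imp {pt x c i} {pt y d j} {B} {C} o (pts e _) = vis⊸ B C (subst (λ k → Visible L k (B ⊸ C)) (trans e (ℕₚ.+-suc d j)) o)
        ok-imp {pt x c i} {neg y zero} {B} {C} (p , _) (pts e _) = ⊥-elim (ℕₚ.1+n≰n (ℕₚ.≤-trans p′ z≤n))
          where
          p′ : suc (⊸-depth B ℕ.⊔ ⊸-depth C) ℕ.≤ 0
          p′ = subst (suc (⊸-depth B ℕ.⊔ ⊸-depth C) ℕ.≤_) e p
        ok-nab : ∀ {u v B} → ok u (∇ B) → v ≼ π u → ok v B
        ok-nab {pt x c i} {pt y d j} {B} o (pts e _) = subst (λ k → Visible L k B) (sym (trans e (ℕₚ.+-suc c i))) (vis∇ B o)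
        imp⁻ : ∀ {u v B C} (m : (B ⊸ C) ∈ Φ) → ok u (B ⊸ C) → On (st u) m → u ≼ π v → On (st v) (sub₁⊸ m) → On (st v) (sub₂⊸ m)
        imp⁻ {pt x c i} {neg y zero} {B} {C} m o _ r _ = ⊥-elim (proj₁ (ok-imp {pt x c i} {neg y zero} {B} {C} o r))
        imp⁻ {pt x c i} {pt y d j} {B} {C} m o a r@(pts e _) b =
          ofˢ {y} {d} l′ (law (lawsOf y j (i≤ {d} l′)) m (up∇ (predOf y j lj) (sub∇⊸ m)
            (coherent (lawsOf y (suc j) lj) m _ (app (entry r l) m (onˢ {x} {c} l a)))) (onˢ {y} {d} l′ b))
          where
          l = vis≤ {E = B ⊸ C} o
          lj : suc j ℕ.≤ L
          lj = i≤ {d} (subst (ℕ._≤ L) e l)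
          l′ : d ℕ.+ j ℕ.≤ L
          l′ = ℕₚ.≤-trans (ℕₚ.n≤1+n _) (subst (ℕ._≤ L) (trans e (ℕₚ.+-suc d j)) l)
        imp? : ∀ {u B C} (m : (B ⊸ C) ∈ Φ) → ok u (B ⊸ C) → On (st u) m ⊎ Σ X λ v → u ≼ π v × On (st v) (sub₁⊸ m) × ¬ On (st v) (sub₂⊸ m)
        imp? {pt x c i} {B} {C} m o = step (c ℕ.+ i) refl (proj₁ o) (demands x i (i≤ {c} l) m)
          where
          l = vis≤ {E = B ⊸ C} o
          step : ∀ k → c ℕ.+ i ≡ k → suc (⊸-depth B ℕ.⊔ ⊸-depth C) ℕ.≤ k → Demand x i m →
            On (st (pt x c i)) m ⊎ Σ X λ v → pt x c i ≼ π v × On (st v) (sub₁⊸ m) × ¬ On (st v) (sub₂⊸ m)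
          step k e p (inj₁ a) = inj₁ (ofˢ {x} {c} l a)
          step (suc k) e p (inj₂ (y , ov , b , nc)) = inj₂ (pt y k 0 , enter {x} {c} {i} {y} {k} ov e , ofˢ {y} {k} l′ b , λ z → nc (onˢ {y} {k} l′ z))
            where
            l′ : k ℕ.+ 0 ℕ.≤ L
            l′ = ℕₚ.≤-trans (ℕₚ.≤-reflexive (ℕₚ.+-identityʳ k)) (ℕₚ.≤-trans (ℕₚ.n≤1+n k) (subst (ℕ._≤ L) e l))
        nab⁺ : ∀ {u v B} (m : ∇ B ∈ Φ) → ok u (∇ B) → v ≼ π u → On (st v) (sub∇ m) → On (st u) m
        nab⁺ {pt x c i} {pt y d j} {B} m o r@(pts e _) b =
          ofˢ {x} {c} (vis≤ {E = ∇ B} o) (up∇ (predOf x i (i≤ {c} l)) m (app (entry r l′) _ (onˢ {y} {d} l′ b)))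
          where
          l : c ℕ.+ suc i ℕ.≤ L
          l = ℕₚ.≤-trans (ℕₚ.≤-reflexive (ℕₚ.+-suc c i)) (vis-suc {A = B} o)
          l′ = subst (ℕ._≤ L) (sym e) l
        nab⁻ : ∀ {u B} (m : ∇ B ∈ Φ) → ok u (∇ B) → On (st u) m → Σ X λ v → v ≼ π u × On (st v) (sub∇ m)
        nab⁻ {pt x c i} {B} m o b = pt x c (suc i) , ≼-refl , ofˢ {x} {c} l (down∇ (predOf x i (i≤ {c} l)) m (onˢ {x} {c} (vis≤ {E = ∇ B} o) b))
          where
          l : c ℕ.+ suc i ℕ.≤ L
          l = ℕₚ.≤-trans (ℕₚ.≤-reflexive (ℕₚ.+-suc c i)) (vis-suc {A = B} o)

      ≼-atom : ∀ {p u v} → u ≼ v → st u ∋ᵗ atom p → st v ∋ᵗ atom p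
      ≼-atom l (m , o) = m , ≼-st l m o

      module Fr = Normal.Frame (labelled points) _≼_ ≼-refl ≼-trans π π-mono id id (λ {p} {u} {v} → ≼-atom {p} {u} {v}) up

      successor : wF ∈R 𝓡 → ∀ u → ∃ λ v → u ≼ π v
      successor w (pt x c i) = step (c ℕ.+ i) refl (c ℕ.+ i ℕ.≤? L)
        where
        step : ∀ k → c ℕ.+ i ≡ k → Dec (c ℕ.+ i ℕ.≤ L) → ∃ λ v → pt x c i ≼ π v
        -- At height 0 there is no lower height for a new window, and a point below the given window
        -- takes its place.
        step zero e _ = neg x 0 , pts e (λ r _ → subst (λ j → ent (proj₁ x) (j ℕ.+ r) ⊆ᵗ ent (proj₁ x) r) (sym (ℕₚ.m+n≡0⇒n≡0 c e)) ⊆ᵗ-refl)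
        step (suc k) e (yes l) = let (y , ov) = serials w x i (i≤ {c} l) in pt y k 0 , enter {x} {c} {i} {y} {k} ov e
        step (suc k) e (no ¬l) = pt x k 0 , pts (trans e (sym (ℕₚ.+-comm k 1))) λ r l → ⊥-elim (¬l (ℕₚ.≤-trans (ℕₚ.m≤m+n _ r) l))
      successor w (neg x m) = neg x (suc m) , ≼-refl

      isK : IsK Fr.model 𝓡
      isK N _ = Fr.condN
      isK H h = ⊥-elim (noH h)
      isK P p = ⊥-elim (noP p)
      isK F f = ⊥-elim (noF f)
      isK wF w = Fr.condwF (successor w)

      δ≤L : δ ℕ.+ 0 ℕ.≤ L
      δ≤L = ℕₚ.+-monoʳ-≤ δ z≤n

      visible : ∀ {B} → B ∈ A ∷ Γ → Visible L (δ ℕ.+ 0) B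
      visible {B} m = subst (λ k → Visible L k B) (sym (ℕₚ.+-identityʳ δ)) (⨆-≤ ⊸-depth m , ℕₚ.+-monoʳ-≤ δ (⨆-≤ ∇-depth m))

      conclude : Ans
      conclude = K-off (r₀ 0 z≤n) A∈Φ root-avoids λ nA → K-All (λ m → on (r₀ 0 z≤n) (Γ⊑Φ m) (root-⊇ m) >>= λ o → return (m , o)) λ g →
        ⊥-elim (Fr.refuting (pt x₀ δ 0) (All.map (λ { (m , o) → (Γ⊑Φ m , visible (there m)) , Γ⊑Φ m , ofˢ {x₀} {δ} δ≤L o }) g)
          (A∈Φ , visible (here refl)) (λ a → nA (onˢ {x₀} {δ} δ≤L (pick (lawsˢ x₀ δ 0 δ≤L) a A∈Φ))) (valid 0ℓ _ isK))

  result : Ans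
  result = (select Realized (finite-Vec finite-State) >>= λ sel →
    finite-T (proj₁ sel) (finite-Vec finite-State) (λ x → K-upto L (λ i l → K-Everywhere (demand sel x i l))) >>= λ demands →
    K-imp (T? (𝓡 wF)) (λ w → finite-T (proj₁ sel) (finite-Vec finite-State) (λ x → K-upto L (λ i _ →
      let (Y , f) = serial w (pre i (Select.world-of sel x)) in
      Select.point sel Y >>= λ { (y , r) → K-Over sel x i {Y} {y} f r >>= λ ov → return (y , ov) }))) >>= λ serials →
    Select.point sel root >>= λ { (x₀ , r₀) → return (conclude sel (λ x i l m → each (demands x i l) m) serials x₀ r₀) }) id

-- Dickson's lemma; the exponent i of E ∈ Ψ stands for the formula ∇ⁱ E, and nothing for its absence.

Exponents : List Formula → Set
Exponents Ψ = All (λ _ → Maybe ℕ) Ψ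

-- An absent formula is the weakest fact. Ordered by growing weakness, as for F, it would come last;
-- ordered by growing strength, as for P, first. Leaving it incomparable serves both.
data _≤ᵐ_ : Maybe ℕ → Maybe ℕ → Set where
  none : nothing ≤ᵐ nothing
  some : ∀ {i j} → i ℕ.≤ j → just i ≤ᵐ just j

≤ᵐ-refl : ∀ {x} → x ≤ᵐ x
≤ᵐ-refl {just _} = some ℕₚ.≤-refl
≤ᵐ-refl {nothing} = none

infix 4 _≤ᵛ_
data _≤ᵛ_ : ∀ {Ψ} → Exponents Ψ → Exponents Ψ → Set where
  []  : [] ≤ᵛ []
  _∷_ : ∀ {E Ψ x y} {e f : Exponents Ψ} → x ≤ᵐ y → e ≤ᵛ f → _≤ᵛ_ {E ∷ Ψ} (x ∷ e) (y ∷ f)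

≤ᵛ-refl : ∀ {Ψ} {e : Exponents Ψ} → e ≤ᵛ e
≤ᵛ-refl {e = []} = []
≤ᵛ-refl {e = _ ∷ _} = ≤ᵐ-refl ∷ ≤ᵛ-refl

cap : ∀ {Ψ} → ℕ → Exponents Ψ → Exponents Ψ
cap b [] = []
cap b (x ∷ e) = Maybe.map (ℕ._⊓ b) x ∷ cap b e

capᵐ-mono : ∀ {b c} x → b ℕ.≤ c → Maybe.map (ℕ._⊓ b) x ≤ᵐ Maybe.map (ℕ._⊓ c) x
capᵐ-mono (just i) l = some (ℕₚ.⊓-monoʳ-≤ i l)
capᵐ-mono nothing l = none

cap-mono : ∀ {Ψ b c} (e : Exponents Ψ) → b ℕ.≤ c → cap b e ≤ᵛ cap c e
cap-mono [] l = []
cap-mono (x ∷ e) l = capᵐ-mono x l ∷ cap-mono e l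

lookup-cap : ∀ {Ψ E} b (e : Exponents Ψ) (m : E ∈ Ψ) → All.lookup (cap b e) m ≡ Maybe.map (ℕ._⊓ b) (All.lookup e m)
lookup-cap b (x ∷ e) (here refl) = refl
lookup-cap b (x ∷ e) (there m) = lookup-cap b e m

module Dickson (Ans : Set) where
  open Classical Ans

  bounded-ℕ : ∀ {R : ℕ → ℕ → Set} → (∀ {i k l} → k ℕ.≤ l → R i k → R i l) → (∀ i → K (∃ (R i))) → ∀ b → K (∃ λ k → ∀ i → i ℕ.≤ b → R i k)
  bounded-ℕ raise f zero = f 0 >>= λ { (k , r) → return (k , λ { zero _ → r }) }
  bounded-ℕ {R} raise f (suc b) = bounded-ℕ raise f b >>= λ { (k , g) → f (suc b) >>= λ { (l , r) →
    return (k ℕ.⊔ l , λ i le → pick i (ℕₚ.m≤n⇒m<n∨m≡n le) g r) } }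
    where
    pick : ∀ {k l} i → i ℕ.< suc b ⊎ i ≡ suc b → (∀ i → i ℕ.≤ b → R i k) → R (suc b) l → R i (k ℕ.⊔ l)
    pick {k} {l} i (inj₁ (s≤s le)) g r = raise (ℕₚ.m≤m⊔n k l) (g i le)
    pick {k} {l} i (inj₂ refl) g r = raise (ℕₚ.m≤n⊔m k l) r

  bounded-Maybe : ∀ {R : Maybe ℕ → ℕ → Set} → (∀ {x k l} → k ℕ.≤ l → R x k → R x l) → (∀ x → K (∃ (R x))) →
    ∀ b → K (∃ λ k → ∀ x → R (Maybe.map (ℕ._⊓ b) x) k)
  bounded-Maybe {R} raise f b = f nothing >>= λ { (k , r) → bounded-ℕ {λ i → R (just i)} raise (f ∘ just) b >>= λ { (l , g) →
    return (k ℕ.⊔ l , λ { nothing → raise (ℕₚ.m≤m⊔n k l) r ; (just i) → raise (ℕₚ.m≤n⊔m k l) (g (i ℕ.⊓ b) (ℕₚ.m⊓n≤n i b)) }) } }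

  bounded-cap : ∀ Ψ {R : Exponents Ψ → ℕ → Set} → (∀ {e k l} → k ℕ.≤ l → R e k → R e l) → (∀ e → K (∃ (R e))) →
    ∀ b → K (∃ λ k → ∀ e → R (cap b e) k)
  bounded-cap [] raise f b = f [] >>= λ { (k , r) → return (k , λ { [] → r }) }
  bounded-cap (E ∷ Ψ) {R} raise f b = bounded-Maybe {λ x k → ∀ e → R (x ∷ cap b e) k} (λ l g e → raise l (g e))
    (λ x → bounded-cap Ψ {λ e → R (x ∷ e)} raise (λ e → f (x ∷ e)) b) b >>= λ { (k , g) → return (k , λ { (x ∷ e) → g x e }) }

  Saturates : ∀ {Ψ} → (Exponents Ψ → Set) → ℕ → Set
  Saturates U b = ∀ e → U e → K (U (cap b e))

  saturates-mono : ∀ {Ψ} {U : Exponents Ψ → Set} → (∀ {e f} → e ≤ᵛ f → U e → U f) → ∀ {b c} → b ℕ.≤ c → Saturates U b → Saturates U c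
  saturates-mono mono l s e u = s e u >>= λ u′ → return (mono (cap-mono e l) u′)

  -- An upward closed set of exponents is determined by its members below some bound.
  dickson : ∀ Ψ (U : Exponents Ψ → Set) → (∀ {e f} → e ≤ᵛ f → U e → U f) → K (∃ (Saturates U))
  dickson [] U mono = return (0 , λ { [] u → return u })
  dickson (E ∷ Ψ) U mono =
    dickson Ψ (λ e → U (nothing ∷ e)) (λ l → mono (none ∷ l)) >>= λ { (b₀ , s₀) →
    dickson Ψ V (λ { l (i , u) → i , mono (≤ᵐ-refl ∷ l) u }) >>= λ { (b₁ , s₁) →
    bounded-cap Ψ {λ e k → V e → K (U (just k ∷ e))} (λ l f v → f v >>= λ u → return (mono (some l ∷ ≤ᵛ-refl) u)) choose b₁ >>= λ { (c , g) →
    bounded-ℕ {λ i k → Saturates (λ e → U (just i ∷ e)) k} (λ {i} → saturates-mono {U = λ e → U (just i ∷ e)} (λ l → mono (≤ᵐ-refl ∷ l)))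
      (λ i → dickson Ψ (λ e → U (just i ∷ e)) (λ l → mono (≤ᵐ-refl ∷ l))) c >>= λ { (b₂ , s₂) →
    return (combine b₀ s₀ b₁ s₁ c g b₂ s₂) }}}}
    where
    -- The projection forgetting the first exponent. One value `c` of that exponent works for the
    -- finitely many capped members, and the slices below `c` are treated one by one.
    V : Exponents Ψ → Set
    V e = ∃ λ i → U (just i ∷ e)
    choose : ∀ e → K (∃ λ k → V e → K (U (just k ∷ e)))
    choose e = em (V e) >>= λ { (inj₁ (i , u)) → return (i , λ _ → return u) ; (inj₂ n) → return (0 , λ v _ → n v) }
    combine : ∀ b₀ → Saturates (λ e → U (nothing ∷ e)) b₀ → ∀ b₁ → Saturates V b₁ → ∀ c → (∀ e → V (cap b₁ e) → K (U (just c ∷ cap b₁ e))) →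
      ∀ b₂ → (∀ i → i ℕ.≤ c → Saturates (λ e → U (just i ∷ e)) b₂) → ∃ (Saturates U)
    combine b₀ s₀ b₁ s₁ c g b₂ s₂ = b , sat
      where
      b = (b₀ ℕ.⊔ b₁) ℕ.⊔ (c ℕ.⊔ b₂)
      le₀ : b₀ ℕ.≤ b
      le₀ = ℕₚ.≤-trans (ℕₚ.m≤m⊔n b₀ b₁) (ℕₚ.m≤m⊔n _ _)
      le₁ : b₁ ℕ.≤ b
      le₁ = ℕₚ.≤-trans (ℕₚ.m≤n⊔m b₀ b₁) (ℕₚ.m≤m⊔n _ _)
      leᶜ : c ℕ.≤ b
      leᶜ = ℕₚ.≤-trans (ℕₚ.m≤m⊔n c b₂) (ℕₚ.m≤n⊔m (b₀ ℕ.⊔ b₁) _)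
      le₂ : b₂ ℕ.≤ b
      le₂ = ℕₚ.≤-trans (ℕₚ.m≤n⊔m c b₂) (ℕₚ.m≤n⊔m (b₀ ℕ.⊔ b₁) _)
      sat : Saturates U b
      sat (nothing ∷ e) u = s₀ e u >>= λ u′ → return (mono (none ∷ cap-mono e le₀) u′)
      sat (just i ∷ e) u with ℕₚ.≤-total i c
      ... | inj₁ l = s₂ i l e u >>= λ u′ → return (mono (some (ℕₚ.⊓-glb ℕₚ.≤-refl (ℕₚ.≤-trans l leᶜ)) ∷ cap-mono e le₂) u′)
      -- From `c` on the first exponent can be lowered to `c`, so only the projection is consulted.
      ... | inj₂ l = s₁ e (i , u) >>= λ v → g e v >>= λ u′ → return (mono (some (ℕₚ.⊓-glb l leᶜ) ∷ cap-mono e le₁) u′)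

  least : ∀ {Q : ℕ → Set} n → Q n → K (∃ λ k → Q k × (∀ j → j ℕ.< k → Q j → Ans))
  least {Q} n q = go (suc n) >>= λ { (inj₁ r) → return r ; (inj₂ f) → λ _ → f n ℕₚ.≤-refl q }
    where
    go : ∀ b → K ((∃ λ k → Q k × (∀ j → j ℕ.< k → Q j → Ans)) ⊎ (∀ j → j ℕ.< b → Q j → Ans))
    go zero = return (inj₂ λ _ ())
    go (suc b) = go b >>= λ
      { (inj₁ r) → return (inj₁ r)
      ; (inj₂ f) → em (Q b) >>= λ
        { (inj₁ q) → return (inj₁ (b , q , f))
        ; (inj₂ n) → return (inj₂ λ { j (s≤s l) q → split f n (ℕₚ.m≤n⇒m<n∨m≡n l) q }) } }
      where
      split : ∀ {j} → (∀ j → j ℕ.< b → Q j → Ans) → (Q b → Ans) → j ℕ.< b ⊎ j ≡ b → Q j → Ans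
      split f n (inj₁ l) = f _ l
      split f n (inj₂ refl) = n

fact : Maybe ℕ → Formula → Formula
fact nothing E = ⊤′
fact (just i) E = iter ∇ i E

facts : ∀ {Ψ} → Exponents Ψ → List Formula
facts [] = []
facts {E ∷ Ψ} (x ∷ e) = fact x E ∷ facts e

lookup-facts : ∀ {Ψ E} (e : Exponents Ψ) (m : E ∈ Ψ) → fact (All.lookup e m) E ∈ facts e
lookup-facts (x ∷ e) (here refl) = here refl
lookup-facts (x ∷ e) (there m) = there (lookup-facts e m)

just-fact : ∀ {Ψ E i} (e : Exponents Ψ) (m : E ∈ Ψ) → All.lookup e m ≡ just i → iter ∇ i E ∈ facts e
just-fact {E = E} e m eq = subst (λ x → fact x E ∈ facts e) eq (lookup-facts e m)

all-facts : ∀ {Ψ} {Q : Formula → Set} → Q ⊤′ → (e : Exponents Ψ) → (∀ {E} (m : E ∈ Ψ) i → All.lookup e m ≡ just i → Q (iter ∇ i E)) → All Q (facts e)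
all-facts t [] f = []
all-facts {E ∷ Ψ} {Q} t (nothing ∷ e) f = t ∷ all-facts t e (f ∘ there)
all-facts {E ∷ Ψ} {Q} t (just i ∷ e) f = f (here refl) i refl ∷ all-facts t e (f ∘ there)

nothings : ∀ {Ψ} → Exponents Ψ → ℕ
nothings [] = 0
nothings (nothing ∷ e) = suc (nothings e)
nothings (just _ ∷ e) = nothings e

nothings-cap : ∀ {Ψ} b (e : Exponents Ψ) → nothings (cap b e) ≡ nothings e
nothings-cap b [] = refl
nothings-cap b (nothing ∷ e) = cong suc (nothings-cap b e)
nothings-cap b (just _ ∷ e) = nothings-cap b e

put : ∀ {B : Set} {Ψ : List Formula} {E} → E ∈ Ψ → B → All (λ _ → B) Ψ → All (λ _ → B) Ψ
put (here _) x (_ ∷ e) = x ∷ e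
put (there m) x (y ∷ e) = y ∷ put m x e

nothings-put : ∀ {Ψ E} (m : E ∈ Ψ) {i} (e : Exponents Ψ) → All.lookup e m ≡ nothing → nothings (put m (just i) e) ℕ.< nothings e
nothings-put (here refl) (nothing ∷ e) eq = ℕₚ.≤-refl
nothings-put (there m) (nothing ∷ e) eq = s≤s (nothings-put m e eq)
nothings-put (there m) (just _ ∷ e) eq = nothings-put m e eq

put-keeps : ∀ {Ψ E D} (m : E ∈ Ψ) (m′ : D ∈ Ψ) {x j} (e : Exponents Ψ) → All.lookup e m ≡ nothing →
  All.lookup e m′ ≡ just j → All.lookup (put m x e) m′ ≡ just j
put-keeps (here refl) (here refl) (nothing ∷ e) _ ()
put-keeps (here refl) (there m′) (_ ∷ e) _ eq = eq
put-keeps (there m) (here refl) (_ ∷ e) _ eq = eq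
put-keeps (there m) (there m′) (_ ∷ e) n eq = put-keeps m m′ e n eq

put-facts : ∀ {Ψ E i} {Q : Formula → Set} (m : E ∈ Ψ) (e : Exponents Ψ) → Q (iter ∇ i E) → All Q (facts e) → All Q (facts (put m (just i) e))
put-facts (here refl) (x ∷ e) q (_ ∷ qs) = q ∷ qs
put-facts (there m) (x ∷ e) q (p ∷ qs) = p ∷ put-facts m e q qs

join : ∀ {Ψ} → Exponents Ψ → Exponents Ψ → Exponents Ψ
join [] [] = []
join (nothing ∷ e) (y ∷ f) = y ∷ join e f
join (just i ∷ e) (nothing ∷ f) = just i ∷ join e f
join (just i ∷ e) (just j ∷ f) = just (i ℕ.⊔ j) ∷ join e f

blank : ∀ {Ψ} → Exponents Ψ
blank = All.tabulate λ _ → nothing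

lookup-blank : ∀ {Ψ E} (m : E ∈ Ψ) → All.lookup (blank {Ψ}) m ≡ nothing
lookup-blank {Ψ = _ ∷ _} (here refl) = refl
lookup-blank {Ψ = _ ∷ _} (there m) = lookup-blank m

Obeys : ∀ {Ψ} → (∀ {E} → E ∈ Ψ → ℕ → Set) → Exponents Ψ → Set
Obeys Q e = ∀ {E} (m : E ∈ _) i → All.lookup e m ≡ just i → Q m i

obeys-blank : ∀ {Ψ} {Q : ∀ {E} → E ∈ Ψ → ℕ → Set} → Obeys Q blank
obeys-blank m i eq with trans (sym eq) (lookup-blank m)
... | ()

obeys-join : ∀ {Ψ} {Q : ∀ {E} → E ∈ Ψ → ℕ → Set} (e f : Exponents Ψ) → Obeys Q e → Obeys Q f → Obeys Q (join e f)
obeys-join (nothing ∷ e) (y ∷ f) p q (here refl) i eq = q (here refl) i eq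
obeys-join (just j ∷ e) (nothing ∷ f) p q (here refl) i eq = p (here refl) i eq
obeys-join {Q = Q} (just j ∷ e) (just k ∷ f) p q (here refl) i refl with ℕₚ.⊔-sel j k
... | inj₁ eq = subst (Q (here refl)) (sym eq) (p (here refl) j refl)
... | inj₂ eq = subst (Q (here refl)) (sym eq) (q (here refl) k refl)
obeys-join (nothing ∷ e) (y ∷ f) p q (there m) i eq = obeys-join e f (p ∘ there) (q ∘ there) m i eq
obeys-join (just _ ∷ e) (nothing ∷ f) p q (there m) i eq = obeys-join e f (p ∘ there) (q ∘ there) m i eq
obeys-join (just _ ∷ e) (just _ ∷ f) p q (there m) i eq = obeys-join e f (p ∘ there) (q ∘ there) m i eq

obeys-put : ∀ {Ψ E} {Q : ∀ {E} → E ∈ Ψ → ℕ → Set} (m : E ∈ Ψ) {j} (e : Exponents Ψ) → Q m j → Obeys Q e → Obeys Q (put m (just j) e)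
obeys-put (here refl) (x ∷ e) q p (here refl) i refl = q
obeys-put (here refl) (x ∷ e) q p (there m′) i eq = p (there m′) i eq
obeys-put (there m) (x ∷ e) q p (here refl) i eq = p (here refl) i eq
obeys-put (there m) (x ∷ e) q p (there m′) i eq = obeys-put m e q (p ∘ there) m′ i eq

put-fact : ∀ {Ψ E i} (m : E ∈ Ψ) (e : Exponents Ψ) → iter ∇ i E ∈ facts (put m (just i) e)
put-fact (here refl) (_ ∷ e) = here refl
put-fact (there m) (_ ∷ e) = there (put-fact m e)

missing-put : ∀ {Ψ E} (m : E ∈ Ψ) (q : All (λ _ → Bool) Ψ) → ¬ T (All.lookup q m) → missing (put m true q) ℕ.< missing q
missing-put (here refl) (true ∷ q) n = ⊥-elim (n tt)
missing-put (here refl) (false ∷ q) n = ℕₚ.≤-refl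
missing-put (there m) (true ∷ q) n = missing-put m q n
missing-put (there m) (false ∷ q) n = s≤s (missing-put m q n)

put-true : ∀ {Ψ E D} (m : E ∈ Ψ) (m′ : D ∈ Ψ) (q : All (λ _ → Bool) Ψ) → T (All.lookup (put m true q) m′) → T (All.lookup q m′) ⊎ D ≡ E
put-true (here refl) (here refl) (_ ∷ q) o = inj₂ refl
put-true (here refl) (there m′) (_ ∷ q) o = inj₁ o
put-true (there m) (here refl) (_ ∷ q) o = inj₁ o
put-true (there m) (there m′) (_ ∷ q) o = put-true m m′ q o

all-false : ∀ {Ψ : List Formula} → All (λ _ → Bool) Ψ
all-false = All.tabulate λ _ → false

no-bits : ∀ {Ψ : List Formula} {E} (m : E ∈ Ψ) → ¬ T (All.lookup (all-false {Ψ}) m)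
no-bits {_ ∷ Ψ} (here refl) ()
no-bits {_ ∷ Ψ} (there m) o = no-bits {Ψ} m o

-- Canonical worlds whose orbit is constant on Φ after boundedly many steps are cofinal among those that omit a formula.
module Approximation (𝓡 : SchemeSet) (Ans : Set) (Φ : List Formula) (cl : Closed Φ) where
  open Calculus 𝓡
  open Classical Ans
  open Canonical 𝓡 Ans
  open States 𝓡 Ans Φ cl
  open Dickson Ans

  Tame : ℕ → World → Set
  Tame b W = ∀ E → E ∈ Φ → ∀ i → (mem W (iter ∇ b E) → mem W (iter ∇ (b ℕ.+ i) E)) × (mem W (iter ∇ (b ℕ.+ i) E) → mem W (iter ∇ b E))

  Approx : ℕ → Set₁
  Approx b = ∀ C → C ∈ Φ → ∀ Y → (mem Y C → Ans) →
    K (Σ World λ W → Tame b W × (mem W C → Ans) × (∀ E → E ∈ Φ → ∀ i → mem Y (iter ∇ i E) → mem W (iter ∇ i E)))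

  uniform : ∀ {U : Formula → Exponents Φ → Set} → (∀ C {e f} → e ≤ᵛ f → U C e → U C f) → K (∃ λ b → ∀ C → C ∈ Φ → Saturates (U C) b)
  uniform {U} mono = go Φ
    where
    go : ∀ Ψ → K (∃ λ b → ∀ C → C ∈ Ψ → Saturates (U C) b)
    go [] = return (0 , λ _ ())
    go (C ∷ Ψ) = dickson Φ (U C) (mono C) >>= λ { (b , s) → go Ψ >>= λ { (c , ss) →
      return (b ℕ.⊔ c , λ { D (here refl) → saturates-mono {U = U C} (mono C) (ℕₚ.m≤m⊔n b c) s
                        ; D (there m) → saturates-mono {U = U D} (mono D) (ℕₚ.m≤n⊔m b c) (ss D m) }) } }

  module Rising (f : F ∈R 𝓡) where

    raise : ∀ {i j} E → i ℕ.≤ j → 𝓡 ⊢ iter ∇ i E ∷ [] ⇒ iter ∇ j E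
    raise {i} E l = subst (λ k → 𝓡 ⊢ iter ∇ i E ∷ [] ⇒ iter ∇ k E) (ℕₚ.m∸n+n≡m l) (go (_ ℕ.∸ i))
      where
      go : ∀ k → 𝓡 ⊢ iter ∇ i E ∷ [] ⇒ iter ∇ (k ℕ.+ i) E
      go zero = ax
      go (suc k) = schF f (go k)

    facts-mono : ∀ {Ψ} {e e′ : Exponents Ψ} → e ≤ᵛ e′ → ∀ {D} → D ∈ facts e′ → 𝓡 ⊢ facts e ⇒ D
    facts-mono (none ∷ l) (here refl) = R⊤
    facts-mono {E ∷ _} (some l ∷ _) (here refl) = weaken (λ { (here refl) → here refl }) (raise E l)
    facts-mono (_ ∷ l) (there m) = weaken there (facts-mono l m)

    -- F makes facts weaker as exponents grow, so the safe vectors are upward closed; under P the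
    -- deriving ones are.
    Safe : Formula → Exponents Φ → Set
    Safe C e = 𝓡 ⊢ facts e ⇒ C → Ans

    module _ (b : ℕ) {C : Formula} (sat : Saturates (Safe C) b) (Y : World) (avoids : mem Y C → Ans) where

      Covers : Exponents Φ → Set
      Covers e = ∀ {E} (m : E ∈ Φ) i → mem Y (iter ∇ i E) → K (∃ λ j → j ℕ.≤ i × All.lookup e m ≡ just j)

      record Candidate (k : ℕ) : Set where
        constructor candidate
        field
          exps   : Exponents Φ
          covers : Covers exps
          safe   : Safe C exps
          few    : nothings exps ℕ.≤ k

      start : K (∃ Candidate)
      start k = go Φ λ { (e , cov , all) → k (nothings e , candidate e (λ m → cov _ m) (λ d → avoids (closed Y all d)) ℕₚ.≤-refl) }
        where
        Cov : ∀ Ψ → Exponents Ψ → Set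
        Cov Ψ e = ∀ E (m : E ∈ Ψ) i → mem Y (iter ∇ i E) → K (∃ λ j → j ℕ.≤ i × All.lookup e m ≡ just j)
        go : ∀ Ψ → K (Σ (Exponents Ψ) λ e → Cov Ψ e × All (mem Y) (facts e))
        go [] = return ([] , (λ _ ()) , [])
        go (E ∷ Ψ) = go Ψ >>= λ { (e , cov , all) → em (∃ λ i → mem Y (iter ∇ i E)) >>= λ
          { (inj₁ (i , y)) → least {λ i → mem Y (iter ∇ i E)} i y >>= λ { (k , yk , min) → return (just k ∷ e
              , (λ { _ (here refl) i y → first k min i y ; D (there m) → cov D m }) , yk ∷ all) }
          ; (inj₂ n) → return (nothing ∷ e , (λ { _ (here refl) i y _ → n (i , y) ; D (there m) → cov D m }) , closed Y [] R⊤ ∷ all) } }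
          where
          first : ∀ k → (∀ j → j ℕ.< k → mem Y (iter ∇ j E) → Ans) → ∀ i → mem Y (iter ∇ i E) → K (∃ λ j → j ℕ.≤ i × just k ≡ just j)
          first k min i y with k ℕ.≤? i
          ... | yes l = return (k , l , refl)
          ... | no l = λ _ → min i (ℕₚ.≰⇒> l) y

      module _ {k : ℕ} (c : Candidate k) (minimal : ∀ j → j ℕ.< k → Candidate j → Ans) where
        open Candidate c

        e : Exponents Φ
        e = cap b exps

        covers-e : Covers e
        covers-e m i y = covers m i y >>= λ { (j , l , eq) →
          return (j ℕ.⊓ b , ℕₚ.≤-trans (ℕₚ.m⊓n≤m j b) l , trans (lookup-cap b exps m) (cong (Maybe.map (ℕ._⊓ b)) eq)) }

        small : ∀ {E} (m : E ∈ Φ) {j} → All.lookup e m ≡ just j → j ℕ.≤ b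
        small m {j} eq with All.lookup exps m | trans (sym (lookup-cap b exps m)) eq
        ... | just i | refl = ℕₚ.m⊓n≤n i b

        module _ (safe-e : Safe C e) where

          open Avoid (_∈ facts e) C (λ ms d → safe-e (weaken (All.lookup ms) d))

          -- A formula with an exponent has one at most `b`, so it is present from `b` on. One
          -- without an exponent cannot appear later: recording it would give a candidate with fewer
          -- absences than the minimum.
          tame : Tame b world
          tame E m i = (λ x → entails world x (raise E (ℕₚ.m≤m+n b i))) , back (All.lookup e m) refl
            where
            back : ∀ x → All.lookup e m ≡ x → mem world (iter ∇ (b ℕ.+ i) E) → mem world (iter ∇ b E)
            back (just j) eq _ = entails world (world-⊇ (just-fact e m eq)) (raise E (small m eq))
            back nothing eq x = stable world λ _ → minimal _
              (ℕₚ.<-≤-trans (nothings-put m e eq) (ℕₚ.≤-trans (ℕₚ.≤-reflexive (nothings-cap b exps)) few))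
              (candidate (put m (just (b ℕ.+ i)) e)
                (λ m′ i′ y → covers-e m′ i′ y >>= λ { (j , l , eq′) → return (j , l , put-keeps m m′ e eq eq′) })
                (λ d → world-avoids (closed world (put-facts m e x (All.tabulate world-⊇)) d)) ℕₚ.≤-refl)

          approximated : Σ World λ W → Tame b W × (mem W C → Ans) × (∀ E → E ∈ Φ → ∀ i → mem Y (iter ∇ i E) → mem W (iter ∇ i E))
          approximated = world , tame , world-avoids , λ E m i y → stable world (covers-e m i y >>= λ { (j , l , eq) →
            return (entails world (world-⊇ (just-fact e m eq)) (raise E l)) })

    approx : K (∃ Approx)
    approx = uniform {Safe} (λ C l s d → s (cuts (facts-mono l) d)) >>= λ { (b , sat) → return (b , λ C m Y n →
      start b (sat C m) Y n >>= λ { (k , c) → least {Candidate b (sat C m) Y n} k c >>= λ { (k′ , c′ , min) →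
      sat C m (Candidate.exps c′) (Candidate.safe c′) >>= λ safe-e →
      return (approximated b (sat C m) Y n c′ min safe-e) } }) }

  module Falling (p : P ∈R 𝓡) where

    lower : ∀ {i j} E → i ℕ.≤ j → 𝓡 ⊢ iter ∇ j E ∷ [] ⇒ iter ∇ i E
    lower {i} E l = subst (λ k → 𝓡 ⊢ iter ∇ k E ∷ [] ⇒ iter ∇ i E) (ℕₚ.m∸n+n≡m l) (go (_ ℕ.∸ i))
      where
      go : ∀ k → 𝓡 ⊢ iter ∇ (k ℕ.+ i) E ∷ [] ⇒ iter ∇ i E
      go zero = ax
      go (suc k) = schP p ax ⨟ go k

    facts-mono : ∀ {Ψ} {e e′ : Exponents Ψ} → e ≤ᵛ e′ → ∀ {D} → D ∈ facts e → 𝓡 ⊢ facts e′ ⇒ D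
    facts-mono (none ∷ l) (here refl) = R⊤
    facts-mono {E ∷ _} (some l ∷ _) (here refl) = weaken (λ { (here refl) → here refl }) (lower E l)
    facts-mono (_ ∷ l) (there m) = weaken there (facts-mono l m)

    join₁ : ∀ {Ψ} (e e′ : Exponents Ψ) → ∀ {D} → D ∈ facts e → 𝓡 ⊢ facts (join e e′) ⇒ D
    join₁ (nothing ∷ e) (y ∷ e′) (here refl) = R⊤
    join₁ (just i ∷ e) (nothing ∷ e′) (here refl) = hyp (here refl)
    join₁ {E ∷ _} (just i ∷ e) (just j ∷ e′) (here refl) = weaken (λ { (here refl) → here refl }) (lower E (ℕₚ.m≤m⊔n i j))
    join₁ (nothing ∷ e) (y ∷ e′) (there m) = weaken there (join₁ e e′ m)
    join₁ (just i ∷ e) (nothing ∷ e′) (there m) = weaken there (join₁ e e′ m)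
    join₁ (just i ∷ e) (just j ∷ e′) (there m) = weaken there (join₁ e e′ m)

    join₂ : ∀ {Ψ} (e e′ : Exponents Ψ) → ∀ {D} → D ∈ facts e′ → 𝓡 ⊢ facts (join e e′) ⇒ D
    join₂ (nothing ∷ e) (y ∷ e′) (here refl) = hyp (here refl)
    join₂ (just i ∷ e) (nothing ∷ e′) (here refl) = R⊤
    join₂ {E ∷ _} (just i ∷ e) (just j ∷ e′) (here refl) = weaken (λ { (here refl) → here refl }) (lower E (ℕₚ.m≤n⊔m i j))
    join₂ (nothing ∷ e) (y ∷ e′) (there m) = weaken there (join₂ e e′ m)
    join₂ (just i ∷ e) (nothing ∷ e′) (there m) = weaken there (join₂ e e′ m)
    join₂ (just i ∷ e) (just j ∷ e′) (there m) = weaken there (join₂ e e′ m)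

    Derives : Formula → Exponents Φ → Set
    Derives C e = 𝓡 ⊢ facts e ⇒ C

    module _ (b : ℕ) {C : Formula} (sat : Saturates (Derives C) b) (Y : World) (avoids : mem Y C → Ans) where

      Allowed : State → ∀ {E} → E ∈ Φ → ℕ → Set
      Allowed s {E} m i = On s m ⊎ mem Y (iter ∇ i E)

      -- The formulas marked by unbounded can be added at every exponent.
      record Candidate (k : ℕ) : Set where
        constructor candidate
        field
          unbounded : State
          safe      : ∀ e → Obeys (Allowed unbounded) e → 𝓡 ⊢ facts e ⇒ C → Ans
          few       : missing unbounded ℕ.≤ k

      start : Candidate (missing (all-false {Φ}))
      start = candidate all-false
        (λ e ob d → avoids (closed Y (all-facts (closed Y [] R⊤) e λ m i eq → present m i (ob m i eq)) d)) ℕₚ.≤-refl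
        where
        present : ∀ {E} (m : E ∈ Φ) i → Allowed all-false m i → mem Y (iter ∇ i E)
        present m i (inj₁ (bit o)) = ⊥-elim (no-bits m o)
        present m i (inj₂ y) = y

      module _ {k : ℕ} (c : Candidate k) (minimal : ∀ j → j ℕ.< k → Candidate j → Ans) where
        open Candidate c

        T₀ : Theory
        T₀ D = Σ (Exponents Φ) λ e → Obeys (Allowed unbounded) e × 𝓡 ⊢ facts e ⇒ D

        -- Under P a larger exponent is the stronger fact, so the maximum of the exponents handles
        -- several allowed facts about one formula.
        gather : ∀ {Γ} → All T₀ Γ → Σ (Exponents Φ) λ e → Obeys (Allowed unbounded) e × (∀ D → D ∈ Γ → 𝓡 ⊢ facts e ⇒ D)
        gather [] = blank , (λ m → obeys-blank {Q = Allowed unbounded} m) , λ _ ()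
        gather ((e , ob , d) ∷ ts) with gather ts
        ... | e′ , ob′ , ds = join e e′ , (λ m → obeys-join e e′ (λ m → ob m) (λ m → ob′ m) m) , λ
          { D (here refl) → cuts (join₁ e e′) d ; D (there m) → cuts (join₂ e e′) (ds D m) }

        T₀-avoids : ∀ {Γ} → All T₀ Γ → 𝓡 ⊢ Γ ⇒ C → Ans
        T₀-avoids ts d = let (e , ob , ds) = gather ts in safe e (λ m → ob m) (cuts (λ m → ds _ m) d)

        open Avoid T₀ C T₀-avoids

        contains : ∀ {E} (m : E ∈ Φ) i → Allowed unbounded m i → mem world (iter ∇ i E)
        contains m i a = world-⊇ (put m (just i) blank
          , (λ m′ → obeys-put {Q = Allowed unbounded} m blank a (λ m″ → obeys-blank {Q = Allowed unbounded} m″) m′)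
          , hyp (put-fact m blank))

        -- If `∇ᵇ E` holds and `E` is not marked, marking it would be safe: capping at `b` turns a
        -- derivation of `C` into one from facts of the world. This contradicts the maximality of
        -- the marked set.
        tame : Tame b world
        tame E m i = grow (On? unbounded m) , λ x → entails world x (lower E (ℕₚ.m≤m+n b i))
          where
          grow : Dec (On unbounded m) → mem world (iter ∇ b E) → mem world (iter ∇ (b ℕ.+ i) E)
          grow (yes o) _ = contains m (b ℕ.+ i) (inj₁ o)
          grow (no n) x = stable world λ _ → minimal _
            (ℕₚ.<-≤-trans (missing-put m unbounded (n ∘ bit)) few)
            (candidate (put m true unbounded) safe′ ℕₚ.≤-refl)
            where
            safe′ : ∀ e → Obeys (Allowed (put m true unbounded)) e → 𝓡 ⊢ facts e ⇒ C → Ans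
            safe′ e ob d = sat e d λ d′ → world-avoids (closed world (all-facts (closed world [] R⊤) (cap b e) λ m′ j eq →
              member m′ j (All.lookup e m′) refl (trans (sym (lookup-cap b e m′)) eq)) d′)
              where
              member : ∀ {D} (m′ : D ∈ Φ) j x → All.lookup e m′ ≡ x → Maybe.map (ℕ._⊓ b) x ≡ just j → mem world (iter ∇ j D)
              member {D} m′ _ (just j) eq refl with ob m′ j eq
              ... | inj₂ y = entails world (contains m′ j (inj₂ y)) (lower D (ℕₚ.m⊓n≤m j b))
              ... | inj₁ (bit o) with put-true m m′ unbounded o
              ... | inj₁ o′ = contains m′ (j ℕ.⊓ b) (inj₁ (bit o′))
              ... | inj₂ refl = entails world x (lower E (ℕₚ.m⊓n≤n j b))

        approximated : Σ World λ W → Tame b W × (mem W C → Ans) × (∀ E → E ∈ Φ → ∀ i → mem Y (iter ∇ i E) → mem W (iter ∇ i E))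
        approximated = world , tame , world-avoids , λ E m i y → contains m i (inj₂ y)

    approx : K (∃ Approx)
    approx = uniform {Derives} (λ C l d → cuts (facts-mono l) d) >>= λ { (b , sat) → return (b , λ C m Y n →
      least {Candidate b (sat C m) Y n} _ (start b (sat C m) Y n) >>= λ { (k , c , min) →
      return (approximated b (sat C m) Y n c min) }) }

-- The countermodel for N with one of F and P, without H.

ent-last : ∀ {A : Set} {L} (v : Vec A (suc L)) n → L ℕ.≤ n → ent v n ≡ ent v L
ent-last {L = zero} (x ∷ []) n l = refl
ent-last {L = suc L} (x ∷ v) (suc n) (s≤s l) = ent-last v n l

ent-⊓ : ∀ {A : Set} {L} (v : Vec A (suc L)) i r → ent v (i ℕ.+ r) ≡ ent v (i ℕ.⊓ L ℕ.+ r)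
ent-⊓ {L = L} v i r with ℕₚ.≤-total i L
... | inj₁ l = cong (λ k → ent v (k ℕ.+ r)) (sym (ℕₚ.m≤n⇒m⊓n≡m l))
... | inj₂ l = trans (ent-last v _ (ℕₚ.≤-trans l (ℕₚ.m≤m+n i r)))
  (sym (ent-last v _ (ℕₚ.≤-trans (ℕₚ.≤-reflexive (sym (ℕₚ.m≥n⇒m⊓n≡n l))) (ℕₚ.m≤m+n _ r))))

module TameModel (𝓡 : SchemeSet) (Γ : List Formula) (A : Formula)
  (valid : ∀ (ℓ : Level) (M : KripkeModel ℓ) → IsK M 𝓡 → Valid M Γ A) (n : N ∈R 𝓡) (noH : ¬ (H ∈R 𝓡))
  (d : Drift) (noP : P ∈R 𝓡 → d ≡ down) (noF : F ∈R 𝓡 → d ≡ up) where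

  open Root 𝓡 Γ A
  open Calculus 𝓡
  open Classical Ans
  open Canonical 𝓡 Ans
  open States 𝓡 Ans Φ cl
  open Labels 𝓡 Ans Φ cl
  open Iterated 𝓡 Ans Φ cl (inj₁ n) hiding (Realized; module Select; K-local)
  open Approximation 𝓡 Ans Φ cl

  module _ (b : ℕ) (approx : Approx b) where

    Win : Set
    Win = Vec State (suc b)

    -- Entries after `b` repeat the one at `b`, so finitely many instances determine a statement
    -- about the whole orbit.
    K-always : {Q : ℕ → Set} → (∀ k → b ℕ.≤ k → Q b → Q k) → (∀ k → K (Q k)) → K (∀ k → Q k)
    K-always {Q} frozen f = K-upto b (λ k _ → f k) >>= λ g → return λ k → choose k g (ℕₚ.≤-total k b)
      where
      choose : ∀ k → (∀ k → k ℕ.≤ b → Q k) → k ℕ.≤ b ⊎ b ℕ.≤ k → Q k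
      choose k g (inj₁ l) = g k l
      choose k g (inj₂ l) = frozen k l (g b ℕₚ.≤-refl)

    Along : World → Win → Set
    Along Z x = ∀ k → Real (mem (pre k Z)) (ent x k)

    record Orbit (x : Win) : Set where
      constructor orbit
      field
        lawful  : ∀ k → Laws (ent x k)
        linked  : ∀ k → Pred (ent x k) (ent x (suc k))
        rising  : F ∈R 𝓡 → ∀ k → ent x k ⊆ᵗ ent x (suc k)
        falling : P ∈R 𝓡 → ∀ k → ent x (suc k) ⊆ᵗ ent x k

    last² : ∀ {x : Win} (Q : State → State → Set) k → b ℕ.≤ k → Q (ent x b) (ent x (suc b)) → Q (ent x k) (ent x (suc k))
    last² {x} Q k l = subst₂ Q (sym (ent-last x k l))
      (trans (ent-last x (suc b) (ℕₚ.n≤1+n b)) (sym (ent-last x (suc k) (ℕₚ.m≤n⇒m≤1+n l))))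

    K-orbit : ∀ Z {x} → Along Z x → K (Orbit x)
    K-orbit Z {x} r =
      K-always (λ k l → subst Laws (sym (ent-last x k l))) (λ k → K-laws (pre k Z) (r k)) >>= λ ls →
      K-always (last² {x} Pred) (λ k → K-Pred (r k) (r (suc k)) id id) >>= λ ps →
      K-imp (T? (𝓡 F)) (λ f → K-always (last² {x} _⊆ᵗ_) (λ k → K-⊆ (r k) (r (suc k)) (λ _ z → entails (pre k Z) z (schF f ax)))) >>= λ rs →
      K-imp (T? (𝓡 P)) (λ p → K-always (last² {x} (λ q q′ → q′ ⊆ᵗ q)) (λ k → K-⊆ (r (suc k)) (r k) (λ _ z → entails (pre k Z) z (schP p ax)))) >>= λ fs →
      return (orbit ls ps rs fs)

    Realized : Win → Set₁
    Realized x = Orbit x × Σ World λ Z → Along Z x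

    module _ (sel : Selection Realized) where

      Pt : Set
      Pt = Σ Win (T ∘ proj₁ sel)

      info : (x : Pt) → Realized (proj₁ x)
      info x = proj₁ (proj₂ sel) (proj₂ x)

      world-of : Pt → World
      world-of x = proj₁ (proj₂ (info x))

      along : ∀ x → Along (world-of x) (proj₁ x)
      along x = proj₂ (proj₂ (info x))

      module Orb (x : Pt) = Orbit (proj₁ (info x))

      point : ∀ W → Tame b W → K (Σ Pt λ x → Along W (proj₁ x))
      point W t = realizeVec b W >>= λ { (x , r) →
        let al = λ k → full x r k (ℕₚ.≤-total k b) in
        K-orbit W {x} al >>= λ o → proj₂ (proj₂ sel) (o , W , al) >>= λ s → return ((x , s) , al) }
        where
        full : ∀ x → RealVec W x → ∀ k → k ℕ.≤ b ⊎ b ℕ.≤ k → Real (mem (pre k W)) (ent x k)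
        full x r k (inj₁ l) = r k l
        full x r k (inj₂ l) = subst (Real (mem (pre k W))) (sym (ent-last x k l)) record
          { holds = λ {E} m o → subst id (sym (pre-mem k W E)) (subst (λ j → mem W (iter ∇ j E)) (ℕₚ.m+[n∸m]≡n l)
              (proj₁ (t E m (k ℕ.∸ b)) (subst id (pre-mem b W E) (holds (r b ℕₚ.≤-refl) m o))))
          ; off = λ {E} m o z → off (r b ℕₚ.≤-refl) m o (subst id (sym (pre-mem b W E)) (proj₂ (t E m (k ℕ.∸ b))
              (subst (λ j → mem W (iter ∇ j E)) (sym (ℕₚ.m+[n∸m]≡n l)) (subst id (pre-mem k W E) z)))) }

      Over : Pt → ℕ → Pt → Set
      Over x i y = ∀ r → ent (proj₁ x) (i ℕ.+ r) ⊆ᵗ ent (proj₁ y) (suc r)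

      -- The canonical answer `Y` may have an orbit that stabilises late; it is replaced by a tame
      -- world above it that still omits `C`. Since all iterates of `∇` on Φ are kept, accessibility
      -- persists.
      answer : ∀ x i {Y C} → pre i (world-of x) ↦ Y → C ∈ Φ → (mem Y C → Ans) →
        K (Σ Pt λ y → Over x i y × Σ World λ W → Real (mem W) (ent (proj₁ y) 0) × (mem W C → Ans) × (∀ E → E ∈ Φ → mem Y E → mem W E))
      answer x i {Y} {C} f m nc = approx C m Y nc >>= λ { (W , t , nw , g) → point W t >>= λ { (y , al) →
        K-always {λ r → ent (proj₁ x) (i ℕ.+ r) ⊆ᵗ ent (proj₁ y) (suc r)}
          (λ r l → subst₂ _⊆ᵗ_
            (trans (ent-last (proj₁ x) (i ℕ.+ b) (ℕₚ.m≤n+m b i)) (sym (ent-last (proj₁ x) (i ℕ.+ r) (ℕₚ.≤-trans l (ℕₚ.m≤n+m r i)))))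
            (trans (ent-last (proj₁ y) (suc b) (ℕₚ.n≤1+n b)) (sym (ent-last (proj₁ y) (suc r) (ℕₚ.m≤n⇒m≤1+n l)))))
          (λ r → K-⊆ (along x (i ℕ.+ r)) (al (suc r)) λ {E} mE z →
            subst id (sym (pre-mem (suc r) W E)) (g E mE (suc r) (f {iter ∇ r E} (subst id (e r E) z)))) >>= λ ov →
        return (y , ov , W , al 0 , nw , λ E mE → g E mE 0) } }
        where
        e : ∀ k E → mem (pre (i ℕ.+ k) (world-of x)) E ≡ mem (pre i (world-of x)) (iter ∇ k E)
        e k E = trans (pre-mem (i ℕ.+ k) (world-of x) E) (trans (cong (mem (world-of x)) (sym (iter-+ i k E))) (sym (pre-mem i (world-of x) (iter ∇ k E))))

      Demand : Pt → ℕ → ∀ {E} → E ∈ Φ → Set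
      Demand x i {B ⊸ C} m = On (ent (proj₁ x) i) m ⊎
        Σ Pt λ y → Over x i y × On (ent (proj₁ y) 0) (sub₁⊸ m) × ¬ On (ent (proj₁ y) 0) (sub₂⊸ m)
      Demand _ _ _ = ⊤

      demand : ∀ x i {E} (m : E ∈ Φ) → K (Demand x i m)
      demand x i {atom _} m = return tt
      demand x i {⊤′} m = return tt
      demand x i {⊥′} m = return tt
      demand x i {𝟏} m = return tt
      demand x i {_ ∧ _} m = return tt
      demand x i {_ ∨ _} m = return tt
      demand x i {_ ⊗ _} m = return tt
      demand x i {∇ _} m = return tt
      demand x i {B ⊸ C} m = case (On? (ent (proj₁ x) i) m)
        where
        case : Dec (On (ent (proj₁ x) i) m) → K _
        case (yes o) = return (inj₁ o)
        case (no o) =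
          let (Y , f , yb , nc) = refute-⊸ (pre i (world-of x)) (off (along x i) m o) in
          answer x i {Y} f (sub₂⊸ m) nc >>= λ { (y , ov , W , r , nw , g) →
          on r _ (g B (sub₁⊸ m) yb) >>= λ ob → K-off r _ nw >>= λ oc → return (inj₂ (y , ov , ob , oc)) }

      module _ (demands : ∀ x i → i ℕ.≤ b → ∀ {E} (m : E ∈ Φ) → Demand x i m)
        (serials : wF ∈R 𝓡 → ∀ x i → i ℕ.≤ b → Σ Pt (Over x i))
        (x₀ : Pt) (W₀ : World) (r₀ : Real (mem W₀) (ent (proj₁ x₀) 0)) (n₀ : mem W₀ A → Ans) (g₀ : ∀ {B} → B ∈ Γ → mem W₀ B) where

        X : Set
        X = Pt × ℕ

        st : X → State
        st (x , i) = ent (proj₁ x) i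

        π : X → X
        π (x , i) = x , suc i

        infix 4 _≼_
        record _≼_ (u v : X) : Set where
          constructor below
          field throughout : ∀ r → ent (proj₁ (proj₁ u)) (proj₂ u ℕ.+ r) ⊆ᵗ ent (proj₁ (proj₁ v)) (proj₂ v ℕ.+ r)
        open _≼_

        ≼-st : ∀ {u v} → u ≼ v → st u ⊆ᵗ st v
        ≼-st {x , i} {y , j} l = subst₂ (λ k k′ → ent (proj₁ x) k ⊆ᵗ ent (proj₁ y) k′) (ℕₚ.+-identityʳ i) (ℕₚ.+-identityʳ j) (throughout l 0)

        π-mono : ∀ {u v} → u ≼ v → π u ≼ π v
        π-mono {x , i} {y , j} l = below λ r → subst₂ (λ k k′ → ent (proj₁ x) k ⊆ᵗ ent (proj₁ y) k′) (ℕₚ.+-suc i r) (ℕₚ.+-suc j r) (throughout l (suc r))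

        ⊓-on : ∀ (x : Pt) i {E} {m : E ∈ Φ} → On (ent (proj₁ x) (i ℕ.⊓ b)) m → On (ent (proj₁ x) i) m
        ⊓-on x i {m = m} = subst (λ q → On q m) (sym (trans (cong (ent (proj₁ x)) (sym (ℕₚ.+-identityʳ i)))
          (trans (ent-⊓ (proj₁ x) i 0) (cong (ent (proj₁ x)) (ℕₚ.+-identityʳ (i ℕ.⊓ b))))))

        enter : ∀ x i {y} → Over x (i ℕ.⊓ b) y → (x , i) ≼ π (y , 0)
        enter x i {y} ov = below λ r → subst (_⊆ᵗ ent (proj₁ y) (suc r)) (sym (ent-⊓ (proj₁ x) i r)) (ov r)

        points : Points
        points = record
          { X = X ; R₀ = λ u v → u ≼ π v ; st = st ; ok = λ _ _ → ⊤ ; laws = λ { {x , i} _ → Orb.lawful x i }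
          ; ok∧ = λ _ → tt , tt ; ok∨ = λ _ → tt , tt ; ok⊗ = λ _ → tt , tt ; ok⊸ = λ _ _ → tt , tt ; ok∇ = λ _ _ → tt
          ; ⊸⁻ = λ { {x , i} {y , j} m _ o l a → law (Orb.lawful y j) m
              (up∇ (Orb.linked y j) (sub∇⊸ m) (coherent (Orb.lawful y (suc j)) m _ (app (≼-st l) m o))) a }
          ; ⊸? = λ { {x , i} m _ → imp? x i m }
          ; ∇⁺ = λ { {x , i} m _ l a → up∇ (Orb.linked x i) m (app (≼-st l) _ a) }
          ; ∇⁻ = λ { {x , i} m _ o → (x , suc i) , below (λ _ → ⊆ᵗ-refl) , down∇ (Orb.linked x i) m o } }
          where
          imp? : ∀ x i {B C} (m : (B ⊸ C) ∈ Φ) → On (ent (proj₁ x) i) m ⊎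
            Σ X λ v → (x , i) ≼ π v × On (st v) (sub₁⊸ m) × ¬ On (st v) (sub₂⊸ m)
          imp? x i m with demands x (i ℕ.⊓ b) (ℕₚ.m⊓n≤n i b) m
          ... | inj₁ o = inj₁ (⊓-on x i o)
          ... | inj₂ (y , ov , ob , oc) = inj₂ ((y , 0) , enter x i {y} ov , ob , oc)

        ≼-refl : ∀ {u} → u ≼ u
        ≼-refl = below λ _ → ⊆ᵗ-refl

        ≼-trans : ∀ {u v w} → u ≼ v → v ≼ w → u ≼ w
        ≼-trans (below f) (below g) = below λ r → ⊆ᵗ-trans (f r) (g r)

        ≼-atom : ∀ {p u v} → u ≼ v → st u ∋ᵗ atom p → st v ∋ᵗ atom p
        ≼-atom l (m , o) = m , app (≼-st l) m o

        module Fr = Normal.Frame (labelled points) _≼_ ≼-refl ≼-trans π π-mono id id ≼-atom d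

        isK : IsK Fr.model 𝓡
        isK N _ = Fr.condN
        isK H h = ⊥-elim (noH h)
        isK P p = Fr.condP (λ { (x , i) → below λ r → Orb.falling x p (i ℕ.+ r) }) (noP p)
        isK F f = Fr.condF (λ { (x , i) → below λ r → Orb.rising x f (i ℕ.+ r) }) (noF f)
        isK wF w = Fr.condwF λ { (x , i) → let (y , ov) = serials w x (i ℕ.⊓ b) (ℕₚ.m⊓n≤n i b) in (y , 0) , enter x i {y} ov }

        conclude : Ans
        conclude = K-off r₀ A∈Φ n₀ λ nA → K-All (λ m → on r₀ (Γ⊑Φ m) (g₀ m) >>= λ o → return (m , o)) λ g →
          ⊥-elim (Fr.refuting (x₀ , 0) (All.map (λ { (m , o) → (Γ⊑Φ m , tt) , Γ⊑Φ m , o }) g)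
            (A∈Φ , tt) (λ a → nA (pick (Orb.lawful x₀ 0) a A∈Φ)) (valid 0ℓ _ isK))

    result : Ans
    result = (select Realized (finite-Vec finite-State) >>= λ sel →
      finite-T (proj₁ sel) (finite-Vec finite-State) (λ x → K-upto b (λ i _ → K-Everywhere (demand sel x i))) >>= λ demands →
      K-imp (T? (𝓡 wF)) (λ w → finite-T (proj₁ sel) (finite-Vec finite-State) (λ x → K-upto b (λ i _ →
        let (Y , f) = serial w (pre i (world-of sel x)) in
        answer sel x i {Y} f (sfs-⊥ (A ∷ Γ)) (proper Y) >>= λ { (y , ov , _) → return (y , ov) }))) >>= λ serials →
      approx A A∈Φ root root-avoids >>= λ { (W₀ , t , n₀ , g) → point sel W₀ t >>= λ { (x₀ , al) →
      return (conclude sel (λ x i l m → each (demands x i l) m) serials x₀ W₀ (al 0) n₀ (λ m → g _ (Γ⊑Φ m) 0 (root-⊇ m))) } }) id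

-- Combining the cases.

module _ (𝓡 : SchemeSet) (Γ : List Formula) (A : Formula)
  (valid : ∀ (ℓ : Level) (M : KripkeModel ℓ) → IsK M 𝓡 → Valid M Γ A) (n : N ∈R 𝓡) (noH : ¬ (H ∈R 𝓡)) where
  open Root 𝓡 Γ A

  tame-rising : F ∈R 𝓡 → ¬ (P ∈R 𝓡) → 𝓡 ⊢ Γ ⇒ A
  tame-rising f np = Approximation.Rising.approx 𝓡 Ans Φ cl f λ { (b , ap) →
    TameModel.result 𝓡 Γ A valid n noH up (λ p → ⊥-elim (np p)) (λ _ → refl) b ap }

  tame-falling : P ∈R 𝓡 → ¬ (F ∈R 𝓡) → 𝓡 ⊢ Γ ⇒ A
  tame-falling p nf = Approximation.Falling.approx 𝓡 Ans Φ cl p λ { (b , ap) →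
    TameModel.result 𝓡 Γ A valid n noH down (λ _ → refl) (λ f → ⊥-elim (nf f)) b ap }

theorem8p8 : (𝓡 : SchemeSet) (Γ : List Formula) (A : Formula)
  → (∀ (ℓ : Level) (M : KripkeModel ℓ) → IsK M 𝓡 → Valid M Γ A)
  → 𝓡 ⊢ Γ ⇒ A
theorem8p8 𝓡 Γ A valid with T? (𝓡 F) | T? (𝓡 P) | T? (𝓡 H) | T? (𝓡 N)
... | yes f | yes p | _     | _     = Finitary.outcome 𝓡 Γ A valid λ o → proj₁ o f p
... | yes f | no ¬p | yes h | _     = GrowingModel.result 𝓡 Γ A valid h up f (λ p → ⊥-elim (¬p p)) (λ _ → refl)
... | no ¬f | yes p | yes h | _     = GrowingModel.result 𝓡 Γ A valid h down p (λ _ → refl) (λ f → ⊥-elim (¬f f))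
... | no ¬f | no ¬p | yes h | _     = HModel.result 𝓡 Γ A valid h ¬p ¬f
... | yes f | no ¬p | no ¬h | yes n = tame-rising 𝓡 Γ A valid n ¬h f ¬p
... | no ¬f | yes p | no ¬h | yes n = tame-falling 𝓡 Γ A valid n ¬h p ¬f
... | no ¬f | no ¬p | no ¬h | yes n = NModel.result 𝓡 Γ A valid n ¬h ¬p ¬f
... | no ¬f | yes p | no ¬h | no ¬n = Finitary.outcome 𝓡 Γ A valid λ o → proj₁ (proj₂ o) ¬n ¬h ¬f p
... | _     | no ¬p | no ¬h | no ¬n = Finitary.outcome 𝓡 Γ A valid λ o → proj₂ (proj₂ o) ¬n ¬h ¬p
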